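{- Let $m \geq 2$ and $N \geq 2$. Then \[\lim_{d \rightarrow \infty} \dfrac{\#\{f \in \mathcal{F}_{d,4}^{(1, N, N+1)}(\mathbb{F}_{q}) : \#C^{(m)}_{f}(\mathbb{F}_{q}) = k\}}{\#\mathcal{F}_{d,4}^{(1, N, N+1)}(\mathbb{F}_{q})} = \mathrm{Prob}\left(\sum_{i=1}^{q}X_{i} = k\right),\] where $X_{1}, \dots, X_{q}$ are i.i.d. random variables with $X_{i} = 0$ with probability $\left(1 - \frac{1}{(m, q-1)}\right)\frac{1}{1 + q^{ -1} + q^{ -N} + q^{ -(N+1)}}$, $X_{i} = 1$ with probability $\frac{q^{ -1} + q^{ -N} + q^{ -(N+1)}}{1 + q^{ -1} + q^{ -N} + q^{ -(N+1)}}$, $X_{i} = (m, q-1)$ with probability $\frac{1}{(m, q-1)}\frac{1}{1 + q^{ -1} + q^{ -N} + q^{ -(N+1)}}$, with the convention that when $(m, q-1) = 1$ the sum of the last two probabilities is $\mathrm{Prob}(X_{i} = 1)$. Moreover, if $\mathcal{F}_{d,4}^{(1, N, N+1)}(\mathbb{F}_{q})$ is replaced by $\hat{\mathcal{F}}_{d,4}^{(1, N, N+1)}(\mathbb{F}_{q})$, the same distribution is obtained.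
   Context: $\mathbb{F}_{q}$ is a fixed finite field. For $m \geq 2$ and $f \in \mathbb{F}_{q}[x]$, $C^{(m)}_{f}$ denotes the affine curve $y^{m} = f(x)$, and $\#C^{(m)}_{f}(\mathbb{F}_{q})$ is its number of $\mathbb{F}_{q}$-points in $\mathbb{A}^{2}$. Every $n$-th power-free polynomial $f \in \mathbb{F}_{q}[x]$ has a unique decomposition $f = a f_{1} f_{2}^{2} \cdots f_{n-1}^{n-1}$ with $a \in \mathbb{F}_{q}^{\times}$ and $f_{1},\dots,f_{n-1}$ monic and pairwise coprime. For a weight $\boldsymbol{c} = (c_{1}, \dots, c_{n-1})$ of positive integers, the weighted degree is $\deg(f, \boldsymbol{c}) = c_{1}\deg(f_{1}) + \cdots + c_{n-1}\deg(f_{n-1})$. $\hat{\mathcal{F}}_{d,n}^{\boldsymbol{c}}(\mathbb{F}_{q})$ is the set of $n$-th power-free $f \in \mathbb{F}_{q}[x]$ with $\deg(f, \boldsymbol{c}) = d$, and $\mathcal{F}_{d,n}^{\boldsymbol{c}}(\mathbb{F}_{q})$ is its subset of monic polynomials. $(m, q-1)$ denotes $\gcd(m, q-1)$. -}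

module Defs where

open import Level using (Level; _⊔_) renaming (suc to lsuc)
open import Algebra.Bundles using (CommutativeRing)
open import Data.Nat as ℕ using (ℕ; zero; suc; _≤ᵇ_; _∸_)
open import Data.Nat.GCD using (gcd)
open import Data.Bool using (if_then_else_)
open import Data.Integer using (+_)
open import Data.Rational as ℚ using (ℚ; 0ℚ; 1ℚ; _≟_)
open import Data.List using (List; []; _∷_; _++_; [_]; length; map; foldr)
open import Data.List.Relation.Unary.All using (All)
open import Data.List.Relation.Unary.Any using (Any)
open import Data.List.Relation.Unary.AllPairs using (AllPairs)
open import Data.Product using (Σ; ∃; _×_; _,_)
open import Relation.Binary using (Decidable)
open import Relation.Nullary using (¬_; yes; no)
open import Relation.Binary.PropositionalEquality using (_≡_)

HasSize : ∀ {a ℓ p} (A : Set a) (_∼_ : A → A → Set ℓ) (P : A → Set p) → ℕ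
        → Set (a ⊔ ℓ ⊔ p)
HasSize A _∼_ P n =
  Σ (List A) λ L → length L ≡ n × All P L × AllPairs (λ x y → ¬ (x ∼ y)) L
                 × (∀ x → P x → Any (x ∼_) L)

record FiniteField (c ℓ : Level) : Set (lsuc (c ⊔ ℓ)) where
  field
    commRing : CommutativeRing c ℓ
  open CommutativeRing commRing public
  field
    _≈?_     : Decidable _≈_
    0≉1      : ¬ (0# ≈ 1#)
    inverse  : ∀ x → ¬ (x ≈ 0#) → ∃ λ y → x * y ≈ 1#
    elements : List Carrier
    complete : ∀ x → Any (x ≈_) elements
    distinct : AllPairs (λ x y → ¬ (x ≈ y)) elements

  card : ℕ
  card = length elements

  pow : Carrier → ℕ → Carrier
  pow x zero    = 1#
  pow x (suc n) = x * pow x n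

  -- Polynomials F_q[x] as coefficient lists (constant term first),
  -- equal up to trailing zeros.

  Poly : Set c
  Poly = List Carrier

  data _≈P_ : Poly → Poly → Set (c ⊔ ℓ) where
    []≈[] : [] ≈P []
    ∷≈[]  : ∀ {x xs} → x ≈ 0# → xs ≈P [] → (x ∷ xs) ≈P []
    []≈∷  : ∀ {y ys} → 0# ≈ y → [] ≈P ys → [] ≈P (y ∷ ys)
    ∷≈∷   : ∀ {x y xs ys} → x ≈ y → xs ≈P ys → (x ∷ xs) ≈P (y ∷ ys)

  _+P_ : Poly → Poly → Poly
  []       +P ys       = ys
  (x ∷ xs) +P []       = x ∷ xs
  (x ∷ xs) +P (y ∷ ys) = (x + y) ∷ (xs +P ys)

  scaleP : Carrier → Poly → Poly
  scaleP a = map (a *_)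

  _*P_ : Poly → Poly → Poly
  []       *P ys = []
  (x ∷ xs) *P ys = scaleP x ys +P (0# ∷ (xs *P ys))

  _^P_ : Poly → ℕ → Poly
  p ^P zero  = [ 1# ]
  p ^P suc n = p *P (p ^P n)

  oneP : Poly
  oneP = [ 1# ]

  evalP : Poly → Carrier → Carrier
  evalP p x = foldr (λ a acc → a + x * acc) 0# p

  _∣P_ : Poly → Poly → Set (c ⊔ ℓ)
  g ∣P f = Σ Poly λ h → (g *P h) ≈P f

  IsUnitP : Poly → Set (c ⊔ ℓ)
  IsUnitP h = h ∣P oneP

  CoprimeP : Poly → Poly → Set (c ⊔ ℓ)
  CoprimeP f g = ∀ h → h ∣P f → h ∣P g → IsUnitP h

  PowerFree : ℕ → Poly → Set (c ⊔ ℓ)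
  PowerFree n f = ∀ h → (h ^P n) ∣P f → IsUnitP h

  SquareFree : Poly → Set (c ⊔ ℓ)
  SquareFree = PowerFree 2

  MonicOfDeg : Poly → ℕ → Set (c ⊔ ℓ)
  MonicOfDeg f n = Σ Poly λ cs → length cs ≡ n × f ≈P (cs ++ [ 1# ])

  Monic : Poly → Set (c ⊔ ℓ)
  Monic f = ∃ λ n → MonicOfDeg f n

  -- Weighted degree for n = 4: f = a f₁ f₂² f₃³ with a ≠ 0 and
  -- f₁,f₂,f₃ monic, squarefree, pairwise coprime (the unique such
  -- decomposition of a 4th-power-free f);
  -- deg(f,(c₁,c₂,c₃)) = c₁ deg f₁ + c₂ deg f₂ + c₃ deg f₃.

  WDeg4 : ℕ → ℕ → ℕ → Poly → ℕ → Set (c ⊔ ℓ)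
  WDeg4 c₁ c₂ c₃ f d =
    Σ Carrier λ a → Σ Poly λ f₁ → Σ Poly λ f₂ → Σ Poly λ f₃ →
    Σ ℕ λ n₁ → Σ ℕ λ n₂ → Σ ℕ λ n₃ →
      ¬ (a ≈ 0#)
    × MonicOfDeg f₁ n₁ × MonicOfDeg f₂ n₂ × MonicOfDeg f₃ n₃
    × SquareFree f₁ × SquareFree f₂ × SquareFree f₃
    × CoprimeP f₁ f₂ × CoprimeP f₁ f₃ × CoprimeP f₂ f₃
    × f ≈P scaleP a (f₁ *P ((f₂ ^P 2) *P (f₃ ^P 3)))
    × (c₁ ℕ.* n₁ ℕ.+ c₂ ℕ.* n₂ ℕ.+ c₃ ℕ.* n₃) ≡ d

  InFhat : ℕ → ℕ → Poly → Set (c ⊔ ℓ)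
  InFhat N d f = PowerFree 4 f × WDeg4 1 N (suc N) f d

  InF : ℕ → ℕ → Poly → Set (c ⊔ ℓ)
  InF N d f = Monic f × InFhat N d f

  _≈²_ : Carrier × Carrier → Carrier × Carrier → Set ℓ
  (x , y) ≈² (x' , y') = (x ≈ x') × (y ≈ y')

  OnCurve : ℕ → Poly → Carrier × Carrier → Set ℓ
  OnCurve m f (x , y) = pow y m ≈ evalP f x

  PointCount : ℕ → Poly → ℕ → Set (c ⊔ ℓ)
  PointCount m f k = HasSize (Carrier × Carrier) _≈²_ (OnCurve m f) k

-- 1/n for a natural number n (only used with n ≠ 0; value 0 at n = 0)
recipℕ : ℕ → ℚ
recipℕ zero    = 0ℚ
recipℕ (suc n) = + 1 ℚ./ suc n

-- 1/p (only used with p ≠ 0; value 0 at p = 0)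
recipℚ : ℚ → ℚ
recipℚ p with p ≟ 0ℚ
... | yes _  = 0ℚ
... | no p≢0 = ℚ.1/_ p {{ℚ.≢-nonZero p≢0}}

-- Prob(X₁ + ⋯ + Xₙ = k) for i.i.d. Xᵢ with finitely supported law given
-- as a list of (value, probability) pairs.
probSum : List (ℕ × ℚ) → ℕ → ℕ → ℚ
probSum D zero zero    = 1ℚ
probSum D zero (suc k) = 0ℚ
probSum D (suc n) k =
  foldr ℚ._+_ 0ℚ
    (map (λ { (v , p) → if v ≤ᵇ k then p ℚ.* probSum D n (k ∸ v) else 0ℚ }) D)

law : ℕ → ℕ → ℕ → List (ℕ × ℚ)
law q m N = (0 , p₀) ∷ (1 , p₁) ∷ (g , p_g) ∷ []
  where
  g : ℕ
  g = gcd m (q ∸ 1)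
  qinv : ℕ → ℚ
  qinv j = recipℕ (q ℕ.^ j)
  Z : ℚ
  Z = 1ℚ ℚ.+ qinv 1 ℚ.+ qinv N ℚ.+ qinv (suc N)
  p₀ p₁ p_g : ℚ
  p₀  = (1ℚ ℚ.- recipℕ g) ℚ.* recipℚ Z
  p₁  = (qinv 1 ℚ.+ qinv N ℚ.+ qinv (suc N)) ℚ.* recipℚ Z
  p_g = recipℕ g ℚ.* recipℚ Z

{-# OPTIONS --safe #-}
module Submission where

-- Writing g = f₁ f₃ and h = f₂ f₃ turns f = f₁ f₂² f₃³ into f = g h², where g and h range independently over the
-- squarefree monic polynomials with deg g + N deg h = d. The decomposition of every monic polynomial as s t² with s
-- squarefree gives a recursion for the number of squarefree polynomials of degree n with prescribed nonzero values at
-- all points of F; since the number of all polynomials with prescribed values is exactly q^(n-q), the recursion contracts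
-- and, up to o(q^n), these numbers do not depend on the values and are multiplied by q when n increases by 1. A zero
-- of f at x comes from a factor X - x of g, of h, or of both, which lowers d by 1, N or N + 1: this produces the
-- terms q⁻¹, q⁻ᴺ and q⁻⁽ᴺ⁺¹⁾ of the law. Finally y^m = a has gcd(m, q-1) solutions for (q-1)/gcd(m, q-1) units a.

open import Defs
open import Level using (Level; _⊔_)
open import Algebra.Bundles using (CommutativeRing)
open import Data.Bool using (true; false; if_then_else_)
open import Data.List using (List; []; _∷_; _++_; [_]; length; map; concatMap; filter; foldr; upTo)
open import Data.List.Properties using (length-map; length-filter; map-upTo; map-++; map-∘; map-id; ++-assoc; ++-identityʳ)
open import Data.List.Relation.Unary.All as All using (All; []; _∷_)
import Data.List.Relation.Unary.All.Properties as Allₚ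
open import Data.List.Relation.Unary.Any as Any using (Any; here; there)
import Data.List.Relation.Unary.Any.Properties as Anyₚ
open import Data.List.Relation.Unary.AllPairs as AllPairs using (AllPairs; []; _∷_)
import Data.List.Relation.Unary.AllPairs.Properties as AllPairsₚ
open import Data.Nat using (ℕ; zero; suc; _+_; _*_; _∸_; _^_; _≤_; z≤n; s≤s; NonZero; _≤?_; _≤ᵇ_)
import Data.Integer as ℤ
import Data.Nat as ℕ
open import Data.Nat.Properties hiding (_≟_)
open import Data.Nat.Tactic.RingSolver using (solve-∀)
open import Data.Product using (Σ; ∃; _×_; _,_; proj₁; proj₂)
open import Data.Sum using (_⊎_; inj₁; inj₂)
open import Data.Unit using (⊤; tt)
open import Function using (_∘_; case_of_)
open import Relation.Binary using (IsEquivalence; Transitive)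
open import Relation.Binary.PropositionalEquality using (_≡_; refl; sym; trans; cong; cong₂; subst; module ≡-Reasoning)
open import Relation.Nullary using (¬_; Dec; yes; no; contradiction; ¬?)
open import Relation.Nullary.Decidable using (_×-dec_; map′)
import Algebra.Properties.Ring as RingProps
import Algebra.Solver.Ring.NaturalCoefficients.Default as SemiringSolver
open import Data.Nat.GCD using (gcd; gcd[m,n]∣m; gcd[m,n]∣n; gcd-GCD; module Bézout)
open import Data.Nat.Divisibility using (divides)
open import Algebra.Properties.CommutativeSemigroup *-commutativeSemigroup using (x∙yz≈y∙xz)

-- The density of squarefree polynomials with prescribed values is never computed. Every count is
-- compared with a single reference count, that of the pairs with g h² = 1 at all points, which
-- cancels from the quotient; since the families have at least q^d / 2 members for d ≥ 2, an error
-- o(q^d) is negligible against their size. The recursion carries an error bound of order (15 q /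
-- 16)^n through a strong induction. A square t² with deg t = j leaves degree n - 2 j and there are
-- q^j such t, so the inherited errors form a geometric series of ratio 256 / (225 q). Summed from j
-- = 1 it exceeds 1 when q = 2 and the induction would not close; summed from j = 2 it is at most
-- 4/5. Values that are nonzero at every point of the field exclude deg t = 1. For this reason the
-- induction treats unit values only, and zeros come afterwards, one point at a time, by dividing
-- out X - x and summing over the unit values of the cofactor. The condition N ≥ 2 lets the same
-- series bound the sum over h. Denominators are cleared throughout: powers of 16 for the rate,
-- powers of q^(N+1) for the densities.

-- Finite sums over lists and indicators of decidable propositions.

∑ : ∀ {a} {A : Set a} → List A → (A → ℕ) → ℕ
∑ []       f = 0
∑ (x ∷ xs) f = f x + ∑ xs f

𝟙 : ∀ {p} {P : Set p} → Dec P → ℕ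
𝟙 (yes _) = 1
𝟙 (no _)  = 0

𝟙-yes : ∀ {p} {P : Set p} (d : Dec P) → P → 𝟙 d ≡ 1
𝟙-yes (yes _) _ = refl
𝟙-yes (no ¬p) p = contradiction p ¬p

𝟙-no : ∀ {p} {P : Set p} (d : Dec P) → ¬ P → 𝟙 d ≡ 0
𝟙-no (yes p) ¬p = contradiction p ¬p
𝟙-no (no _)  _  = refl

𝟙-cong : ∀ {p q} {P : Set p} {Q : Set q} (d : Dec P) (e : Dec Q) → (P → Q) → (Q → P) → 𝟙 d ≡ 𝟙 e
𝟙-cong (yes p) e f g = sym (𝟙-yes e (f p))
𝟙-cong (no ¬p) e f g = sym (𝟙-no e (¬p ∘ g))

𝟙-× : ∀ {p q} {P : Set p} {Q : Set q} (d : Dec P) (e : Dec Q) → 𝟙 d * 𝟙 e ≡ 𝟙 (d ×-dec e)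
𝟙-× (yes _) (yes _) = refl
𝟙-× (yes _) (no _)  = refl
𝟙-× (no _)  (yes _) = refl
𝟙-× (no _)  (no _)  = refl

module _ {a} {A : Set a} where

  ∑-cong : ∀ (L : List A) {f g : A → ℕ} → (∀ x → f x ≡ g x) → ∑ L f ≡ ∑ L g
  ∑-cong []      e = refl
  ∑-cong (x ∷ L) e = cong₂ _+_ (e x) (∑-cong L e)

  ∑-congAll : ∀ {L : List A} {f g : A → ℕ} → All (λ x → f x ≡ g x) L → ∑ L f ≡ ∑ L g
  ∑-congAll []       = refl
  ∑-congAll (e ∷ es) = cong₂ _+_ e (∑-congAll es)

  ∑-++ : ∀ (L K : List A) f → ∑ (L ++ K) f ≡ ∑ L f + ∑ K f
  ∑-++ []      K f = refl
  ∑-++ (x ∷ L) K f = trans (cong (f x +_) (∑-++ L K f)) (sym (+-assoc (f x) _ _))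

  ∑-+ : ∀ (L : List A) f g → ∑ L (λ x → f x + g x) ≡ ∑ L f + ∑ L g
  ∑-+ []      f g = refl
  ∑-+ (x ∷ L) f g rewrite ∑-+ L f g = interchange (f x) (g x) (∑ L f) (∑ L g)
    where
    interchange : ∀ a b c d → (a + b) + (c + d) ≡ (a + c) + (b + d)
    interchange = solve-∀

  ∑-*ˡ : ∀ (L : List A) c f → ∑ L (λ x → c * f x) ≡ c * ∑ L f
  ∑-*ˡ []      c f = sym (*-zeroʳ c)
  ∑-*ˡ (x ∷ L) c f rewrite ∑-*ˡ L c f = sym (*-distribˡ-+ c (f x) (∑ L f))

  ∑-*ʳ : ∀ (L : List A) c f → ∑ L (λ x → f x * c) ≡ ∑ L f * c
  ∑-*ʳ L c f = trans (∑-cong L (λ x → *-comm (f x) c)) (trans (∑-*ˡ L c f) (*-comm c _))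

  ∑-const : ∀ (L : List A) c → ∑ L (λ _ → c) ≡ length L * c
  ∑-const []      c = refl
  ∑-const (x ∷ L) c = cong (c +_) (∑-const L c)

  ∑-length : ∀ (L : List A) → ∑ L (λ _ → 1) ≡ length L
  ∑-length L = trans (∑-const L 1) (*-identityʳ _)

  ∑-zero : ∀ (L : List A) {f} → (∀ x → f x ≡ 0) → ∑ L f ≡ 0
  ∑-zero L e = trans (∑-cong L e) (trans (∑-const L 0) (*-zeroʳ (length L)))

  ∑-zeroAll : ∀ {L : List A} {f} → All (λ x → f x ≡ 0) L → ∑ L f ≡ 0
  ∑-zeroAll {L} e = trans (∑-congAll e) (∑-zero L (λ _ → refl))

  ∑-mono : ∀ (L : List A) {f g : A → ℕ} → (∀ x → f x ≤ g x) → ∑ L f ≤ ∑ L g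
  ∑-mono []      e = z≤n
  ∑-mono (x ∷ L) e = +-mono-≤ (e x) (∑-mono L e)

  ∑-filter : ∀ {p} {P : A → Set p} (P? : ∀ x → Dec (P x)) L f →
             ∑ (filter P? L) f ≡ ∑ L (λ x → 𝟙 (P? x) * f x)
  ∑-filter P? []      f = refl
  ∑-filter P? (x ∷ L) f with P? x
  ... | yes _ = cong₂ _+_ (sym (+-identityʳ (f x))) (∑-filter P? L f)
  ... | no _  = ∑-filter P? L f

∑-map : ∀ {a b} {A : Set a} {B : Set b} (T : B → A) L f → ∑ (map T L) f ≡ ∑ L (f ∘ T)
∑-map T []      f = refl
∑-map T (x ∷ L) f = cong (f (T x) +_) (∑-map T L f)

∑-concatMap : ∀ {a b} {A : Set a} {B : Set b} (T : B → List A) L f → ∑ (concatMap T L) f ≡ ∑ L (λ x → ∑ (T x) f)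
∑-concatMap T []      f = refl
∑-concatMap T (x ∷ L) f = trans (∑-++ (T x) _ f) (cong (∑ (T x) f +_) (∑-concatMap T L f))

∑-swap : ∀ {a b} {A : Set a} {B : Set b} (L : List A) (K : List B) (f : A → B → ℕ) →
         ∑ L (λ x → ∑ K (f x)) ≡ ∑ K (λ y → ∑ L (λ x → f x y))
∑-swap []      K f = sym (∑-zero K (λ _ → refl))
∑-swap (x ∷ L) K f = trans (cong (∑ K (f x) +_) (∑-swap L K f)) (sym (∑-+ K (f x) _))

∑∑-*ˡ : ∀ {a b} {A : Set a} {B : Set b} (L : List A) (K : A → List B) k (f : A → B → ℕ) →
        k * ∑ L (λ x → ∑ (K x) (f x)) ≡ ∑ L (λ x → ∑ (K x) (λ y → k * f x y))
∑∑-*ˡ L K k f = trans (sym (∑-*ˡ L k _)) (∑-cong L (λ x → sym (∑-*ˡ (K x) k (f x))))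

∑∑-+ : ∀ {a b} {A : Set a} {B : Set b} (L : List A) (K : A → List B) (f g : A → B → ℕ) →
       ∑ L (λ x → ∑ (K x) (λ y → f x y + g x y)) ≡ ∑ L (λ x → ∑ (K x) (f x)) + ∑ L (λ x → ∑ (K x) (g x))
∑∑-+ L K f g = trans (∑-cong L (λ x → ∑-+ (K x) (f x) (g x))) (∑-+ L _ _)

∑-upTo-suc : ∀ n f → ∑ (upTo (suc n)) f ≡ f 0 + ∑ (upTo n) (f ∘ suc)
∑-upTo-suc n f = cong (f 0 +_) (trans (cong (λ L → ∑ L f) (sym (map-upTo suc n))) (∑-map suc (upTo n) f))

∑-upTo-last : ∀ n f → ∑ (upTo (suc n)) f ≡ ∑ (upTo n) f + f n
∑-upTo-last zero    f = +-comm (f 0) 0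
∑-upTo-last (suc n) f = begin
  ∑ (upTo (2 + n)) f                              ≡⟨ ∑-upTo-suc (suc n) f ⟩
  f 0 + ∑ (upTo (suc n)) (f ∘ suc)                ≡⟨ cong (f 0 +_) (∑-upTo-last n (f ∘ suc)) ⟩
  f 0 + (∑ (upTo n) (f ∘ suc) + f (suc n))        ≡⟨ sym (+-assoc (f 0) _ _) ⟩
  (f 0 + ∑ (upTo n) (f ∘ suc)) + f (suc n)        ≡⟨ cong (_+ f (suc n)) (sym (∑-upTo-suc n f)) ⟩
  ∑ (upTo (suc n)) f + f (suc n)                  ∎
  where open ≡-Reasoning

-- Duplicate-free enumerations up to an equivalence.

record Enum {a r p} {A : Set a} (_~_ : A → A → Set r) (Q : A → Set p) (L : List A) : Set (a ⊔ r ⊔ p) where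
  constructor enum
  field
    member   : All Q L
    distinct : AllPairs (λ x y → ¬ (x ~ y)) L
    covers   : ∀ x → Q x → Any (x ~_) L

module _ {a r} {A : Set a} {_~_ : A → A → Set r} where

  -- The remaining list `K` is described only by its sums and its memberships, which is all that the
  -- induction in `∑-⊆` uses, so permutations of lists never appear.
  extract : ∀ {p} {P : A → Set p} {L} → Any P L →
            Σ A λ y → Σ (List A) λ K → P y × (∀ φ → ∑ L φ ≡ φ y + ∑ K φ)
              × (∀ {R : A → Set r} → Any R L → R y ⊎ Any R K)
  extract {L = x ∷ L} (here px) = x , L , px , (λ _ → refl) , λ { (here r) → inj₁ r ; (there i) → inj₂ i }
  extract {L = x ∷ L} (there i) with extract i
  ... | y , K , py , e , s = y , x ∷ K , py , e′ , s′
    where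
    swap : ∀ a b c → a + (b + c) ≡ b + (a + c)
    swap = solve-∀
    e′ : ∀ φ → φ x + ∑ L φ ≡ φ y + (φ x + ∑ K φ)
    e′ φ = trans (cong (φ x +_) (e φ)) (swap (φ x) (φ y) _)
    s′ : ∀ {R : A → Set r} → Any R (x ∷ L) → R y ⊎ Any R (x ∷ K)
    s′ (here r)  = inj₂ (here r)
    s′ (there j) with s j
    ... | inj₁ ry = inj₁ ry
    ... | inj₂ k  = inj₂ (there k)

  module _ (~-equiv : IsEquivalence _~_) where
    open IsEquivalence ~-equiv renaming (refl to ~-refl; sym to ~-sym; trans to ~-trans)

    -- Pigeonhole principle: the partner of the head is deleted from `K`, and distinctness
    -- guarantees that the other entries keep a partner in what is left.
    ∑-⊆ : ∀ {φ : A → ℕ} → (∀ {x y} → x ~ y → φ x ≡ φ y) → ∀ {L K} →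
          AllPairs (λ x y → ¬ (x ~ y)) L → All (λ x → Any (x ~_) K) L → ∑ L φ ≤ ∑ K φ
    ∑-⊆ {φ} resp {[]} _ _ = z≤n
    ∑-⊆ {φ} resp {x ∷ L} {K} (x≁ ∷ dL) (i ∷ is) with extract i
    ... | y , K′ , x~y , e , s = subst (φ x + ∑ L φ ≤_) (sym (e φ))
            (+-mono-≤ (≤-reflexive (resp x~y)) (∑-⊆ resp dL (All.zipWith rest (x≁ , is))))
      where
      rest : ∀ {z} → (¬ (x ~ z)) × Any (z ~_) K → Any (z ~_) K′
      rest (x≁z , j) with s j
      ... | inj₁ z~y = contradiction (~-trans x~y (~-sym z~y)) x≁z
      ... | inj₂ k   = k

    -- Two enumerations differ only in order and in the choice of representatives. Together with
    -- `enum-map` this turns each bijection of the proof into an equality of sums of class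
    -- functions.
    enum-∑ : ∀ {p} {Q : A → Set p} {L K} → Enum _~_ Q L → Enum _~_ Q K →
             ∀ {φ} → (∀ {x y} → x ~ y → φ x ≡ φ y) → ∑ L φ ≡ ∑ K φ
    enum-∑ (enum mL dL cL) (enum mK dK cK) resp =
      ≤-antisym (∑-⊆ resp dL (All.map (cK _) mL)) (∑-⊆ resp dK (All.map (cL _) mK))

    enum-length : ∀ {p} {Q : A → Set p} {L K} → Enum _~_ Q L → Enum _~_ Q K → length L ≡ length K
    enum-length {L = L} {K} eL eK =
      trans (sym (∑-length L)) (trans (enum-∑ eL eK (λ _ → refl)) (∑-length K))

    enum-filter : ∀ {p s} {Q : A → Set p} {P : A → Set s} (P? : ∀ x → Dec (P x)) →
                  (∀ {x y} → x ~ y → P x → P y) → ∀ {L} → Enum _~_ Q L →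
                  Enum _~_ (λ x → Q x × P x) (filter P? L)
    enum-filter {Q = Q} {P} P? resp {L} (enum m d c) = enum
      (All.zip (Allₚ.filter⁺ P? m , Allₚ.all-filter P? L))
      (AllPairsₚ.filter⁺ P? d)
      (λ x (qx , px) → filterAny px (c x qx))
      where
      filterAny : ∀ {x} → P x → ∀ {L} → Any (x ~_) L → Any (x ~_) (filter P? L)
      filterAny px {y ∷ L} i with P? y
      filterAny px {y ∷ L} (here e)  | yes _  = here e
      filterAny px {y ∷ L} (there i) | yes _  = there (filterAny px i)
      filterAny px {y ∷ L} (here e)  | no ¬py = contradiction (resp e px) ¬py
      filterAny px {y ∷ L} (there i) | no _   = filterAny px i

    enum-singleton : ∀ {x : A} → Enum _~_ (_~ x) [ x ]
    enum-singleton = enum (~-refl ∷ []) ([] ∷ []) (λ _ e → here e)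

    -- The class of `x` is represented exactly once, by whichever representative the list holds;
    -- this collapses sums over values against a delta.
    ∑-at : ∀ {p} {Q : A → Set p} {L} → Enum _~_ Q L → ∀ {x} → Q x → (∀ {y} → x ~ y → Q y) →
           (e? : ∀ y → Dec (x ~ y)) → ∑ L (λ y → 𝟙 (e? y)) ≡ 1
    ∑-at {L = L} eL {x} qx resp e? = trans (trans (∑-cong L (λ y → sym (*-identityʳ _))) (sym (∑-filter e? L (λ _ → 1))))
       (enum-∑ (enum-filter e? (λ e x~ → ~-trans x~ e) eL) single (λ _ → refl))
      where
      single : Enum _~_ _ [ x ]
      single = enum ((qx , ~-refl) ∷ []) ([] ∷ []) (λ y (_ , e) → here (~-sym e))

  enum-⇔ : ∀ {p s} {Q : A → Set p} {P : A → Set s} → (∀ x → Q x → P x) → (∀ x → P x → Q x) →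
           ∀ {L} → Enum _~_ Q L → Enum _~_ P L
  enum-⇔ f g (enum m d c) = enum (All.map (f _) m) d (λ x px → c x (g x px))

  enum-[] : ∀ {p} {Q : A → Set p} → (∀ x → ¬ Q x) → Enum _~_ Q []
  enum-[] none = enum [] [] (λ x q → contradiction q (none x))

  enum-++ : ∀ {p s} {Q : A → Set p} {P : A → Set s} {L K} → Enum _~_ Q L → Enum _~_ P K →
            (∀ {x y} → Q x → P y → ¬ (x ~ y)) → Enum _~_ (λ x → Q x ⊎ P x) (L ++ K)
  enum-++ {L = L} (enum m d c) (enum m′ d′ c′) disj = enum
    (Allₚ.++⁺ (All.map inj₁ m) (All.map inj₂ m′))
    (AllPairsₚ.++⁺ d d′ (All.map (λ q → All.map (disj q) m′) m))
    (λ { x (inj₁ q) → Anyₚ.++⁺ˡ (c x q) ; x (inj₂ p) → Anyₚ.++⁺ʳ L (c′ x p) })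

  enum-map : ∀ {b s p p′} {B : Set b} {_≈_ : B → B → Set s} {Q : A → Set p} {Q′ : B → Set p′} (T : A → B) →
             Transitive _≈_ →
             (∀ {x} → Q x → Q′ (T x)) →
             (∀ {x y} → Q x → Q y → T x ≈ T y → x ~ y) →
             (∀ {x y} → Q x → x ~ y → T x ≈ T y) →
             (∀ y → Q′ y → ∃ λ x → Q x × y ≈ T x) →
             ∀ {L} → Enum _~_ Q L → Enum _≈_ Q′ (map T L)
  enum-map {Q = Q} {Q′} T ≈-trans mem inj resp surj {L} (enum m d c) = enum
    (Allₚ.map⁺ (All.map mem m))
    (AllPairsₚ.map⁺ (go m d))
    (λ y q′ → case surj y q′ of λ { (x , q , e) → Anyₚ.map⁺ (Any.map (λ x~ → ≈-trans e (resp q x~)) (c x q)) })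
    where
    go : ∀ {L} → All Q L → AllPairs (λ x y → ¬ (x ~ y)) L → AllPairs _ L
    go []       []       = []
    go (q ∷ qs) (d ∷ ds) = All.zipWith (λ (q′ , ≁) e → ≁ (inj q q′ e)) (qs , d) ∷ go qs ds

pairs : ∀ {a b} {A : Set a} {B : Set b} → List A → (A → List B) → List (A × B)
pairs L K = concatMap (λ x → map (x ,_) (K x)) L

∑-pairs : ∀ {a b} {A : Set a} {B : Set b} (L : List A) (K : A → List B) φ →
          ∑ (pairs L K) φ ≡ ∑ L (λ x → ∑ (K x) (λ y → φ (x , y)))
∑-pairs L K φ = trans (∑-concatMap _ L φ) (∑-cong L (λ x → ∑-map (x ,_) (K x) φ))

Both : ∀ {a b r s} {A : Set a} {B : Set b} → (A → A → Set r) → (B → B → Set s) → A × B → A × B → Set (r ⊔ s)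
Both _~_ _≈_ (x , y) (x′ , y′) = (x ~ x′) × (y ≈ y′)

-- The second list depends on the listed representative of the first component, while a given pair
-- may contain another member of that class; the last hypothesis transports `Q` between the two.
enum-pairs : ∀ {a b r s p p′} {A : Set a} {B : Set b} {_~_ : A → A → Set r} {_≈_ : B → B → Set s}
             {P : A → Set p} {Q : A → B → Set p′} {L : List A} {K : A → List B} →
             Enum _~_ P L → (∀ x → P x → Enum _≈_ (Q x) (K x)) →
             (∀ {x x′ y} → P x → x ~ x′ → Q x y → Q x′ y) →
             Enum (Both _~_ _≈_) (λ xy → P (proj₁ xy) × Q (proj₁ xy) (proj₂ xy)) (pairs L K)
enum-pairs {A = A} {B} {_~_} {_≈_} {P} {Q} {L} {K} (enum m d c) eK resp = enum (mem m) (dis m d) (cov m)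
  where
  _≉_ : A × B → A × B → Set _
  u ≉ v = ¬ Both _~_ _≈_ u v

  mem : ∀ {L} → All P L → All (λ xy → P (proj₁ xy) × Q (proj₁ xy) (proj₂ xy)) (pairs L K)
  mem []               = []
  mem {x ∷ L} (p ∷ ps) = Allₚ.++⁺ (Allₚ.map⁺ (All.map (p ,_) (Enum.member (eK x p)))) (mem ps)

  apart : ∀ {x y L} → All (λ z → ¬ (x ~ z)) L → All ((x , y) ≉_) (pairs L K)
  apart []                      = []
  apart {L = z ∷ L} (x≁z ∷ x≁L) = Allₚ.++⁺ (Allₚ.map⁺ (All.universal (λ _ (e , _) → x≁z e) (K z))) (apart x≁L)

  dis : ∀ {L} → All P L → AllPairs (λ x y → ¬ (x ~ y)) L → AllPairs _≉_ (pairs L K)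
  dis []               []         = []
  dis {x ∷ L} (p ∷ ps) (x≁L ∷ ds) = AllPairsₚ.++⁺
    (AllPairsₚ.map⁺ (AllPairs.map (λ y≉ (_ , e) → y≉ e) (Enum.distinct (eK x p))))
    (dis ps ds)
    (Allₚ.map⁺ (All.universal (λ _ → apart x≁L) (K x)))

  cov : All P L → ∀ xy → P (proj₁ xy) × Q (proj₁ xy) (proj₂ xy) → Any (Both _~_ _≈_ xy) (pairs L K)
  cov ps (x , y) (p , q) = go ps (c x p)
    where
    go : ∀ {L} → All P L → Any (x ~_) L → Any (Both _~_ _≈_ (x , y)) (pairs L K)
    go (p′ ∷ ps) (here e)  = Anyₚ.++⁺ˡ (Anyₚ.map⁺ (Any.map (e ,_) (Enum.covers (eK _ p′) y (resp p e q))))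
    go {z ∷ L} (_ ∷ ps) (there i) = Anyₚ.++⁺ʳ (map (z ,_) (K z)) (go ps i)

enum-upTo : ∀ n → Enum _≡_ (λ i → suc i ≤ n) (upTo n)
enum-upTo zero    = enum [] [] (λ _ ())
enum-upTo (suc n) with enum-upTo n
... | enum m d c = subst (Enum _≡_ _) (cong (0 ∷_) (map-upTo suc n)) (enum
  (s≤s z≤n ∷ Allₚ.map⁺ (All.map s≤s m))
  (Allₚ.map⁺ (All.universal (λ _ ()) (upTo n)) ∷ AllPairsₚ.map⁺ (AllPairs.map (λ ≢ e → ≢ (suc-injective e)) d))
  (λ { zero _ → here refl ; (suc i) (s≤s i<n) → there (Anyₚ.map⁺ (Any.map (cong suc) (c i i<n))) }))

-- lag L n k is L (n - k), or [] when k exceeds n: the coefficient of index n of x^k times the series L.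
lag : ∀ {a} {A : Set a} → (ℕ → List A) → ℕ → ℕ → List A
lag L n       zero    = L n
lag L zero    (suc k) = []
lag L (suc n) (suc k) = lag L n k

lag-+ : ∀ {a} {A : Set a} (L : ℕ → List A) k n j → lag L (k + n) (k + j) ≡ lag L n j
lag-+ L zero    n j = refl
lag-+ L (suc k) n j = lag-+ L k n j

lag-> : ∀ {a} {A : Set a} (L : ℕ → List A) {n k} → suc n ≤ k → lag L n k ≡ []
lag-> L {zero}  {suc k} _         = refl
lag-> L {suc n} {suc k} (s≤s n<k) = lag-> L n<k

enum-lag : ∀ {a r p} {A : Set a} {_~_ : A → A → Set r} {Q : ℕ → A → Set p} {L : ℕ → List A} →
           (∀ i → Enum _~_ (Q i) (L i)) → ∀ n k → Enum _~_ (λ x → ∃ λ i → k + i ≡ n × Q i x) (lag L n k)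
enum-lag e n zero             = enum-⇔ (λ x q → n , refl , q) (λ { x (_ , refl , q) → q }) (e n)
enum-lag e zero (suc k)       = enum-[] (λ { x (_ , () , _) })
enum-lag e (suc n) (suc k)    =
  enum-⇔ (λ { x (i , eq , q) → i , cong suc eq , q }) (λ { x (i , eq , q) → i , suc-injective eq , q }) (enum-lag e n k)

-- The convolution step of `probSum` over the natural numbers, with the same truncation when the
-- value exceeds `k`.
select : ℕ → ℕ → (ℕ → ℕ) → ℕ
select v k f = if v ≤ᵇ k then f (k ∸ v) else 0

-- The ring of polynomials, evaluation, and inverses in the field.

module Polynomials {c ℓ : Level} (F : FiniteField c ℓ) where

  open FiniteField F public
    using (Carrier; _≈_; 0#; 1#; commRing; _≈?_; 0≉1; inverse; elements; card; pow; Poly; _≈P_; []≈[]; ∷≈[]; []≈∷; ∷≈∷;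
           _+P_; scaleP; _*P_; _^P_; oneP; evalP; _∣P_; IsUnitP; CoprimeP; PowerFree; SquareFree; MonicOfDeg; Monic;
           WDeg4; InFhat; InF; _≈²_; OnCurve; PointCount)
    renaming (_+_ to _⊕_; _*_ to _⊗_; -_ to ⊖_; complete to elements-complete; distinct to elements-distinct)
  module C = CommutativeRing commRing

  module CS = SemiringSolver C.commutativeSemiring
  open CS using (_:+_; _:*_; _:=_)

  coef : Poly → ℕ → Carrier
  coef []      _       = 0#
  coef (x ∷ f) zero    = x
  coef (x ∷ f) (suc n) = coef f n

  -- Coefficientwise equality does not see the lengths of the lists, so the ring laws reduce to
  -- those of the coefficients.
  _≗P_ : Poly → Poly → Set ℓ
  f ≗P g = ∀ n → coef f n ≈ coef g n

  to≗ : ∀ {f g} → f ≈P g → f ≗P g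
  to≗ []≈[]       n       = C.refl
  to≗ (∷≈[] e es) zero    = e
  to≗ (∷≈[] e es) (suc n) = to≗ es n
  to≗ ([]≈∷ e es) zero    = e
  to≗ ([]≈∷ e es) (suc n) = to≗ es n
  to≗ (∷≈∷ e es)  zero    = e
  to≗ (∷≈∷ e es)  (suc n) = to≗ es n

  from≗ : ∀ f g → f ≗P g → f ≈P g
  from≗ []      []      e = []≈[]
  from≗ []      (y ∷ g) e = []≈∷ (e 0) (from≗ [] g (e ∘ suc))
  from≗ (x ∷ f) []      e = ∷≈[] (e 0) (from≗ f [] (e ∘ suc))
  from≗ (x ∷ f) (y ∷ g) e = ∷≈∷ (e 0) (from≗ f g (e ∘ suc))

  reflP : ∀ {f} → f ≈P f
  reflP {f} = from≗ f f (λ _ → C.refl)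

  symP : ∀ {f g} → f ≈P g → g ≈P f
  symP e = from≗ _ _ (λ n → C.sym (to≗ e n))

  transP : ∀ {f g h} → f ≈P g → g ≈P h → f ≈P h
  transP d e = from≗ _ _ (λ n → C.trans (to≗ d n) (to≗ e n))

  ≈P-equiv : IsEquivalence _≈P_
  ≈P-equiv = record { refl = reflP ; sym = symP ; trans = transP }

  coef-+ : ∀ f g n → coef (f +P g) n ≈ (coef f n ⊕ coef g n)
  coef-+ []      g       n       = C.sym (C.+-identityˡ _)
  coef-+ (x ∷ f) []      n       = C.sym (C.+-identityʳ _)
  coef-+ (x ∷ f) (y ∷ g) zero    = C.refl
  coef-+ (x ∷ f) (y ∷ g) (suc n) = coef-+ f g n

  coef-scale : ∀ a f n → coef (scaleP a f) n ≈ (a ⊗ coef f n)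
  coef-scale a []      n       = C.sym (C.zeroʳ a)
  coef-scale a (x ∷ f) zero    = C.refl
  coef-scale a (x ∷ f) (suc n) = coef-scale a f n

  +P-cong : ∀ {f f′ g g′} → f ≈P f′ → g ≈P g′ → (f +P g) ≈P (f′ +P g′)
  +P-cong {f} {f′} {g} {g′} d e = from≗ _ _ λ n →
    C.trans (coef-+ f g n) (C.trans (C.+-cong (to≗ d n) (to≗ e n)) (C.sym (coef-+ f′ g′ n)))

  scale-cong : ∀ {a b f g} → a ≈ b → f ≈P g → scaleP a f ≈P scaleP b g
  scale-cong {a} {b} {f} {g} d e = from≗ _ _ λ n →
    C.trans (coef-scale a f n) (C.trans (C.*-cong d (to≗ e n)) (C.sym (coef-scale b g n)))

  +P-assoc : ∀ f g h → ((f +P g) +P h) ≈P (f +P (g +P h))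
  +P-assoc f g h = from≗ _ _ λ n →
    C.trans (coef-+ (f +P g) h n) (C.trans (C.+-congʳ (coef-+ f g n)) (C.trans (C.+-assoc _ _ _)
      (C.trans (C.+-congˡ (C.sym (coef-+ g h n))) (C.sym (coef-+ f (g +P h) n)))))

  +P-comm : ∀ f g → (f +P g) ≈P (g +P f)
  +P-comm f g = from≗ _ _ λ n → C.trans (coef-+ f g n) (C.trans (C.+-comm _ _) (C.sym (coef-+ g f n)))

  +P-identityʳ : ∀ f → (f +P []) ≈P f
  +P-identityʳ []      = reflP
  +P-identityʳ (x ∷ f) = reflP

  negP : Poly → Poly
  negP = scaleP (⊖ 1#)

  private
    module NR = RingProps C.ring

  +P-inverseʳ : ∀ f → (f +P negP f) ≈P []
  +P-inverseʳ f = from≗ _ _ λ n →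
    C.trans (coef-+ f (negP f) n) (C.trans (C.+-congˡ (C.trans (coef-scale (⊖ 1#) f n) (NR.-1*x≈-x _))) (C.-‿inverseʳ _))

  scale-+ : ∀ a f g → scaleP a (f +P g) ≈P (scaleP a f +P scaleP a g)
  scale-+ a f g = from≗ _ _ λ n →
    C.trans (coef-scale a (f +P g) n) (C.trans (C.*-congˡ (coef-+ f g n)) (C.trans (C.distribˡ a _ _)
      (C.trans (C.+-cong (C.sym (coef-scale a f n)) (C.sym (coef-scale a g n))) (C.sym (coef-+ (scaleP a f) (scaleP a g) n)))))

  scale-⊕ : ∀ a b f → scaleP (a ⊕ b) f ≈P (scaleP a f +P scaleP b f)
  scale-⊕ a b f = from≗ _ _ λ n →
    C.trans (coef-scale (a ⊕ b) f n) (C.trans (C.distribʳ _ a b)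
      (C.trans (C.+-cong (C.sym (coef-scale a f n)) (C.sym (coef-scale b f n))) (C.sym (coef-+ (scaleP a f) (scaleP b f) n))))

  scale-scale : ∀ a b f → scaleP a (scaleP b f) ≈P scaleP (a ⊗ b) f
  scale-scale a b f = from≗ _ _ λ n →
    C.trans (coef-scale a (scaleP b f) n) (C.trans (C.*-congˡ (coef-scale b f n))
      (C.trans (C.sym (C.*-assoc a b _)) (C.sym (coef-scale (a ⊗ b) f n))))

  scale-0 : ∀ f → scaleP 0# f ≈P []
  scale-0 f = from≗ _ _ λ n → C.trans (coef-scale 0# f n) (C.zeroˡ _)

  scale-1 : ∀ f → scaleP 1# f ≈P f
  scale-1 f = from≗ _ _ λ n → C.trans (coef-scale 1# f n) (C.*-identityˡ _)

  private
    +P-interchange : ∀ f g h k → ((f +P g) +P (h +P k)) ≈P ((f +P h) +P (g +P k))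
    +P-interchange f g h k =
      transP (+P-assoc f g (h +P k)) (transP (+P-cong (reflP {f}) (transP (symP (+P-assoc g h k))
        (transP (+P-cong (+P-comm g h) reflP) (+P-assoc h g k)))) (symP (+P-assoc f h (g +P k))))

  *P-congˡ : ∀ f {g g′} → g ≈P g′ → (f *P g) ≈P (f *P g′)
  *P-congˡ []      e = reflP
  *P-congˡ (x ∷ f) e = +P-cong (scale-cong C.refl e) (∷≈∷ C.refl (*P-congˡ f e))

  *P-zeroʳ : ∀ f → (f *P []) ≈P []
  *P-zeroʳ []      = reflP
  *P-zeroʳ (x ∷ f) = ∷≈[] C.refl (*P-zeroʳ f)

  *P-∷ʳ : ∀ f y g → (f *P (y ∷ g)) ≈P (scaleP y f +P (0# ∷ (f *P g)))
  *P-∷ʳ []      y g = []≈∷ C.refl []≈[]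
  *P-∷ʳ (x ∷ f) y g = ∷≈∷ (C.+-congʳ (C.*-comm x y))
    (transP (+P-cong (reflP {scaleP x g}) (*P-∷ʳ f y g))
    (transP (symP (+P-assoc (scaleP x g) (scaleP y f) _))
    (transP (+P-cong (+P-comm (scaleP x g) (scaleP y f)) reflP)
            (+P-assoc (scaleP y f) (scaleP x g) _))))

  *P-comm : ∀ f g → (f *P g) ≈P (g *P f)
  *P-comm []      g = symP (*P-zeroʳ g)
  *P-comm (x ∷ f) g = transP (+P-cong (reflP {scaleP x g}) (∷≈∷ C.refl (*P-comm f g))) (symP (*P-∷ʳ g x f))

  *P-cong : ∀ {f f′ g g′} → f ≈P f′ → g ≈P g′ → (f *P g) ≈P (f′ *P g′)
  *P-cong {f} {f′} {g} {g′} d e =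
    transP (*P-congˡ f e) (transP (*P-comm f g′) (transP (*P-congˡ g′ d) (*P-comm g′ f′)))

  *P-distribʳ : ∀ h f g → ((f +P g) *P h) ≈P ((f *P h) +P (g *P h))
  *P-distribʳ h []      g       = reflP
  *P-distribʳ h (x ∷ f) []      = symP (+P-identityʳ _)
  *P-distribʳ h (x ∷ f) (y ∷ g) =
    transP (+P-cong (scale-⊕ x y h) (∷≈∷ (C.sym (C.+-identityˡ 0#)) (*P-distribʳ h f g)))
           (+P-interchange (scaleP x h) (scaleP y h) (0# ∷ (f *P h)) (0# ∷ (g *P h)))

  scale-* : ∀ a f g → (scaleP a f *P g) ≈P scaleP a (f *P g)
  scale-* a []      g = reflP
  scale-* a (x ∷ f) g =
    transP (+P-cong (symP (scale-scale a x g)) (∷≈∷ (C.sym (C.zeroʳ a)) (scale-* a f g)))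
           (symP (scale-+ a (scaleP x g) (0# ∷ (f *P g))))

  *P-assoc : ∀ f g h → ((f *P g) *P h) ≈P (f *P (g *P h))
  *P-assoc []      g h = reflP
  *P-assoc (x ∷ f) g h =
    transP (*P-distribʳ h (scaleP x g) (0# ∷ (f *P g)))
           (+P-cong (scale-* x g h) (transP (+P-cong (scale-0 h) reflP) (∷≈∷ C.refl (*P-assoc f g h))))

  const-* : ∀ a f → ([ a ] *P f) ≈P scaleP a f
  const-* a f = transP (+P-cong (reflP {scaleP a f}) (∷≈[] C.refl []≈[])) (+P-identityʳ _)

  *P-identityˡ : ∀ f → (oneP *P f) ≈P f
  *P-identityˡ f = transP (const-* 1# f) (scale-1 f)

  polyRing : CommutativeRing c (c ⊔ ℓ)
  polyRing = record
    { Carrier = Poly ; _≈_ = _≈P_ ; _+_ = _+P_ ; _*_ = _*P_ ; -_ = negP ; 0# = [] ; 1# = oneP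
    ; isCommutativeRing = record
      { isRing = record
        { +-isAbelianGroup = record
          { isGroup = record
            { isMonoid = record
              { isSemigroup = record
                { isMagma = record { isEquivalence = ≈P-equiv ; ∙-cong = +P-cong }
                ; assoc = +P-assoc }
              ; identity = (λ _ → reflP) , +P-identityʳ }
            ; inverse = (λ f → transP (+P-comm (negP f) f) (+P-inverseʳ f)) , +P-inverseʳ
            ; ⁻¹-cong = scale-cong C.refl }
          ; comm = +P-comm }
        ; *-cong = *P-cong
        ; *-assoc = *P-assoc
        ; *-identity = *P-identityˡ , (λ f → transP (*P-comm f oneP) (*P-identityˡ f))
        ; distrib = (λ f g h → transP (*P-comm f (g +P h)) (transP (*P-distribʳ f g h) (+P-cong (*P-comm g f) (*P-comm h f))))
                  , *P-distribʳ }
      ; *-comm = *P-comm } }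
  module PR = CommutativeRing polyRing

  eval-0 : ∀ {f} x → f ≈P [] → evalP f x ≈ 0#
  eval-0 x []≈[]       = C.refl
  eval-0 x (∷≈[] e es) = C.trans (C.+-cong e (C.trans (C.*-congˡ (eval-0 x es)) (C.zeroʳ x))) (C.+-identityˡ 0#)

  eval-cong : ∀ {f g} x → f ≈P g → evalP f x ≈ evalP g x
  eval-cong x []≈[]         = C.refl
  eval-cong x e@(∷≈[] _ _)  = eval-0 x e
  eval-cong x e@([]≈∷ _ _)  = C.sym (eval-0 x (symP e))
  eval-cong x (∷≈∷ e es)    = C.+-cong e (C.*-congˡ (eval-cong x es))

  eval-congʳ : ∀ f {x y} → x ≈ y → evalP f x ≈ evalP f y
  eval-congʳ []      e = C.refl
  eval-congʳ (a ∷ f) e = C.+-congˡ (C.*-cong e (eval-congʳ f e))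

  private
    eval-+-step : ∀ a b x u v → ((a ⊕ b) ⊕ (x ⊗ (u ⊕ v))) ≈ ((a ⊕ (x ⊗ u)) ⊕ (b ⊕ (x ⊗ v)))
    eval-+-step = CS.solve 5 (λ a b x u v → (a :+ b) :+ (x :* (u :+ v)) := (a :+ (x :* u)) :+ (b :+ (x :* v))) C.refl

    eval-scale-step : ∀ a b x u → ((a ⊗ b) ⊕ (x ⊗ (a ⊗ u))) ≈ (a ⊗ (b ⊕ (x ⊗ u)))
    eval-scale-step = CS.solve 4 (λ a b x u → (a :* b) :+ (x :* (a :* u)) := a :* (b :+ (x :* u))) C.refl

    eval-*-step : ∀ a x u v → ((a ⊗ v) ⊕ (x ⊗ (u ⊗ v))) ≈ ((a ⊕ (x ⊗ u)) ⊗ v)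
    eval-*-step = CS.solve 4 (λ a x u v → (a :* v) :+ (x :* (u :* v)) := (a :+ (x :* u)) :* v) C.refl

  eval-+ : ∀ f g x → evalP (f +P g) x ≈ (evalP f x ⊕ evalP g x)
  eval-+ []      g       x = C.sym (C.+-identityˡ _)
  eval-+ (a ∷ f) []      x = C.sym (C.+-identityʳ _)
  eval-+ (a ∷ f) (b ∷ g) x = C.trans (C.+-congˡ (C.*-congˡ (eval-+ f g x))) (eval-+-step a b x _ _)

  eval-scale : ∀ a f x → evalP (scaleP a f) x ≈ (a ⊗ evalP f x)
  eval-scale a []      x = C.sym (C.zeroʳ a)
  eval-scale a (b ∷ f) x = C.trans (C.+-congˡ (C.*-congˡ (eval-scale a f x))) (eval-scale-step a b x _)

  eval-* : ∀ f g x → evalP (f *P g) x ≈ (evalP f x ⊗ evalP g x)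
  eval-* []      g x = C.sym (C.zeroˡ _)
  eval-* (a ∷ f) g x = C.trans (eval-+ (scaleP a g) (0# ∷ (f *P g)) x)
    (C.trans (C.+-cong (eval-scale a g x) (C.trans (C.+-identityˡ _) (C.*-congˡ (eval-* f g x)))) (eval-*-step a x _ _))

  eval-const : ∀ a x → evalP [ a ] x ≈ a
  eval-const a x = C.trans (C.+-congˡ (C.zeroʳ x)) (C.+-identityʳ a)

  x≉0⇒y≉0⇒xy≉0 : ∀ {x y} → ¬ (x ≈ 0#) → ¬ (y ≈ 0#) → ¬ ((x ⊗ y) ≈ 0#)
  x≉0⇒y≉0⇒xy≉0 {x} {y} x≉0 y≉0 xy≈0 with inverse x x≉0
  ... | z , xz≈1 = y≉0 (C.trans (C.sym (C.*-identityˡ y)) (C.trans (C.*-congʳ (C.trans (C.sym xz≈1) (C.*-comm x z)))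
                    (C.trans (C.*-assoc z x y) (C.trans (C.*-congˡ xy≈0) (C.zeroʳ z)))))

  -- Made total with value 0 at 0, so that prescribed values can be divided by those of any
  -- polynomial; nonvanishing enters only where the quotient must be correct.
  inv : Carrier → Carrier
  inv x with x ≈? 0#
  ... | yes _   = 0#
  ... | no x≉0 = proj₁ (inverse x x≉0)

  inv-inverseʳ : ∀ {x} → ¬ (x ≈ 0#) → (x ⊗ inv x) ≈ 1#
  inv-inverseʳ {x} x≉0 with x ≈? 0#
  ... | yes x≈0 = contradiction x≈0 x≉0
  ... | no x≉0′ = proj₂ (inverse x x≉0′)

  inv≉0 : ∀ {x} → ¬ (x ≈ 0#) → ¬ (inv x ≈ 0#)
  inv≉0 {x} x≉0 e = 0≉1 (C.trans (C.sym (C.zeroʳ x)) (C.trans (C.*-congˡ (C.sym e)) (inv-inverseʳ x≉0)))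

  *≈⇒≈*inv : ∀ {u w y} → ¬ (w ≈ 0#) → (u ⊗ w) ≈ y → u ≈ (y ⊗ inv w)
  *≈⇒≈*inv {u} {w} {y} w≉0 e = C.trans (C.sym (C.*-identityʳ u)) (C.trans (C.*-congˡ (C.sym (inv-inverseʳ w≉0)))
     (C.trans (C.sym (C.*-assoc u w (inv w))) (C.*-congʳ e)))

  ≈*inv⇒*≈ : ∀ {u w y} → ¬ (w ≈ 0#) → u ≈ (y ⊗ inv w) → (u ⊗ w) ≈ y
  ≈*inv⇒*≈ {u} {w} {y} w≉0 e = C.trans (C.*-congʳ e) (C.trans (C.*-assoc y (inv w) w)
    (C.trans (C.*-congˡ (C.trans (C.*-comm (inv w) w) (inv-inverseʳ w≉0))) (C.*-identityʳ y)))

  ≉0? : ∀ x → Dec (¬ (x ≈ 0#))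
  ≉0? x = ¬? (x ≈? 0#)

-- Leading coefficients, division with remainder, greatest common divisors.

module Divisibility {c ℓ : Level} (F : FiniteField c ℓ) where

  open Polynomials F
  module PS = SemiringSolver PR.commutativeSemiring
  open PS using (_:+_; _:*_; _:=_)
  private
    module NR = RingProps C.ring
    module NP = RingProps PR.ring

  DegLt : Poly → ℕ → Set ℓ
  DegLt f n = ∀ i → n ≤ i → coef f i ≈ 0#

  infixr 4 _,_
  -- The coefficient `a` may be zero here: `n` is the degree only together with a separate
  -- hypothesis that `a` is nonzero.
  record HasLead (f : Poly) (a : Carrier) (n : ℕ) : Set ℓ where
    constructor _,_
    field
      top   : coef f n ≈ a
      above : DegLt f (suc n)
  open HasLead

  infix 4 _∣_
  record _∣_ (f g : Poly) : Set (c ⊔ ℓ) where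
    constructor _,_
    field
      quotient : Poly
      equality : (f *P quotient) ≈P g

  Mon : Poly → ℕ → Set ℓ
  Mon f n = HasLead f 1# n

  degLt-0 : ∀ {f} → DegLt f 0 → f ≈P []
  degLt-0 {f} d = from≗ f [] (λ n → d n z≤n)

  degLt-cong : ∀ {f g n} → f ≈P g → DegLt f n → DegLt g n
  degLt-cong e d i le = C.trans (C.sym (to≗ e i)) (d i le)

  lead-cong : ∀ {f g a n} → f ≈P g → HasLead f a n → HasLead g a n
  lead-cong {n = n} e (l , d) = C.trans (C.sym (to≗ e n)) l , degLt-cong e d

  lead-coef : ∀ {f a b n} → a ≈ b → HasLead f a n → HasLead f b n
  lead-coef e (l , d) = C.trans l e , d

  lead-scale : ∀ {f a n} b → HasLead f a n → HasLead (scaleP b f) (b ⊗ a) n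
  lead-scale {f} b (l , d) = C.trans (coef-scale b f _) (C.*-congˡ l) ,
    λ i le → C.trans (coef-scale b f i) (C.trans (C.*-congˡ (d i le)) (C.zeroʳ b))

  lead-* : ∀ f {g a b n m} → HasLead f a n → HasLead g b m → HasLead (f *P g) (a ⊗ b) (n + m)
  lead-* [] (0≈a , _) _ = C.sym (C.trans (C.*-congʳ (C.sym 0≈a)) (C.zeroˡ _)) , λ _ _ → C.refl
  lead-* (x ∷ f) {g} {n = zero} (x≈a , d) lg =
    lead-coef (C.*-congʳ x≈a) (lead-cong (symP (transP
      (+P-cong (reflP {scaleP x g}) (∷≈[] C.refl (*P-cong {f} {[]} {g} (degLt-0 (λ i _ → d (suc i) (s≤s z≤n))) reflP)))
      (+P-identityʳ _))) (lead-scale {g} x lg))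
  lead-* (x ∷ f) {g} {a} {b} {suc n} {m} (l , d) lg@(_ , dg) with lead-* f {n = n} (l , λ i le → d (suc i) (s≤s le)) lg
  ... | l′ , d′ = C.trans (step (n + m) (s≤s (m≤n+m m n))) l′ ,
                  λ { (suc i) (s≤s le) → C.trans (step i (s≤s (≤-trans (m≤n+m m n) (<⇒≤ le)))) (d′ i le) }
    where
    step : ∀ i → suc m ≤ suc i → coef ((x ∷ f) *P g) (suc i) ≈ coef (f *P g) i
    step i le = C.trans (coef-+ (scaleP x g) _ (suc i)) (C.trans (C.+-congʳ
      (C.trans (coef-scale x g (suc i)) (C.trans (C.*-congˡ (dg (suc i) le)) (C.zeroʳ x)))) (C.+-identityˡ _))

  lead-unique : ∀ {f a b n m} → ¬ (a ≈ 0#) → ¬ (b ≈ 0#) → HasLead f a n → HasLead f b m → n ≡ m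
  lead-unique {n = n} {m} a≉0 b≉0 (l , d) (l′ , d′) = ≤-antisym
    (≮⇒≥ λ m<n → a≉0 (C.trans (C.sym l) (d′ n m<n)))
    (≮⇒≥ λ n<m → b≉0 (C.trans (C.sym l′) (d m n<m)))

  1≉0 : ¬ (1# ≈ 0#)
  1≉0 e = 0≉1 (C.sym e)

  degLt-cases : ∀ f n → DegLt f n → f ≈P [] ⊎ ∃ λ a → ∃ λ m → ¬ (a ≈ 0#) × HasLead f a m × suc m ≤ n
  degLt-cases f zero    d = inj₁ (degLt-0 d)
  degLt-cases f (suc n) d with coef f n ≈? 0#
  ... | no a≉0 = inj₂ (coef f n , n , a≉0 , (C.refl , d) , ≤-refl)
  ... | yes e with degLt-cases f n (λ i le → case m≤n⇒m<n∨m≡n le of λ { (inj₁ lt) → d i lt ; (inj₂ refl) → e })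
  ...   | inj₁ f≈0 = inj₁ f≈0
  ...   | inj₂ (a , m , a≉0 , l , lt) = inj₂ (a , m , a≉0 , l , m≤n⇒m≤1+n lt)

  degLt-length : ∀ f → DegLt f (length f)
  degLt-length []      i       _        = C.refl
  degLt-length (x ∷ f) (suc i) (s≤s le) = degLt-length f i le

  zero-or-lead : ∀ f → f ≈P [] ⊎ ∃ λ a → ∃ λ n → ¬ (a ≈ 0#) × HasLead f a n
  zero-or-lead f with degLt-cases f (length f) (degLt-length f)
  ... | inj₁ e = inj₁ e
  ... | inj₂ (a , n , a≉0 , l , _) = inj₂ (a , n , a≉0 , l)

  lead⇒≉0 : ∀ {f a n} → ¬ (a ≈ 0#) → HasLead f a n → ¬ (f ≈P [])
  lead⇒≉0 {n = n} a≉0 (l , _) e = a≉0 (C.trans (C.sym l) (to≗ e n))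

  mon⇒≉0 : ∀ {f n} → Mon f n → ¬ (f ≈P [])
  mon⇒≉0 = lead⇒≉0 1≉0

  mon-one : Mon oneP 0
  mon-one = C.refl , λ { (suc i) _ → C.refl }

  mon-* : ∀ {f g n m} → Mon f n → Mon g m → Mon (f *P g) (n + m)
  mon-* {f} {g} l l′ = lead-coef (C.*-identityˡ 1#) (lead-* f l l′)

  mon-∷ : ∀ {f n} x → Mon f n → Mon (x ∷ f) (suc n)
  mon-∷ x (l , d) = l , λ { (suc i) (s≤s le) → d i le }

  mon-tail : ∀ {f n x} → Mon (x ∷ f) (suc n) → Mon f n
  mon-tail (l , d) = l , λ i le → d (suc i) (s≤s le)

  mon-0 : ∀ {f} → Mon f 0 → f ≈P oneP
  mon-0 {f} (l , d) = from≗ f oneP λ { zero → l ; (suc i) → d (suc i) (s≤s z≤n) }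

  mon⇒monic : ∀ f {n} → Mon f n → MonicOfDeg f n
  mon⇒monic []      (0≈1 , _) = contradiction 0≈1 0≉1
  mon⇒monic (x ∷ f) {zero}  m = [] , refl , mon-0 m
  mon⇒monic (x ∷ f) {suc n} m with mon⇒monic f (mon-tail m)
  ... | cs , eq , e = x ∷ cs , cong suc eq , ∷≈∷ C.refl e

  monic⇒mon : ∀ {f n} → MonicOfDeg f n → Mon f n
  monic⇒mon (cs , refl , e) = lead-cong (symP e) (go cs)
    where
    go : ∀ cs → Mon (cs ++ [ 1# ]) (length cs)
    go []       = mon-one
    go (x ∷ cs) = mon-∷ x (go cs)

  integral : ∀ {f g} → ¬ (f ≈P []) → (f *P g) ≈P [] → g ≈P []
  integral {f} {g} f≉0 e with zero-or-lead f | zero-or-lead g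
  ... | inj₁ f≈0 | _        = contradiction f≈0 f≉0
  ... | inj₂ _   | inj₁ g≈0 = g≈0
  ... | inj₂ (a , n , a≉0 , l) | inj₂ (b , m , b≉0 , l′) =
    contradiction e (lead⇒≉0 (x≉0⇒y≉0⇒xy≉0 a≉0 b≉0) (lead-* f l l′))

  cancelˡ : ∀ {f g h} → ¬ (f ≈P []) → (f *P g) ≈P (f *P h) → g ≈P h
  cancelˡ {f} {g} {h} f≉0 e = NP.x∙y⁻¹≈ε⇒x≈y g h (integral f≉0
    (transP (PR.distribˡ f g (negP h)) (transP (+P-cong e (symP (NP.-‿distribʳ-* f h))) (PR.-‿inverseʳ (f *P h)))))

  mon-quotient : ∀ {f g h n m} → Mon f n → Mon g m → (f *P h) ≈P g → ∃ λ j → n + j ≡ m × Mon h j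
  mon-quotient {f} {g} {h} {n} {m} lf lg e with zero-or-lead h
  ... | inj₁ h≈0 = contradiction (transP (symP e) (transP (*P-congˡ f h≈0) (*P-zeroʳ f))) (mon⇒≉0 lg)
  ... | inj₂ (b , j , b≉0 , lh) with lead-coef (C.*-identityˡ b) (lead-cong e (lead-* f lf lh))
  ...   | lg′ with lead-unique b≉0 1≉0 lg′ lg
  ...     | refl = j , refl , lead-coef (C.trans (C.sym (top lg′)) (top lg)) lh

  ∣-trans : ∀ {f g h} → f ∣ g → g ∣ h → f ∣ h
  ∣-trans {f} (u , e) (v , e′) = u *P v , transP (symP (*P-assoc f u v)) (transP (*P-cong e reflP) e′)

  ∣-respʳ : ∀ {f g h} → g ≈P h → f ∣ g → f ∣ h
  ∣-respʳ e (u , e′) = u , transP e′ e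

  ∣-respˡ : ∀ {f g h} → f ≈P g → f ∣ h → g ∣ h
  ∣-respˡ e (u , e′) = u , transP (*P-cong (symP e) reflP) e′

  ∣-*ʳ : ∀ {f g} h → f ∣ g → f ∣ (g *P h)
  ∣-*ʳ {f} h (u , e) = u *P h , transP (symP (*P-assoc f u h)) (*P-cong e reflP)

  ∣-*ˡ : ∀ {f g} h → f ∣ g → f ∣ (h *P g)
  ∣-*ˡ {f} {g} h d = ∣-respʳ (*P-comm g h) (∣-*ʳ h d)

  ∣-+ : ∀ {f g h} → f ∣ g → f ∣ h → f ∣ (g +P h)
  ∣-+ {f} (u , e) (v , e′) = u +P v , transP (PR.distribˡ f u v) (+P-cong e e′)

  ∣-*-mono : ∀ {f f′ g g′} → f ∣ g → f′ ∣ g′ → (f *P f′) ∣ (g *P g′)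
  ∣-*-mono {f} {f′} (u , e) (v , e′) = u *P v ,
    transP (PS.solve 4 (λ f f′ u v → (f :* f′) :* (u :* v) := (f :* u) :* (f′ :* v)) reflP f f′ u v) (*P-cong e e′)

  ∣-refl : ∀ {f} → f ∣ f
  ∣-refl {f} = oneP , PR.*-identityʳ f

  ≈-∣ : ∀ {f g} → f ≈P g → f ∣ g
  ≈-∣ {f} e = oneP , transP (PR.*-identityʳ f) e

  ∣-cancelˡ : ∀ {d f g} → ¬ (d ≈P []) → (d *P f) ∣ (d *P g) → f ∣ g
  ∣-cancelˡ {d} {f} d≉0 (u , e) = u , cancelˡ d≉0 (transP (symP (*P-assoc d f u)) e)

  square≈ : ∀ h → (h ^P 2) ≈P (h *P h)
  square≈ h = *P-congˡ h (PR.*-identityʳ h)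

  unit-degree : ∀ {h a n} → h ∣ oneP → ¬ (a ≈ 0#) → HasLead h a n → n ≡ 0
  unit-degree {h} {n = n} (k , e) a≉0 lh with zero-or-lead k
  ... | inj₁ k≈0 = contradiction (transP (symP e) (transP (*P-congˡ h k≈0) (*P-zeroʳ h))) (mon⇒≉0 mon-one)
  ... | inj₂ (b , m , b≉0 , lk) = m+n≡0⇒m≡0 n (lead-unique (x≉0⇒y≉0⇒xy≉0 a≉0 b≉0) 1≉0 (lead-cong e (lead-* h lh lk)) mon-one)

  lead-0-unit : ∀ {h a} → ¬ (a ≈ 0#) → HasLead h a 0 → h ∣ oneP
  lead-0-unit {h} {a} a≉0 (l , d) = [ inv a ] , transP (*P-cong h≈a reflP)
    (transP (const-* a [ inv a ]) (∷≈∷ (inv-inverseʳ a≉0) []≈[]))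
    where
    h≈a : h ≈P [ a ]
    h≈a = from≗ h [ a ] λ { zero → l ; (suc i) → d (suc i) (s≤s z≤n) }

  normalise : ∀ {f a n} → ¬ (a ≈ 0#) → HasLead f a n → Mon (scaleP (inv a) f) n
  normalise a≉0 l = lead-coef (C.trans (C.*-comm _ _) (inv-inverseʳ a≉0)) (lead-scale _ l)

  normalise-∣ : ∀ {f a} → ¬ (a ≈ 0#) → scaleP (inv a) f ∣ f
  normalise-∣ {f} {a} a≉0 = [ a ] , transP (*P-comm _ [ a ]) (transP (const-* a _) (transP (scale-scale a (inv a) f)
    (transP (scale-cong (inv-inverseʳ a≉0) reflP) (scale-1 f))))

  ∣-normalise : ∀ f a → f ∣ scaleP a f
  ∣-normalise f a = [ a ] , transP (*P-comm f [ a ]) (const-* a f)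

  -- Long division from the top coefficient down: if `r` is the remainder of the tail, then X r plus
  -- the constant term has degree at most `n`, and one scalar multiple of `g` brings it below `n`.
  divMod : ∀ {g n} → Mon g n → ∀ f → ∃ λ k → ∃ λ r → f ≈P ((g *P k) +P r) × DegLt r n
  divMod {g} lg []      = [] , [] , symP (transP (+P-identityʳ _) (*P-zeroʳ g)) , λ _ _ → C.refl
  divMod {g} {n} (lg , dg) (x ∷ f) with divMod {g} {n} (lg , dg) f
  ... | k , r , e , d = a ∷ k , r′ , e′ , d′
    where
    a = coef (x ∷ r) n
    r′ = (x ∷ r) +P negP (scaleP a g)
    coef-r′ : ∀ i → coef r′ i ≈ (coef (x ∷ r) i ⊕ (⊖ (a ⊗ coef g i)))
    coef-r′ i = C.trans (coef-+ (x ∷ r) (negP (scaleP a g)) i) (C.+-congˡ (C.trans (coef-scale (⊖ 1#) (scaleP a g) i)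
      (C.trans (NR.-1*x≈-x _) (C.-‿cong (coef-scale a g i)))))
    d′ : DegLt r′ n
    d′ i n≤i with m≤n⇒m<n∨m≡n n≤i
    ... | inj₂ refl = C.trans (coef-r′ n) (C.trans (C.+-congˡ (C.-‿cong (C.trans (C.*-congˡ lg) (C.*-identityʳ a)))) (C.-‿inverseʳ a))
    d′ (suc i) n≤i | inj₁ (s≤s n≤i′) = C.trans (coef-r′ (suc i)) (C.trans (C.+-cong (d i n≤i′)
        (C.-‿cong (C.trans (C.*-congˡ (dg (suc i) (s≤s n≤i′))) (C.zeroʳ a)))) (C.-‿inverseʳ 0#))
    rearrange : ∀ u v w z → ((u +P v) +P (w +P z)) ≈P ((v +P w) +P (u +P z))
    rearrange = PS.solve 4 (λ u v w z → (u :+ v) :+ (w :+ z) := (v :+ w) :+ (u :+ z)) reflP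
    e′ : (x ∷ f) ≈P ((g *P (a ∷ k)) +P r′)
    e′ = symP (transP (+P-cong (*P-∷ʳ g a k) reflP) (transP (rearrange (scaleP a g) (0# ∷ (g *P k)) (x ∷ r) (negP (scaleP a g)))
      (transP (+P-cong (∷≈∷ (C.+-identityˡ x) (symP e)) (PR.-‿inverseʳ (scaleP a g))) (+P-identityʳ _))))

  _≈P?_ : ∀ f g → Dec (f ≈P g)
  []      ≈P? []      = yes []≈[]
  []      ≈P? (y ∷ g) = map′ (λ (e , es) → []≈∷ e es) (λ { ([]≈∷ e es) → e , es }) ((0# ≈? y) ×-dec ([] ≈P? g))
  (x ∷ f) ≈P? []      = map′ (λ (e , es) → ∷≈[] e es) (λ { (∷≈[] e es) → e , es }) ((x ≈? 0#) ×-dec (f ≈P? []))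
  (x ∷ f) ≈P? (y ∷ g) = map′ (λ (e , es) → ∷≈∷ e es) (λ { (∷≈∷ e es) → e , es }) ((x ≈? y) ×-dec (f ≈P? g))

  ∣-degLt⇒≈0 : ∀ {g n} → Mon g n → ∀ {r} → DegLt r n → g ∣ r → r ≈P []
  ∣-degLt⇒≈0 {g} {n} lg {r} d (h , e) with zero-or-lead h
  ... | inj₁ h≈0 = transP (symP e) (transP (*P-congˡ g h≈0) (*P-zeroʳ g))
  ... | inj₂ (b , j , b≉0 , lh) = contradiction
    (C.trans (C.trans (C.sym (C.*-identityˡ b)) (C.sym (top (lead-cong e (lead-* g lg lh))))) (d (n + j) (m≤m+n n j))) b≉0

  ∣-negP : ∀ {f g} → f ∣ g → f ∣ negP g
  ∣-negP {f} {g} d = ∣-trans d (∣-normalise g (⊖ 1#))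

  ∣-cancel-+ : ∀ {f g h} → f ∣ (g +P h) → f ∣ g → f ∣ h
  ∣-cancel-+ {f} {g} {h} d d′ = ∣-respʳ (transP (symP (+P-assoc (negP g) g h)) (transP (+P-cong (PR.-‿inverseˡ g) reflP) reflP))
    (∣-+ (∣-negP d′) d)

  ∣-dec : ∀ {g n} → Mon g n → ∀ f → Dec (g ∣ f)
  ∣-dec {g} lg f with divMod lg f
  ... | k , r , e , d with r ≈P? []
  ...   | yes r≈0 = yes (k , symP (transP e (transP (+P-cong (reflP {g *P k}) r≈0) (+P-identityʳ _))))
  ...   | no r≉0  = no λ g∣f → r≉0 (∣-degLt⇒≈0 lg d (∣-cancel-+ (∣-respʳ e g∣f) (k , reflP)))

  -- Extended Euclidean algorithm. The degree bound `n` drops either because the coefficient there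
  -- vanishes or because `g` is replaced by a remainder, so the recursion is structural.
  gcdP : ∀ n f g → DegLt g n → ∃ λ d → ∃ λ u → ∃ λ v → d ∣ f × d ∣ g × d ≈P ((u *P f) +P (v *P g))
  gcdP zero f g d = f , oneP , [] , ∣-refl , ([] , transP (*P-zeroʳ f) (symP (degLt-0 d))) ,
    symP (transP (+P-identityʳ _) (PR.*-identityˡ f))
  gcdP (suc n) f g d with coef g n ≈? 0#
  ... | yes e = gcdP n f g (λ i le → case m≤n⇒m<n∨m≡n le of λ { (inj₁ lt) → d i lt ; (inj₂ refl) → e })
  ... | no a≉0 with divMod (normalise {g} a≉0 (C.refl , d)) f
  ...   | k , r , e , dr with gcdP n g r dr
  ...     | w , u , v , w∣g , w∣r , w≈ = w , v , u +P negP (v *P k′) ,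
              ∣-respʳ (symP e) (∣-+ (∣-*ʳ k (∣-trans w∣g (∣-normalise g a))) w∣r) , w∣g , w≈′
    where
    a = inv (coef g n)
    k′ = scaleP a k
    gk : (scaleP a g *P k) ≈P (g *P k′)
    gk = transP (scale-* a g k) (transP (scale-cong C.refl (*P-comm g k)) (transP (symP (scale-* a k g)) (*P-comm k′ g)))
    step : ∀ u v g r k m → (((u *P g) +P (v *P r)) +P ((m +P (v *P k)) *P g)) ≈P ((v *P ((g *P k) +P r)) +P ((u +P m) *P g))
    step = PS.solve 6 (λ u v g r k m → ((u :* g) :+ (v :* r)) :+ ((m :+ (v :* k)) :* g)
                   := (v :* ((g :* k) :+ r)) :+ ((u :+ m) :* g)) reflP
    w≈′ : w ≈P ((v *P f) +P ((u +P negP (v *P k′)) *P g))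
    w≈′ = transP w≈ (transP (symP (+P-identityʳ _)) (transP (+P-cong reflP (symP
      (*P-cong {g = g} (PR.-‿inverseˡ (v *P k′)) reflP)))
      (transP (step u v g r k′ (negP (v *P k′))) (+P-cong (*P-congˡ v (transP (+P-cong (symP gk) reflP) (symP e))) reflP))))

  Bezout : Poly → Poly → Set (c ⊔ ℓ)
  Bezout f g = ∃ λ u → ∃ λ v → ((u *P f) +P (v *P g)) ≈P oneP

  bezout-sym : ∀ {f g} → Bezout f g → Bezout g f
  bezout-sym {f} {g} (u , v , e) = v , u , transP (+P-comm (v *P g) (u *P f)) e

  coprime⇒bezout : ∀ {f g} → (∀ h → h ∣ f → h ∣ g → h ∣ oneP) → Bezout f g
  coprime⇒bezout {f} {g} cop with gcdP (length g) f g (degLt-length g)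
  ... | d , u , v , d∣f , d∣g , d≈ with cop d d∣f d∣g
  ...   | k , dk≈1 = k *P u , k *P v , transP (step k u v f g) (transP (*P-congˡ k (symP d≈)) (transP (*P-comm k d) dk≈1))
    where
    step : ∀ k u v f g → (((k *P u) *P f) +P ((k *P v) *P g)) ≈P (k *P ((u *P f) +P (v *P g)))
    step = PS.solve 5 (λ k u v f g → ((k :* u) :* f) :+ ((k :* v) :* g) := k :* ((u :* f) :+ (v :* g))) reflP

  bezout⇒∣ : ∀ {f g h} → Bezout f g → f ∣ (g *P h) → f ∣ h
  bezout⇒∣ {f} {g} {h} (u , v , e) d = ∣-respʳ (transP (step u v f g h) (transP (*P-cong e reflP) (*P-identityˡ h)))
    (∣-+ (∣-*ʳ (u *P h) ∣-refl) (∣-*ˡ v d))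
    where
    step : ∀ u v f g h → ((f *P (u *P h)) +P (v *P (g *P h))) ≈P (((u *P f) +P (v *P g)) *P h)
    step = PS.solve 5 (λ u v f g h → (f :* (u :* h)) :+ (v :* (g :* h)) := ((u :* f) :+ (v :* g)) :* h) reflP

  -- In the product of the two identities every term except v v′ g h contains `f`.
  bezout-* : ∀ {f g h} → Bezout f g → Bezout f h → Bezout f (g *P h)
  bezout-* {f} {g} {h} (u , v , e) (u′ , v′ , e′) =
    ((u *P (u′ *P f)) +P ((v *P g) *P u′)) +P (u *P (v′ *P h)) , v *P v′ ,
    transP (step u v u′ v′ f g h) (transP (*P-cong e e′) (*P-identityˡ oneP))
    where
    step : ∀ u v u′ v′ f g h → (((((u *P (u′ *P f)) +P ((v *P g) *P u′)) +P (u *P (v′ *P h))) *P f) +P ((v *P v′) *P (g *P h)))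
           ≈P (((u *P f) +P (v *P g)) *P ((u′ *P f) +P (v′ *P h)))
    step = PS.solve 7 (λ u v u′ v′ f g h →
      ((((u :* (u′ :* f)) :+ ((v :* g) :* u′)) :+ (u :* (v′ :* h))) :* f) :+ ((v :* v′) :* (g :* h))
      := ((u :* f) :+ (v :* g)) :* ((u′ :* f) :+ (v′ :* h))) reflP

  record GCD (f g : Poly) : Set (c ⊔ ℓ) where
    field
      d f′ g′ : Poly
      f≈      : (d *P f′) ≈P f
      g≈      : (d *P g′) ≈P g
      d≉0     : ¬ (d ≈P [])
      bezout  : Bezout f′ g′

  -- The identity for the cofactors is the one expressing `d` with `d` cancelled; `d` is nonzero
  -- because it divides `g`.
  gcd-split : ∀ f g → ¬ (g ≈P []) → GCD f g
  gcd-split f g g≉0 with gcdP (length g) f g (degLt-length g)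
  ... | d , u , v , (f′ , f≈) , (g′ , g≈) , d≈ = record
    { d = d ; f′ = f′ ; g′ = g′ ; f≈ = f≈ ; g≈ = g≈ ; d≉0 = d≉0
    ; bezout = u , v , cancelˡ d≉0 (transP (step d u v f′ g′)
        (transP (+P-cong (*P-congˡ u f≈) (*P-congˡ v g≈)) (transP (symP d≈) (symP (PR.*-identityʳ d))))) }
    where
    d≉0 : ¬ (d ≈P [])
    d≉0 e = g≉0 (transP (symP g≈) (*P-cong e reflP))
    step : ∀ d u v f g → (d *P ((u *P f) +P (v *P g))) ≈P ((u *P (d *P f)) +P (v *P (d *P g)))
    step = PS.solve 5 (λ d u v f g → d :* ((u :* f) :+ (v :* g)) := (u :* (d :* f)) :+ (v :* (d :* g))) reflP

-- Squarefree polynomials, the square part, and the pairs (g, h) behind the weighted families.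

module SquareFreePolynomials {c ℓ : Level} (F : FiniteField c ℓ) where

  open Polynomials F
  open Divisibility F
  open PS using (_:+_; _:*_; _:=_)

  SqFree : Poly → Set (c ⊔ ℓ)
  SqFree f = ∀ h → (h *P h) ∣ f → h ∣ oneP

  sqfree-∣ : ∀ {f g} → f ∣ g → SqFree g → SqFree f
  sqfree-∣ d sf h hh∣f = sf h (∣-trans hh∣f d)

  private
    rearrange₁ : ∀ d s a → (s *P ((d *P a) *P (d *P a))) ≈P ((d *P d) *P ((a *P a) *P s))
    rearrange₁ = PS.solve 3 (λ d s a → s :* ((d :* a) :* (d :* a)) := (d :* d) :* ((a :* a) :* s)) reflP

    rearrange₂ : ∀ d a → ((d *P a) *P (d *P a)) ≈P ((d *P d) *P (a *P a))
    rearrange₂ = PS.solve 2 (λ d a → (d :* a) :* (d :* a) := (d :* d) :* (a :* a)) reflP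

    rearrange₃ : ∀ d a → ((d *P a) *P (d *P a)) ≈P (d *P ((a *P a) *P d))
    rearrange₃ = PS.solve 2 (λ d a → (d :* a) :* (d :* a) := d :* ((a :* a) :* d)) reflP

  bezout-squares : ∀ {f g} → Bezout f g → Bezout (f *P f) (g *P g)
  bezout-squares b = let b′ = bezout-* b b in bezout-sym (bezout-* (bezout-sym b′) (bezout-sym b′))

  *-≉0 : ∀ {f g} → ¬ (f ≈P []) → ¬ (g ≈P []) → ¬ ((f *P g) ≈P [])
  *-≉0 f≉0 g≉0 e = g≉0 (integral f≉0 e)

  -- With d = gcd a b, the cofactor of b in d is prime to that of a, so its square divides s.
  square-∣⇒∣ : ∀ {s a b} → SqFree s → ¬ (b ≈P []) → (b *P b) ∣ (s *P (a *P a)) → b ∣ a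
  square-∣⇒∣ {s} {a} {b} sf b≉0 div = ∣-trans b∣d (f′ , f≈)
    where
    open GCD (gcd-split a b b≉0)
    div′ : ((d *P d) *P (g′ *P g′)) ∣ ((d *P d) *P ((f′ *P f′) *P s))
    div′ = ∣-respˡ (transP (*P-cong (symP g≈) (symP g≈)) (rearrange₂ d g′))
             (∣-respʳ (transP (*P-congˡ s (*P-cong (symP f≈) (symP f≈))) (rearrange₁ d s f′)) div)
    b∣d : b ∣ d
    b∣d = ∣-respˡ g≈ (∣-respʳ (PR.*-identityʳ d)
      (∣-*-mono (∣-refl {d}) (sf g′ (bezout⇒∣ (bezout-squares (bezout-sym bezout)) (∣-cancelˡ (*-≉0 d≉0 d≉0) div′)))))

  -- With d = gcd p f, the cofactor of `p` is coprime to that of `f`, so its square divides `g` and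
  -- it is a unit; hence `p` divides d.
  sqfree-∣ˡ : ∀ {f g p} → ¬ (f ≈P []) → SqFree g → (p *P p) ∣ (f *P g) → p ∣ f
  sqfree-∣ˡ {f} {g} {p} f≉0 sf div = ∣-trans p∣d (g′ , g≈)
    where
    open GCD (gcd-split p f f≉0)
    div′ : (d *P ((f′ *P f′) *P d)) ∣ (d *P (g′ *P g))
    div′ = ∣-respˡ (transP (*P-cong (symP f≈) (symP f≈)) (rearrange₃ d f′))
             (∣-respʳ (transP (*P-cong (symP g≈) reflP) (*P-assoc d g′ g)) div)
    p∣d : p ∣ d
    p∣d = ∣-respˡ f≈ (∣-respʳ (PR.*-identityʳ d) (∣-*-mono (∣-refl {d})
      (sf f′ (bezout⇒∣ (bezout-sym (bezout-* (bezout-sym bezout) (bezout-sym bezout))) (∣-trans (∣-*ʳ d ∣-refl) (∣-cancelˡ d≉0 div′))))))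

  sqfree-* : ∀ {f g} → ¬ (f ≈P []) → ¬ (g ≈P []) → SqFree f → SqFree g → Bezout f g → SqFree (f *P g)
  sqfree-* {f} {g} f≉0 g≉0 sf sg (u , v , e) p div = ∣-respʳ e (∣-+
    (∣-*ˡ u (sqfree-∣ˡ f≉0 sg div)) (∣-*ˡ v (sqfree-∣ˡ g≉0 sf (∣-respʳ (*P-comm f g) div))))

  mon-antisym : ∀ {f g n m} → Mon f n → Mon g m → f ∣ g → g ∣ f → f ≈P g
  mon-antisym {f} {g} {n} {m} lf lg (h , e) (k , e′) with mon-quotient lf lg e | mon-quotient lg lf e′
  ... | j , refl , lh | j′ , eq , _ with m+n≡0⇒m≡0 j (+-cancelˡ-≡ n _ _ (trans (sym (+-assoc n j j′)) (trans eq (sym (+-identityʳ n)))))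
  ...   | refl = transP (symP (transP (*P-congˡ f (mon-0 lh)) (PR.*-identityʳ f))) e

  -- t² divides s′ t′² with s′ squarefree, so t divides t′, and conversely; monic polynomials
  -- dividing each other agree, and then s = s′ by cancellation.
  square-part-unique : ∀ {s s′ t t′ j j′} → SqFree s → SqFree s′ → Mon t j → Mon t′ j′ →
                       (s *P (t *P t)) ≈P (s′ *P (t′ *P t′)) → s ≈P s′ × t ≈P t′
  square-part-unique {s} {s′} {t} {t′} sf sf′ lt lt′ e = s≈s′ , t≈t′
    where
    t≈t′ : t ≈P t′
    t≈t′ = mon-antisym lt lt′
      (square-∣⇒∣ {s′} sf′ (mon⇒≉0 lt) (∣-respʳ e (∣-*ˡ s ∣-refl)))
      (square-∣⇒∣ {s} sf (mon⇒≉0 lt′) (∣-respʳ (symP e) (∣-*ˡ s′ ∣-refl)))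
    s≈s′ : s ≈P s′
    s≈s′ = cancelˡ (*-≉0 (mon⇒≉0 lt) (mon⇒≉0 lt)) (transP (*P-comm (t *P t) s)
      (transP e (transP (*P-congˡ s′ (symP (*P-cong t≈t′ t≈t′))) (*P-comm s′ (t *P t)))))

  _∣?_ : ∀ g f → Dec (g ∣ f)
  g ∣? f with zero-or-lead g
  ... | inj₁ g≈0 = map′ (λ f≈0 → [] , transP (*P-zeroʳ g) (symP f≈0)) (λ (h , e) → transP (symP e) (*P-cong g≈0 (reflP {h}))) (f ≈P? [])
  ... | inj₂ (a , n , a≉0 , l) = map′ (∣-trans (∣-normalise g (inv a))) (∣-trans (normalise-∣ a≉0)) (∣-dec (normalise a≉0 l) f)

  M : ℕ → List Poly
  M zero    = [ oneP ]
  M (suc n) = map (λ (x , f) → x ∷ f) (pairs elements (λ _ → M n))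

  enum-elements : Enum _≈_ (λ _ → ⊤) elements
  enum-elements = enum (All.universal (λ _ → tt) elements) elements-distinct (λ x _ → elements-complete x)

  enum-M : ∀ n → Enum _≈P_ (λ f → Mon f n) (M n)
  enum-M zero    = enum-⇔ (λ f e → lead-cong (symP e) mon-one) (λ f → mon-0) (enum-singleton ≈P-equiv)
  enum-M (suc n) = enum-map (λ (x , f) → x ∷ f) transP
    (λ {(x , f)} (_ , l) → mon-∷ x l)
    (λ { _ _ (∷≈∷ e es) → e , es })
    (λ _ (e , es) → ∷≈∷ e es)
    (λ { [] (0≈1 , _) → contradiction 0≈1 0≉1 ; (x ∷ f) l → (x , f) , (tt , mon-tail l) , reflP })
    (enum-pairs enum-elements (λ _ _ → enum-M n) (λ _ _ l → l))

  units : ℕ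
  units = ∑ elements (λ u → 𝟙 (≉0? u))

  ∑-M-suc : ∀ n φ → ∑ (M (suc n)) φ ≡ ∑ elements (λ x → ∑ (M n) (λ f → φ (x ∷ f)))
  ∑-M-suc n φ = trans (∑-map _ (pairs elements (λ _ → M n)) φ) (∑-pairs elements (λ _ → M n) (λ (x , f) → φ (x ∷ f)))

  length-M : ∀ n → length (M n) ≡ card ^ n
  length-M zero    = refl
  length-M (suc n) = trans (sym (∑-length (M (suc n)))) (trans (∑-M-suc n (λ _ → 1))
    (trans (∑-cong elements (λ _ → trans (∑-length (M n)) (length-M n))) (∑-const elements (card ^ n))))

  square-divisor : ∀ {f a n h b k} → ¬ (a ≈ 0#) → HasLead f a n → ¬ (b ≈ 0#) → HasLead h b k → (h *P h) ∣ f → k ≤ n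
  square-divisor {f} {n = n} {h} {k = k} a≉0 lf b≉0 lh (q , e) with zero-or-lead q
  ... | inj₁ q≈0 = contradiction (transP (symP e) (transP (*P-congˡ (h *P h) q≈0) (*P-zeroʳ (h *P h)))) (lead⇒≉0 a≉0 lf)
  ... | inj₂ (b′ , j , b′≉0 , lq) = subst (k ≤_)
          (lead-unique (x≉0⇒y≉0⇒xy≉0 (x≉0⇒y≉0⇒xy≉0 b≉0 b≉0) b′≉0) a≉0 (lead-cong e (lead-* (h *P h) (lead-* h lh lh) lq)) lf)
          (≤-trans (m≤m+n k k) (m≤m+n (k + k) j))

  -- A finite search suffices: the root of a square divisor has degree at most that of `f` and may
  -- be taken monic. Constants are skipped, being units.
  sqfree-or-square : ∀ {f a n} → ¬ (a ≈ 0#) → HasLead f a n → SqFree f ⊎ ∃ λ h → ∃ λ k → Mon h (suc k) × (h *P h) ∣ f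
  sqfree-or-square {f} {a} {n} a≉0 lf with Any.any? (λ k → Any.any? (λ h → (h *P h) ∣? f) (M (suc k))) (upTo n)
  ... | yes found with Any.satisfied found
  ...   | k , found′ with find (Enum.member (enum-M (suc k))) found′
    where
    find : ∀ {L} → All (λ h → Mon h (suc k)) L → Any (λ h → (h *P h) ∣ f) L → ∃ λ h → Mon h (suc k) × (h *P h) ∣ f
    find (m ∷ ms) (here d)  = _ , m , d
    find (m ∷ ms) (there i) = find ms i
  ...     | h , m , d = inj₂ (h , k , m , d)
  sqfree-or-square {f} {a} {n} a≉0 lf | no none = inj₁ sf
    where
    sf : SqFree f
    sf h d with zero-or-lead h
    ... | inj₁ h≈0 = contradiction (∣-zero d) (lead⇒≉0 a≉0 lf)
      where
      ∣-zero : (h *P h) ∣ f → f ≈P []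
      ∣-zero (q , e) = transP (symP e) (*P-cong {h *P h} {[]} {q} (*P-cong {h} {[]} {h} h≈0 reflP) reflP)
    ... | inj₂ (b , zero  , b≉0 , lh) = lead-0-unit b≉0 lh
    ... | inj₂ (b , suc k , b≉0 , lh) = contradiction
      (Any.map (λ { refl → Any.map (λ e → ∣-respˡ (*P-cong e e) (∣-trans (∣-*-mono {scaleP (inv b) h} {scaleP (inv b) h} {h} {h} (normalise-∣ b≉0) (normalise-∣ b≉0)) d))
                 (Enum.covers (enum-M (suc k)) _ (normalise b≉0 lh)) })
        (Enum.covers (enum-upTo n) k (square-divisor a≉0 lf b≉0 lh d))) none

  opaque
    sqfree? : ∀ f → Dec (SqFree f)
    sqfree? f with zero-or-lead f
    -- Zero is divisible by X², and X is not a unit.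
    ... | inj₁ f≈0 = no λ sf → case unit-degree (sf (0# ∷ oneP) ([] , transP (*P-zeroʳ ((0# ∷ oneP) *P (0# ∷ oneP))) (symP f≈0))) 1≉0 (mon-∷ 0# mon-one) of λ ()
    ... | inj₂ (a , n , a≉0 , l) with sqfree-or-square a≉0 l
    ...   | inj₁ sf = yes sf
    ...   | inj₂ (h , k , m , d) = no λ sf → case unit-degree (sf h d) 1≉0 m of λ ()

  SFMon : ℕ → Poly → Set (c ⊔ ℓ)
  SFMon n f = Mon f n × SqFree f

  SF : ℕ → List Poly
  SF n = filter sqfree? (M n)

  enum-SF : ∀ n → Enum _≈P_ (SFMon n) (SF n)
  enum-SF n = enum-filter ≈P-equiv sqfree? (λ e → sqfree-∣ (≈-∣ (symP e))) (enum-M n)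

  sqfree-oneP : SqFree oneP
  sqfree-oneP h (q , e) = (h *P q) , transP (symP (*P-assoc h h q)) e

  -- Monic square divisors of positive degree are split off until none is left, their roots
  -- accumulating in t; `b` bounds the degree and drives the recursion.
  decompose : ∀ b {n f} → n ≤ b → Mon f n →
              ∃ λ s → ∃ λ t → ∃ λ i → ∃ λ j → SFMon i s × Mon t j × j + j + i ≡ n × f ≈P (s *P (t *P t))
  decompose b {n} {f} n≤b m with sqfree-or-square 1≉0 m
  ... | inj₁ sf = f , oneP , n , 0 , (m , sf) , mon-one , refl , symP (transP (*P-congˡ f (*P-identityˡ oneP)) (PR.*-identityʳ f))
  ... | inj₂ (h , k , mh , (q , e)) with mon-quotient (mon-* mh mh) m e
  decompose (suc b) (s≤s n≤b) m | inj₂ (h , k , mh , (q , e)) | n′ , refl , mq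
    with decompose b (≤-trans (≤-trans (m≤n+m n′ (suc k)) (+-monoˡ-≤ n′ (m≤n+m (suc k) k))) n≤b) mq
  ...   | s , t , i , j , sf , mt , eq , q≈ = s , h *P t , i , suc k + j , sf , mon-* mh mt ,
            trans (degrees (suc k) i j) (cong (suc k + suc k +_) eq) ,
            transP (symP e) (transP (*P-congˡ (h *P h) q≈) (step h s t))
    where
    degrees : ∀ k i j → (k + j) + (k + j) + i ≡ k + k + (j + j + i)
    degrees = solve-∀
    step : ∀ h s t → ((h *P h) *P (s *P (t *P t))) ≈P (s *P ((h *P t) *P (h *P t)))
    step = PS.solve 3 (λ h s t → (h :* h) :* (s :* (t :* t)) := s :* ((h :* t) :* (h :* t))) reflP

  record SquareFreePair (N d : ℕ) (g h : Poly) : Set (c ⊔ ℓ) where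
    constructor sfPair
    field
      {i j} : ℕ
      g-sf  : SFMon i g
      h-sf  : SFMon j h
      degs  : N * j + i ≡ d

  inv-scale : ∀ {b} f → ¬ (b ≈ 0#) → scaleP (inv b) (scaleP b f) ≈P f
  inv-scale {b} f b≉0 = transP (scale-scale (inv b) b f)
    (transP (scale-cong (C.trans (C.*-comm _ _) (inv-inverseʳ b≉0)) reflP) (scale-1 f))

  private
    toUnit : ∀ {h} → h ∣ oneP → IsUnitP h
    toUnit (k , e) = k , e

    fromUnit : ∀ {h} → IsUnitP h → h ∣ oneP
    fromUnit (k , e) = k , e

    toSquareFree : ∀ {f} → SqFree f → SquareFree f
    toSquareFree sf h (q , e) = toUnit (sf h (q , transP (*P-cong (symP (square≈ h)) reflP) e))

    fromSquareFree : ∀ {f} → SquareFree f → SqFree f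
    fromSquareFree sf h (q , e) = fromUnit (sf h (q , transP (*P-cong (square≈ h) reflP) e))

    powers : ∀ f g h → (f *P ((g ^P 2) *P (h ^P 3))) ≈P ((h *P f) *P ((h *P g) *P (h *P g)))
    powers f g h = transP (*P-congˡ f (*P-cong (square≈ g) (*P-congˡ h (square≈ h)))) (step f g h)
      where
      step : ∀ f g h → (f *P ((g *P g) *P (h *P (h *P h)))) ≈P ((h *P f) *P ((h *P g) *P (h *P g)))
      step = PS.solve 3 (λ f g h → f :* ((g :* g) :* (h :* (h :* h)))
                 := (h :* f) :* ((h :* g) :* (h :* g))) reflP

    power₄ : ∀ p → (p ^P 4) ≈P ((p *P p) *P (p *P p))
    power₄ p = transP (*P-congˡ p (*P-congˡ p (square≈ p))) (symP (*P-assoc p p (p *P p)))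

    weights : ∀ N n₁ n₂ n₃ → N * (n₃ + n₂) + (n₃ + n₁) ≡ 1 * n₁ + N * n₂ + suc N * n₃
    weights = solve-∀

    -- A gcd is known only up to a scalar: its leading coefficient `b` is moved to the cofactor to
    -- make the gcd monic.
    rescale : ∀ {b w f g} → ¬ (b ≈ 0#) → (w *P f) ≈P g → (scaleP (inv b) w *P scaleP b f) ≈P g
    rescale {b} {w} {f} b≉0 e = transP (scale-* (inv b) w (scaleP b f))
      (transP (scale-cong C.refl (transP (*P-comm w (scaleP b f)) (transP (scale-* b f w) (scale-cong C.refl (transP (*P-comm f w) e)))))
      (inv-scale _ b≉0))

    unscale-∣ : ∀ {b} → ¬ (b ≈ 0#) → ∀ f → scaleP b f ∣ f
    unscale-∣ {b} b≉0 f = [ inv b ] , transP (*P-comm (scaleP b f) [ inv b ]) (transP (const-* (inv b) _) (inv-scale f b≉0))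

  PairDecomposition : ℕ → ℕ → Poly → Set (c ⊔ ℓ)
  PairDecomposition N d f = ∃ λ a → ∃ λ g → ∃ λ h → ¬ (a ≈ 0#) × SquareFreePair N d g h × f ≈P scaleP a (g *P (h *P h))

  -- f₁ f₂² f₃³ = g h² with g = f₁ f₃ and h = f₂ f₃, the degrees of g and h being weighted by 1 and N.
  infhat⇒pair : ∀ {N d f} → InFhat N d f → PairDecomposition N d f
  infhat⇒pair {N} {d} {f} (_ , a , f₁ , f₂ , f₃ , n₁ , n₂ , n₃ , a≉0 , m₁ , m₂ , m₃ , s₁ , s₂ , s₃ , c₁₂ , c₁₃ , c₂₃ , f≈ , deg) =
    a , f₃ *P f₁ , f₃ *P f₂ , a≉0 ,
    sfPair (mon-* l₃ l₁ , sqfree-* (mon⇒≉0 l₃) (mon⇒≉0 l₁) (fromSquareFree s₃) (fromSquareFree s₁) (bezout-sym (coprime c₁₃)))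
           (mon-* l₃ l₂ , sqfree-* (mon⇒≉0 l₃) (mon⇒≉0 l₂) (fromSquareFree s₃) (fromSquareFree s₂) (bezout-sym (coprime c₂₃)))
           (trans (weights N n₁ n₂ n₃) deg) ,
    transP f≈ (scale-cong C.refl (powers f₁ f₂ f₃))
    where
    l₁ = monic⇒mon m₁
    l₂ = monic⇒mon m₂
    l₃ = monic⇒mon m₃
    coprime : ∀ {f g} → CoprimeP f g → Bezout f g
    coprime c = coprime⇒bezout (λ { h (u , e) (v , e′) → fromUnit (c h (u , e) (v , e′)) })

  -- Here f₃ is the monic gcd of `g` and `h`, with f₁ and f₂ the cofactors. If p⁴ divides g h², then
  -- (p²)² does, so p² divides `h` because `g` is squarefree, and `p` is a unit because `h` is
  -- squarefree.
  pair⇒infhat : ∀ {N d f a g h} → ¬ (a ≈ 0#) → SquareFreePair N d g h → f ≈P scaleP a (g *P (h *P h)) → InFhat N d f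
  pair⇒infhat {N} {d} {f} {a} {g} {h} a≉0 (sfPair {i} {j} (mg , sg) (mh , sh) deg) f≈ with gcd-split g h (mon⇒≉0 mh)
  ... | record { d = w ; f′ = g′ ; g′ = h′ ; f≈ = g≈ ; g≈ = h≈ ; d≉0 = w≉0 ; bezout = (u , v , uv) } with zero-or-lead w
  ...   | inj₁ w≈0 = contradiction w≈0 w≉0
  ...   | inj₂ (b , n₃ , b≉0 , lw) with mon-quotient {scaleP (inv b) w} {g} {scaleP b g′} (normalise b≉0 lw) mg (rescale {b} {w} {g′} b≉0 g≈)
                                       | mon-quotient {scaleP (inv b) w} {h} {scaleP b h′} (normalise b≉0 lw) mh (rescale {b} {w} {h′} b≉0 h≈)
  ...     | n₁ , refl , m₁ | n₂ , refl , m₂ = free ,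
            (a , f₁ , f₂ , f₃ , n₁ , n₂ , n₃ , a≉0 , mon⇒monic f₁ m₁ , mon⇒monic f₂ m₂ , mon⇒monic f₃ m₃ ,
             toSquareFree (sqfree-∣ f₁∣g sg) , toSquareFree (sqfree-∣ f₂∣h sh) , toSquareFree (sqfree-∣ f₃∣g sg) ,
             (λ p (x , ex) (y , ey) → toUnit (coprime₁₂ p (x , ex) (y , ey))) ,
             -- A common divisor of f₁ and f₃ has its square dividing f₃ f₁ = g; the next line
             -- argues alike with f₃ f₂ = h.
             (λ p (x , ex) (y , ey) → toUnit (sg p (∣-respʳ e₁ (∣-*-mono {p} {p} {f₃} {f₁} (y , ey) (x , ex))))) ,
             (λ p (x , ex) (y , ey) → toUnit (sh p (∣-respʳ e₂ (∣-*-mono {p} {p} {f₃} {f₂} (y , ey) (x , ex))))) ,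
             transP f≈ (scale-cong C.refl (symP (transP (powers f₁ f₂ f₃) (*P-cong e₁ (*P-cong e₂ e₂))))) ,
             trans (sym (weights N n₁ n₂ n₃)) deg)
    where
    f₁ = scaleP b g′
    f₂ = scaleP b h′
    f₃ = scaleP (inv b) w
    m₃ = normalise b≉0 lw
    e₁ : (f₃ *P f₁) ≈P g
    e₁ = rescale {b} {w} {g′} b≉0 g≈
    e₂ : (f₃ *P f₂) ≈P h
    e₂ = rescale {b} {w} {h′} b≉0 h≈
    f₁∣g : f₁ ∣ g
    f₁∣g = ∣-respʳ e₁ (∣-*ˡ f₃ ∣-refl)
    f₃∣g : f₃ ∣ g
    f₃∣g = ∣-respʳ e₁ (∣-*ʳ f₁ ∣-refl)
    f₂∣h : f₂ ∣ h
    f₂∣h = ∣-respʳ e₂ (∣-*ˡ f₃ ∣-refl)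
    coprime₁₂ : ∀ p → p ∣ f₁ → p ∣ f₂ → p ∣ oneP
    coprime₁₂ p d₁ d₂ = ∣-respʳ uv (∣-+ (∣-*ˡ u (∣-trans d₁ (unscale-∣ b≉0 g′))) (∣-*ˡ v (∣-trans d₂ (unscale-∣ b≉0 h′))))
    free : PowerFree 4 f
    free p (q , e) = toUnit (sh p (square-∣⇒∣ sg pp≉0 pp²∣))
      where
      pp²∣f : ((p *P p) *P (p *P p)) ∣ f
      pp²∣f = q , transP (*P-cong (symP (power₄ p)) reflP) e
      k≉0 : ¬ ((g *P (h *P h)) ≈P [])
      k≉0 = *-≉0 (mon⇒≉0 mg) (*-≉0 (mon⇒≉0 mh) (mon⇒≉0 mh))
      pp²∣ : ((p *P p) *P (p *P p)) ∣ (g *P (h *P h))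
      pp²∣ = ∣-trans pp²∣f (∣-respˡ (symP f≈) (unscale-∣ a≉0 (g *P (h *P h))))
      pp≉0 : ¬ ((p *P p) ≈P [])
      pp≉0 z = k≉0 (lemma pp²∣)
        where
        lemma : ((p *P p) *P (p *P p)) ∣ (g *P (h *P h)) → (g *P (h *P h)) ≈P []
        lemma (r , e) = transP (symP e) (*P-cong {(p *P p) *P (p *P p)} {[]} {r} (*P-cong {p *P p} {[]} {p *P p} z reflP) reflP)

-- Comparison of natural numbers up to an error, and of sequences up to o(q^d), without subtraction.

record Near (a b r : ℕ) : Set where
  constructor _,_
  field
    below : a ≤ b + r
    above : b ≤ a + r

near-refl : ∀ {a} → Near a a 0
near-refl {a} = ≤-reflexive (sym (+-identityʳ a)) , ≤-reflexive (sym (+-identityʳ a))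

near-≡ : ∀ {a b} → a ≡ b → Near a b 0
near-≡ refl = near-refl

near-cong : ∀ {a a′ b b′ r} → a ≡ a′ → b ≡ b′ → Near a b r → Near a′ b′ r
near-cong refl refl n = n

near-sym : ∀ {a b r} → Near a b r → Near b a r
near-sym (p , q) = q , p

near-≤ : ∀ {a b r r′} → r ≤ r′ → Near a b r → Near a b r′
near-≤ {a} {b} le (p , q) = ≤-trans p (+-monoʳ-≤ b le) , ≤-trans q (+-monoʳ-≤ a le)

near-trivial : ∀ {a b r} → a ≤ r → b ≤ r → Near a b r
near-trivial {a} {b} p q = ≤-trans p (m≤n+m _ b) , ≤-trans q (m≤n+m _ a)

near-trans : ∀ {a b c r s} → Near a b r → Near b c s → Near a c (r + s)
near-trans {a} {b} {c} {r} {s} (p , q) (p′ , q′) =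
  ≤-trans p (≤-trans (+-monoˡ-≤ r p′) (≤-reflexive (eq c s r))) ,
  ≤-trans q′ (≤-trans (+-monoˡ-≤ s q) (≤-reflexive (+-assoc a r s)))
  where
  eq : ∀ c s r → c + s + r ≡ c + (r + s)
  eq = solve-∀

near-+ : ∀ {a b c d r s} → Near a b r → Near c d s → Near (a + c) (b + d) (r + s)
near-+ {a} {b} {c} {d} {r} {s} (p , q) (p′ , q′) =
  ≤-trans (+-mono-≤ p p′) (≤-reflexive (eq b r d s)) , ≤-trans (+-mono-≤ q q′) (≤-reflexive (eq a r c s))
  where
  eq : ∀ b r d s → b + r + (d + s) ≡ b + d + (r + s)
  eq = solve-∀

near-*ˡ : ∀ {a b r} k → Near a b r → Near (k * a) (k * b) (k * r)
near-*ˡ {a} {b} {r} k (p , q) = ≤-trans (*-monoʳ-≤ k p) (≤-reflexive (*-distribˡ-+ k b r)) ,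
                                ≤-trans (*-monoʳ-≤ k q) (≤-reflexive (*-distribˡ-+ k a r))

near-cancel-* : ∀ {a b r} k .{{_ : NonZero k}} → Near (k * a) (k * b) (k * r) → Near a b r
near-cancel-* {a} {b} {r} k (p , q) =
  *-cancelˡ-≤ k (≤-trans p (≤-reflexive (sym (*-distribˡ-+ k b r)))) ,
  *-cancelˡ-≤ k (≤-trans q (≤-reflexive (sym (*-distribˡ-+ k a r))))

-- Serves to solve the sieve for its main term: the tails `c` and `d` are subtracted at the price of
-- their own error.
near-cancel-+ : ∀ {a b c d r s} → Near (a + c) (b + d) r → Near c d s → Near a b (r + s)
near-cancel-+ {a} {b} {c} {d} {r} {s} (p , q) (p′ , q′) =
  +-cancelʳ-≤ c a _ (≤-trans p (≤-trans (+-monoˡ-≤ r (+-monoʳ-≤ b q′)) (≤-reflexive (eq b c s r)))) ,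
  +-cancelʳ-≤ d b _ (≤-trans q (≤-trans (+-monoˡ-≤ r (+-monoʳ-≤ a p′)) (≤-reflexive (eq a d s r))))
  where
  eq : ∀ b c s r → b + (c + s) + r ≡ b + (r + s) + c
  eq = solve-∀

near-∑ : ∀ {a} {A : Set a} {L : List A} {f g r : A → ℕ} → All (λ x → Near (f x) (g x) (r x)) L → Near (∑ L f) (∑ L g) (∑ L r)
near-∑ []       = near-refl
near-∑ (n ∷ ns) = near-+ n (near-∑ ns)

-- a d − b d = o(q^d)
Sim : ℕ → (ℕ → ℕ) → (ℕ → ℕ) → Set
Sim q a b = ∀ c → ∃ λ D → ∀ d → D ≤ d → Near (c * a d) (c * b d) (q ^ d)

sim-cong : ∀ {q a a′ b b′} → (∀ d → a d ≡ a′ d) → (∀ d → b d ≡ b′ d) → Sim q a b → Sim q a′ b′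
sim-cong {q} e e′ s c with s c
... | D , n = D , λ d le → near-cong (cong (c *_) (e d)) (cong (c *_) (e′ d)) (n d le)

sim-≡ : ∀ {q a b} → (∀ d → a d ≡ b d) → Sim q a b
sim-≡ e c = 0 , λ d _ → near-≤ z≤n (near-≡ (cong (c *_) (e d)))

sim-sym : ∀ {q a b} → Sim q a b → Sim q b a
sim-sym s c with s c
... | D , n = D , λ d le → near-sym (n d le)

private
  double : ∀ c x → 2 * (c * x) ≡ 2 * c * x
  double = solve-∀

  -- The ε/2 argument: the factor in `Sim` is arbitrary, so each of two hypotheses is taken at
  -- `2 * c`.
  halve : ∀ {c x y r} → Near (2 * c * x) (2 * c * y) (r + r) → Near (c * x) (c * y) r
  halve {c} {x} {y} {r} n = near-cancel-* 2 (near-≤ (≤-reflexive (cong (r +_) (sym (+-identityʳ r))))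
    (near-cong (sym (double c x)) (sym (double c y)) n))

sim-trans : ∀ {q a b e} → Sim q a b → Sim q b e → Sim q a e
sim-trans s t c with s (2 * c) | t (2 * c)
... | D , n | D′ , n′ = D + D′ , λ d le → halve {c} (near-trans (n d (≤-trans (m≤m+n D D′) le)) (n′ d (≤-trans (m≤n+m D′ D) le)))

sim-+ : ∀ {q a b a′ b′} → Sim q a b → Sim q a′ b′ → Sim q (λ d → a d + a′ d) (λ d → b d + b′ d)
sim-+ {q} {a} {b} {a′} {b′} s t c with s (2 * c) | t (2 * c)
... | D , n | D′ , n′ = D + D′ , λ d le → halve {c}
  (near-cong (sym (*-distribˡ-+ (2 * c) (a d) (a′ d))) (sym (*-distribˡ-+ (2 * c) (b d) (b′ d)))
  (near-+ (n d (≤-trans (m≤m+n D D′) le)) (n′ d (≤-trans (m≤n+m D′ D) le))))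

sim-*ˡ : ∀ {q a b} k → Sim q a b → Sim q (λ d → k * a d) (λ d → k * b d)
sim-*ˡ {q} {a} {b} k s c with s (c * k)
... | D , n = D , λ d le → near-cong (*-assoc c k (a d)) (*-assoc c k (b d)) (n d le)

sim-cancel-* : ∀ {q a b} k .{{_ : NonZero k}} → Sim q (λ d → k * a d) (λ d → k * b d) → Sim q a b
sim-cancel-* {q} {a} {b} k s c with s c
... | D , n = D , λ d le → near-cancel-* k (near-≤ (m≤n*m (q ^ d) k)
  (near-cong (x∙yz≈y∙xz c k (a d)) (x∙yz≈y∙xz c k (b d)) (n d le)))

sim-∑ : ∀ {q x} {X : Set x} {L : List X} {a b : X → ℕ → ℕ} → All (λ x → Sim q (a x) (b x)) L →
        Sim q (λ d → ∑ L (λ x → a x d)) (λ d → ∑ L (λ x → b x d))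
sim-∑ []       = sim-≡ (λ _ → refl)
sim-∑ (s ∷ ss) = sim-+ s (sim-∑ ss)

private
  ^-*-comm : ∀ a b n → (a * b) ^ n ≡ a ^ n * b ^ n
  ^-*-comm a b zero    = refl
  ^-*-comm a b (suc n) rewrite ^-*-comm a b n = eq a b (a ^ n) (b ^ n)
    where
    eq : ∀ a b x y → a * b * (x * y) ≡ a * x * (b * y)
    eq = solve-∀

  -- Bernoulli's inequality (16/15)^d ≥ 1 + d/15 with denominators cleared.
  bernoulli : ∀ d → 15 ^ d * (15 + d) ≤ 15 * 16 ^ d
  bernoulli zero    = ≤-refl
  bernoulli (suc d) = ≤-trans (≤-reflexive (e₁ (15 ^ d) d)) (≤-trans (m≤m+n _ _)
    (≤-trans (≤-reflexive (e₂ (15 ^ d) d)) (≤-trans (*-monoʳ-≤ 16 (bernoulli d)) (≤-reflexive (e₃ (16 ^ d))))))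
    where
    e₁ : ∀ x d → 15 * x * (15 + suc d) ≡ 240 * x + 15 * (x * d)
    e₁ = solve-∀
    e₂ : ∀ x d → 240 * x + 15 * (x * d) + x * d ≡ 16 * (x * (15 + d))
    e₂ = solve-∀
    e₃ : ∀ y → 16 * (15 * y) ≡ 15 * (16 * y)
    e₃ = solve-∀

-- The hypothesis is an error K (15 q / 16)^d scaled by 16^d. By `bernoulli` (16/15)^d exceeds c K
-- as soon as d ≥ 15 c K, which is the threshold given.
sim-geometric : ∀ {q a b} K → (∀ d → Near (16 ^ d * a d) (16 ^ d * b d) (K * (15 * q) ^ d)) → Sim q a b
sim-geometric {q} {a} {b} K n c = 15 * (c * K) , λ d le → near-cancel-* (16 ^ d) {{m^n≢0 16 d}}
  (near-≤ (bound d le) (near-cong (x∙yz≈y∙xz c (16 ^ d) (a d)) (x∙yz≈y∙xz c (16 ^ d) (b d)) (near-*ˡ c (n d))))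
  where
  eq₁ : ∀ c K x y → c * (K * (x * y)) ≡ x * (c * K) * y
  eq₁ = solve-∀
  eq₂ : ∀ x y → 15 * (x * y) ≡ x * (15 * y)
  eq₂ = solve-∀
  bound : ∀ d → 15 * (c * K) ≤ d → c * (K * (15 * q) ^ d) ≤ 16 ^ d * q ^ d
  bound d le = ≤-trans (≤-reflexive (trans (cong (λ x → c * (K * x)) (^-*-comm 15 q d)) (eq₁ c K (15 ^ d) (q ^ d))))
    (*-monoˡ-≤ (q ^ d) (*-cancelˡ-≤ {m = 15 ^ d * (c * K)} {n = 16 ^ d} 15 (≤-trans (≤-reflexive (eq₂ (15 ^ d) (c * K)))
      (≤-trans (*-monoʳ-≤ (15 ^ d) (≤-trans le (m≤n+m d 15))) (bernoulli d)))))

-- The geometric series controlling the inherited errors.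

lagPow : ℕ → ℕ → ℕ → ℕ
lagPow L n       zero    = L ^ n
lagPow L zero    (suc k) = 0
lagPow L (suc n) (suc k) = lagPow L n k

lagPow-≡ : ∀ L i k → lagPow L (k + i) k ≡ L ^ i
lagPow-≡ L i zero    = refl
lagPow-≡ L i (suc k) = lagPow-≡ L i k

lagPow-≤ : ∀ {L} {c} → c ≤ L → ∀ n k → c ^ k * lagPow L n k ≤ L ^ n
lagPow-≤ c≤L n zero = ≤-reflexive (*-identityˡ _)
lagPow-≤ {c = c} c≤L zero (suc k) = ≤-trans (≤-reflexive (*-zeroʳ (c ^ suc k))) z≤n
lagPow-≤ {L} {c} c≤L (suc n) (suc k) = ≤-trans (≤-reflexive (*-assoc c (c ^ k) _)) (*-mono-≤ c≤L (lagPow-≤ c≤L n k))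

lagPow-mono : ∀ {L} {c} → c ≤ L → ∀ n k i → c ^ (k + i) * lagPow L n (k + i) ≤ c ^ k * lagPow L n k
lagPow-mono {L} {c} c≤L n zero i = ≤-trans (lagPow-≤ c≤L n i) (≤-reflexive (sym (*-identityˡ _)))
lagPow-mono {L} {c} c≤L zero (suc k) i = ≤-trans (≤-reflexive (*-zeroʳ (c ^ suc (k + i)))) z≤n
lagPow-mono {L} {c} c≤L (suc n) (suc k) i = ≤-trans (≤-reflexive (*-assoc c (c ^ (k + i)) _))
  (≤-trans (*-monoʳ-≤ c (lagPow-mono c≤L n k i)) (≤-reflexive (sym (*-assoc c (c ^ k) _))))

module Geometric (L Q P : ℕ) (L² : L * L ≡ Q + P) where

  G : ℕ → ℕ → ℕ
  G D n = ∑ (upTo D) (λ j → Q ^ j * lagPow L n (j + j))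

  private
    vanish : ∀ n D → n ≤ 1 → ∑ (upTo D) (λ j → Q ^ suc j * lagPow L n (suc j + suc j)) ≡ 0
    vanish n D n≤1 = ∑-zero (upTo D) (λ j → trans (cong (Q ^ suc j *_) (van n j n≤1)) (*-zeroʳ (Q ^ suc j)))
      where
      van : ∀ n j → n ≤ 1 → lagPow L n (suc j + suc j) ≡ 0
      van zero          j _             = refl
      van (suc zero)    j _ rewrite +-suc j j = refl
      van (suc (suc n)) j (s≤s ())

  shift : ∀ n D → ∑ (upTo D) (λ j → Q ^ suc j * lagPow L (2 + n) (suc j + suc j)) ≡ Q * G D n
  shift n D = trans (∑-cong (upTo D) (λ j → trans (cong (λ k → Q ^ suc j * lagPow L (suc n) k) (+-suc j j)) (*-assoc Q (Q ^ j) _))) (∑-*ˡ (upTo D) Q _)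

  -- The full series Σ (Q / L²)^j equals L² / (L² - Q) = L² / P; `G` is its truncation, stopped
  -- where the exponent of `L` would become negative, multiplied by L^n.
  geometric : ∀ D n → P * G D n ≤ (L * L) * L ^ n
  geometric zero    n = ≤-trans (≤-reflexive (*-zeroʳ P)) z≤n
  geometric (suc D) n rewrite ∑-upTo-suc D (λ j → Q ^ j * lagPow L n (j + j)) = step n
    where
    P≤L² : P ≤ L * L
    P≤L² = subst (P ≤_) (sym L²) (m≤n+m P Q)
    small : ∀ n → n ≤ 1 → P * (1 * L ^ n + ∑ (upTo D) (λ j → Q ^ suc j * lagPow L n (suc j + suc j))) ≤ (L * L) * L ^ n
    small n n≤1 rewrite vanish n D n≤1 | +-identityʳ (1 * L ^ n) | *-identityˡ (L ^ n) = *-monoˡ-≤ (L ^ n) P≤L²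
    eq₁ : ∀ P x Q G → P * (1 * x + Q * G) ≡ P * x + Q * (P * G)
    eq₁ = solve-∀
    eq₂ : ∀ P Q L y → P * (L * (L * y)) + Q * (L * L * y) ≡ (Q + P) * (L * (L * y))
    eq₂ = solve-∀
    step : ∀ n → P * (1 * L ^ n + ∑ (upTo D) (λ j → Q ^ suc j * lagPow L n (suc j + suc j))) ≤ (L * L) * L ^ n
    step zero          = small 0 z≤n
    step (suc zero)    = small 1 ≤-refl
    step (suc (suc n)) = ≤-trans (≤-reflexive (trans (cong (λ x → P * (1 * L ^ (2 + n) + x)) (shift n D)) (eq₁ P (L ^ (2 + n)) Q (G D n))))
      (≤-trans (+-monoʳ-≤ (P * L ^ (2 + n)) (*-monoʳ-≤ Q (geometric D n)))
      (≤-reflexive (trans (eq₂ P Q L (L ^ n)) (cong (_* L ^ (2 + n)) (sym L²)))))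

  -- From index 2 on the series is bounded by Q² / (P L²) times L^n, and the hypothesis says that
  -- this factor is at most 4/5.
  contraction : .{{_ : NonZero P}} → 5 * (Q * Q) ≤ 4 * (P * (L * L)) → ∀ D n →
                5 * ∑ (upTo D) (λ j → Q ^ (2 + j) * lagPow L n ((2 + j) + (2 + j))) ≤ 4 * L ^ n
  contraction le D n = *-cancelˡ-≤ P (go n)
    where
    T : ℕ → ℕ
    T n = ∑ (upTo D) (λ j → Q ^ (2 + j) * lagPow L n ((2 + j) + (2 + j)))
    small : ∀ n → n ≤ 3 → P * (5 * T n) ≤ P * (4 * L ^ n)
    small n n≤3 = ≤-trans (≤-reflexive (trans (cong (λ x → P * (5 * x))
        (∑-zero (upTo D) (λ j → trans (cong (Q ^ (2 + j) *_) (van n j n≤3)) (*-zeroʳ (Q ^ (2 + j)))))) (*-zeroʳ P))) z≤n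
      where
      van : ∀ n j → n ≤ 3 → lagPow L n ((2 + j) + (2 + j)) ≡ 0
      van n j n≤3 rewrite +-suc j (suc j) | +-suc j j = van′ n n≤3
        where
        van′ : ∀ n → n ≤ 3 → lagPow L n (4 + (j + j)) ≡ 0
        van′ zero _ = refl
        van′ (suc zero) _ = refl
        van′ (suc (suc zero)) _ = refl
        van′ (suc (suc (suc zero))) _ = refl
        van′ (suc (suc (suc (suc n)))) (s≤s (s≤s (s≤s ())))
    eq₁ : ∀ P Q G → P * (5 * (Q * (Q * G))) ≡ 5 * (Q * Q) * (P * G)
    eq₁ = solve-∀
    eq₂ : ∀ P L y → 4 * (P * (L * L)) * (L * L * y) ≡ P * (4 * (L * (L * (L * (L * y)))))
    eq₂ = solve-∀
    T≡ : ∀ n → T (4 + n) ≡ Q * (Q * G D n)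
    T≡ n = trans (∑-cong (upTo D) (λ j → trans (cong (λ k → Q ^ (2 + j) * lagPow L (3 + n) (suc k)) (+-suc j (suc j))) (*-assoc Q (Q ^ suc j) _)))
             (trans (∑-*ˡ (upTo D) Q _) (cong (Q *_) (shift n D)))
    go : ∀ n → P * (5 * T n) ≤ P * (4 * L ^ n)
    go zero = small 0 z≤n
    go (suc zero) = small 1 (s≤s z≤n)
    go (suc (suc zero)) = small 2 (s≤s (s≤s z≤n))
    go (suc (suc (suc zero))) = small 3 ≤-refl
    go (suc (suc (suc (suc n)))) = ≤-trans (≤-reflexive (trans (cong (λ x → P * (5 * x)) (T≡ n)) (eq₁ P Q (G D n))))
      (≤-trans (*-mono-≤ le (geometric D n)) (≤-reflexive (eq₂ P L (L ^ n))))

-- The rate 15/16 leaves room for the contraction even when q = 2.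
module Rate (q r : ℕ) (q≡ : q ≡ 2 + r) where
  L Q P : ℕ
  L = 15 * q
  -- An error inherited from degree n - 2 j is multiplied by the q^j choices of t and by 16^(2 j)
  -- from the scaling: one factor `Q` for each unit of j.
  Q = (16 * 16) * q
  -- L² - Q = q (225 q - 256), where q = 2 + r and 2 · 225 - 256 = 194.
  P = q * (225 * r + 194)

  rate : L * L ≡ Q + P
  rate = trans (e₁ 15 q) (trans (cong (q *_) (trans (cong (225 *_) q≡) (e₂ 225 r))) (trans (cong (q *_) (+-assoc 256 194 (225 * r))) (e₃ q 256 194 (225 * r))))
    where
    e₁ : ∀ c q → (c * q) * (c * q) ≡ q * (c * c * q)
    e₁ = solve-∀
    e₂ : ∀ c r → c * (2 + r) ≡ c + c + c * r
    e₂ = solve-∀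
    e₃ : ∀ q a b c → q * (a + (b + c)) ≡ a * q + q * (c + b)
    e₃ = solve-∀

  rate-≤ : 5 * (Q * Q) ≤ 4 * (P * (L * L))
  rate-≤ = ≤-trans (≤-reflexive (e₁ 5 256 q)) (≤-trans (*-monoˡ-≤ (q * q) bound) (≤-reflexive (e₂ 4 15 q (225 * r + 194))))
    where
    e₁ : ∀ c a q → c * (a * q * (a * q)) ≡ c * a * a * (q * q)
    e₁ = solve-∀
    e₂ : ∀ c a q t → c * (a * a) * (q * t) * (q * q) ≡ c * (q * t * ((a * q) * (a * q)))
    e₂ = solve-∀
    -- The claim divided by q²: 5 · 256² = 327680 on the left and 4 · 15² · P on the right. The
    -- right side is smallest at q = 2, where it is 349200.
    bound : 327680 ≤ 900 * (q * (225 * r + 194))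
    bound = ≤-trans (≤ᵇ⇒≤ 327680 (900 * (2 * 194)) tt) (*-monoʳ-≤ 900 (*-mono-≤ (subst (2 ≤_) (sym q≡) (m≤m+n 2 r)) (m≤n+m 194 (225 * r))))

  open Geometric L Q P rate public

-- Polynomials with prescribed values, and the sum over square parts.

module Interpolation {c ℓ : Level} (F : FiniteField c ℓ) where

  open Polynomials F
  open Divisibility F
  open SquareFreePolynomials F
  private
    module NR = RingProps C.ring
    module NP = RingProps PR.ring

  Data : Set c
  Data = List (Carrier × Carrier)

  points : Data → List Carrier
  points = map proj₁

  Interpolates : Poly → Data → Set (c ⊔ ℓ)
  Interpolates f I = All (λ p → evalP f (proj₁ p) ≈ proj₂ p) I

  interpolates? : ∀ f I → Dec (Interpolates f I)
  interpolates? f = All.all? (λ p → evalP f (proj₁ p) ≈? proj₂ p)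

  χ : Poly → Data → ℕ
  χ f I = 𝟙 (interpolates? f I)

  χ-cong : ∀ {f g} I → f ≈P g → χ f I ≡ χ g I
  χ-cong {f} {g} I e = 𝟙-cong (interpolates? f I) (interpolates? g I)
    (All.map (λ {p} → C.trans (eval-cong (proj₁ p) (symP e)))) (All.map (λ {p} → C.trans (eval-cong (proj₁ p) e)))

  lin : Carrier → Poly
  lin x = ⊖ x ∷ oneP

  mon-lin : ∀ x → Mon (lin x) 1
  mon-lin x = mon-∷ (⊖ x) mon-one

  eval-lin : ∀ x y → evalP (lin x) y ≈ ((⊖ x) ⊕ y)
  eval-lin x y = C.+-congˡ (C.trans (C.*-congˡ (eval-const 1# y)) (C.*-identityʳ y))

  lin-root : ∀ {x y} → x ≈ y → evalP (lin x) y ≈ 0#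
  lin-root {x} {y} e = C.trans (eval-lin x y) (C.trans (C.+-congˡ (C.sym e)) (C.-‿inverseˡ x))

  lin-nonroot : ∀ {x y} → ¬ (x ≈ y) → ¬ (evalP (lin x) y ≈ 0#)
  lin-nonroot {x} {y} x≉y e = x≉y (C.sym (NR.x∙y⁻¹≈ε⇒x≈y y x (C.trans (C.+-comm y (⊖ x)) (C.trans (C.sym (eval-lin x y)) e))))

  mon-+const : ∀ {f n} a → Mon f (suc n) → Mon (f +P [ a ]) (suc n)
  mon-+const {f} {n} a (l , d) = C.trans (step n) l , λ { (suc i) le → C.trans (step i) (d (suc i) le) }
    where
    step : ∀ i → coef (f +P [ a ]) (suc i) ≈ coef f (suc i)
    step i = C.trans (coef-+ f [ a ] (suc i)) (C.+-identityʳ _)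

  factor-lin : ∀ f x → ∃ λ k → f ≈P ((lin x *P k) +P [ evalP f x ])
  factor-lin f x with divMod (mon-lin x) f
  ... | k , r , e , d = k , transP e (+P-cong (reflP {lin x *P k}) (transP r≈ (∷≈∷ (C.sym value) []≈[])))
    where
    r≈ : r ≈P [ coef r 0 ]
    r≈ = from≗ r [ coef r 0 ] λ { zero → C.refl ; (suc i) → d (suc i) (s≤s z≤n) }
    value : evalP f x ≈ coef r 0
    value = C.trans (eval-cong x e) (C.trans (eval-+ (lin x *P k) r x) (C.trans (C.+-cong
      (C.trans (eval-* (lin x) k x) (C.trans (C.*-congʳ (lin-root {x} C.refl)) (C.zeroˡ _)))
      (C.trans (eval-cong x r≈) (eval-const _ x))) (C.+-identityˡ _)))

  root⇒∣ : ∀ f x → evalP f x ≈ 0# → ∃ λ k → f ≈P (lin x *P k)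
  root⇒∣ f x e = k , transP (proj₂ (factor-lin f x)) (transP (+P-cong (reflP {lin x *P k}) (∷≈[] e []≈[])) (+P-identityʳ _))
    where k = proj₁ (factor-lin f x)

  -- Newton's form: in f = (X - x) k + a the value `a` at x is a coordinate independent of the monic
  -- quotient k.
  enum-M-split : ∀ x n → Enum _≈P_ (λ f → Mon f (suc n)) (map (λ (a , f) → (lin x *P f) +P [ a ]) (pairs elements (λ _ → M n)))
  enum-M-split x n = enum-map {_≈_ = _≈P_} T transP
    (λ {(a , f)} (_ , l) → mon-+const a (mon-* (mon-lin x) l))
    (λ {p} {p′} _ _ e → inj p p′ e)
    (λ {p} {p′} _ (e , e′) → +P-cong (*P-congˡ (lin x) e′) (∷≈∷ e []≈[]))
    surj
    (enum-pairs {_~_ = _≈_} enum-elements (λ _ _ → enum-M n) (λ _ _ l → l))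
    where
    T : Carrier × Poly → Poly
    T (a , f) = (lin x *P f) +P [ a ]
    value : ∀ a f → evalP (T (a , f)) x ≈ a
    value a f = C.trans (eval-+ (lin x *P f) [ a ] x) (C.trans (C.+-cong (C.trans (eval-* (lin x) f x)
      (C.trans (C.*-congʳ (lin-root {x} C.refl)) (C.zeroˡ _))) (eval-const a x)) (C.+-identityˡ a))
    inj : ∀ p p′ → T p ≈P T p′ → Both _≈_ _≈P_ p p′
    inj (a , f) (a′ , f′) e = a≈a′ , cancelˡ {lin x} (mon⇒≉0 (mon-lin x))
        (NP.+-cancelʳ [ a ] _ _ (transP e (+P-cong (reflP {lin x *P f′}) (∷≈∷ (C.sym a≈a′) []≈[]))))
      where
      a≈a′ : a ≈ a′
      a≈a′ = C.trans (C.sym (value a f)) (C.trans (eval-cong x e) (value a′ f′))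
    surj : ∀ f → Mon f (suc n) → ∃ λ p → (⊤ × Mon (proj₂ p) n) × f ≈P T p
    surj f m with divMod (mon-lin x) f
    ... | k , r , e , d = (a , k) , (tt , mk) , f≈
      where
      a = coef r 0
      r≈a : r ≈P [ a ]
      r≈a = from≗ r [ a ] λ { zero → C.refl ; (suc i) → d (suc i) (s≤s z≤n) }
      f≈ : f ≈P T (a , k)
      f≈ = transP e (+P-cong (reflP {lin x *P k}) r≈a)
      lk≈ : (f +P [ ⊖ 1# ⊗ a ]) ≈P (lin x *P k)
      lk≈ = transP (+P-cong f≈ reflP) (transP (+P-assoc (lin x *P k) [ a ] (negP [ a ]))
        (transP (+P-cong (reflP {lin x *P k}) (PR.-‿inverseʳ [ a ])) (+P-identityʳ _)))
      mk : Mon k n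
      mk with mon-quotient {lin x} (mon-lin x) (lead-cong lk≈ (mon-+const _ m)) reflP
      ... | _ , refl , m′ = m′

  Distinct : List Carrier → Set (c ⊔ ℓ)
  Distinct = AllPairs (λ x y → ¬ (x ≈ y))

  distinct-insert : ∀ {x} xs {ys} → Distinct (xs ++ x ∷ ys) → All (λ z → ¬ (x ≈ z)) (xs ++ ys)
  distinct-insert []       (d ∷ ds) = d
  distinct-insert (z ∷ xs) (d ∷ ds) = (λ e → All.head (Allₚ.++⁻ʳ xs d) (C.sym e)) ∷ distinct-insert xs ds

  -- With f = (X - x) k + y, a condition f(z) = v becomes k(z) = (v - y) / (z - x). Each point thus
  -- costs exactly one degree, so the count is exact when the degree is at least the number of
  -- points.
  interpolation-count : ∀ l I → length I ≡ l → Distinct (points I) → ∀ n → ∑ (M (l + n)) (λ f → χ f I) ≡ card ^ n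
  interpolation-count zero    []            _    _          n = trans (∑-length (M n)) (length-M n)
  interpolation-count (suc l) ((x , y) ∷ I) eq (x≉ ∷ dis) n = begin
    ∑ (M (suc m)) (λ f → χ f ((x , y) ∷ I))
      ≡⟨ enum-∑ ≈P-equiv (enum-M (suc m)) (enum-M-split x m) (χ-cong ((x , y) ∷ I)) ⟩
    ∑ (map T (pairs elements (λ _ → M m))) (λ f → χ f ((x , y) ∷ I))
      ≡⟨ trans (∑-map T (pairs elements (λ _ → M m)) _) (∑-pairs elements (λ _ → M m) _) ⟩
    ∑ elements (λ a → ∑ (M m) (λ f → χ (T (a , f)) ((x , y) ∷ I)))
      ≡⟨ ∑-cong elements (λ a → trans (∑-cong (M m) (factor a)) (∑-*ˡ (M m) (𝟙 (y ≈? a)) _)) ⟩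
    ∑ elements (λ a → 𝟙 (y ≈? a) * ∑ (M m) (λ f → χ f I′))
      ≡⟨ ∑-*ʳ elements _ _ ⟩
    ∑ elements (λ a → 𝟙 (y ≈? a)) * ∑ (M m) (λ f → χ f I′)
      ≡⟨ cong₂ _*_ (∑-at C.isEquivalence enum-elements {y} tt (λ _ → tt) (y ≈?_)) count ⟩
    1 * card ^ n
      ≡⟨ *-identityˡ _ ⟩
    card ^ n ∎
    where
    open ≡-Reasoning
    m = l + n
    T : Carrier × Poly → Poly
    T (a , f) = (lin x *P f) +P [ a ]
    transform : Carrier × Carrier → Carrier × Carrier
    transform (z , v) = z , ((v ⊕ (⊖ y)) ⊗ inv (evalP (lin x) z))
    I′ = map transform I
    points-I′ : ∀ I → points (map transform I) ≡ points I
    points-I′ []      = refl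
    points-I′ (p ∷ I) = cong (proj₁ p ∷_) (points-I′ I)
    count : ∑ (M m) (λ f → χ f I′) ≡ card ^ n
    count = interpolation-count l I′ (trans (length-map transform I) (suc-injective eq)) (subst Distinct (sym (points-I′ I)) dis) n
    eval-T : ∀ a f z → evalP (T (a , f)) z ≈ ((evalP f z ⊗ evalP (lin x) z) ⊕ a)
    eval-T a f z = C.trans (eval-+ (lin x *P f) [ a ] z) (C.+-cong (C.trans (eval-* (lin x) f z) (C.*-comm _ _)) (eval-const a z))
    at-x : ∀ a f → evalP (T (a , f)) x ≈ a
    at-x a f = C.trans (eval-T a f x) (C.trans (C.+-congʳ (C.trans (C.*-congˡ (lin-root {x} C.refl)) (C.zeroʳ _))) (C.+-identityˡ a))
    to : ∀ {a f} → y ≈ a → ∀ {J} → All (λ z → ¬ (x ≈ z)) (points J) → Interpolates (T (a , f)) J → Interpolates f (map transform J)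
    to e {[]} [] [] = []
    to {a} {f} e {(z , v) ∷ J} (x≉z ∷ n) (i ∷ is) = *≈⇒≈*inv (lin-nonroot x≉z)
      (C.trans (C.trans (C.sym (C.+-identityʳ _)) (C.trans (C.+-congˡ (C.sym (C.-‿inverseʳ a))) (C.sym (C.+-assoc _ _ _))))
      (C.+-cong (C.trans (C.sym (eval-T a f z)) i) (C.-‿cong (C.sym e)))) ∷ to {a} {f} e n is
    from : ∀ {a f} → y ≈ a → ∀ {J} → All (λ z → ¬ (x ≈ z)) (points J) → Interpolates f (map transform J) → Interpolates (T (a , f)) J
    from e {[]} [] [] = []
    from {a} {f} e {(z , v) ∷ J} (x≉z ∷ n) (i ∷ is) = C.trans (eval-T a f z) (C.trans (C.+-cong (≈*inv⇒*≈ (lin-nonroot x≉z) i) (C.sym e))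
      (C.trans (C.+-assoc v (⊖ y) y) (C.trans (C.+-congˡ (C.-‿inverseˡ y)) (C.+-identityʳ v)))) ∷ from {a} {f} e n is
    factor : ∀ a f → χ (T (a , f)) ((x , y) ∷ I) ≡ 𝟙 (y ≈? a) * χ f I′
    factor a f = sym (trans (𝟙-× (y ≈? a) (interpolates? f I′)) (𝟙-cong ((y ≈? a) ×-dec interpolates? f I′) (interpolates? (T (a , f)) ((x , y) ∷ I))
      (λ (e , is) → C.trans (at-x a f) (C.sym e) ∷ from {a} {f} e x≉ is)
      (λ { (i ∷ is) → C.trans (C.sym i) (at-x a f) , to {a} {f} (C.trans (C.sym i) (at-x a f)) x≉ is })))

  infixl 7 _⊘_
  -- The data left for `f` when `f *P w` is to interpolate `I`; meaningful when `w` has no zero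
  -- among the points.
  _⊘_ : Data → Poly → Data
  I ⊘ w = map (λ p → proj₁ p , (proj₂ p ⊗ inv (evalP w (proj₁ p)))) I

  points-⊘ : ∀ I w → points (I ⊘ w) ≡ points I
  points-⊘ []      w = refl
  points-⊘ (p ∷ I) w = cong (proj₁ p ∷_) (points-⊘ I w)

  Nonvanishing : Poly → List Carrier → Set (c ⊔ ℓ)
  Nonvanishing w = All (λ x → ¬ (evalP w x ≈ 0#))

  nonvanishing? : ∀ w xs → Dec (Nonvanishing w xs)
  nonvanishing? w = All.all? (λ x → ¬? (evalP w x ≈? 0#))

  Units : Data → Set (c ⊔ ℓ)
  Units = All (λ p → ¬ (proj₂ p ≈ 0#))

  χ-⊘ : ∀ f w I → Nonvanishing w (points I) → χ (f *P w) I ≡ χ f (I ⊘ w)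
  χ-⊘ f w I nv = 𝟙-cong (interpolates? (f *P w) I) (interpolates? f (I ⊘ w)) (to nv) (from nv)
    where
    to : ∀ {I} → Nonvanishing w (points I) → Interpolates (f *P w) I → Interpolates f (I ⊘ w)
    to {[]}    []       []       = []
    to {p ∷ I} (n ∷ ns) (i ∷ is) = *≈⇒≈*inv n (C.trans (C.sym (eval-* f w (proj₁ p))) i) ∷ to ns is
    from : ∀ {I} → Nonvanishing w (points I) → Interpolates f (I ⊘ w) → Interpolates (f *P w) I
    from {[]}    []       []       = []
    from {p ∷ I} (n ∷ ns) (i ∷ is) = C.trans (eval-* f w (proj₁ p)) (≈*inv⇒*≈ n i) ∷ from ns is

  units-⊘ : ∀ {I w} → Nonvanishing w (points I) → Units I → Units (I ⊘ w)
  units-⊘ {[]}        []       []       = []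
  units-⊘ {p ∷ I} {w} (n ∷ ns) (u ∷ us) = x≉0⇒y≉0⇒xy≉0 u (inv≉0 n) ∷ units-⊘ {I} {w} ns us

  -- A factor `w` with a zero at one of the points can never produce a unit there, so among unit
  -- data only nonvanishing `w` contribute.
  χ-units : ∀ f w I → Units I → χ (f *P w) I ≡ 𝟙 (nonvanishing? w (points I)) * χ f (I ⊘ w)
  χ-units f w I us with nonvanishing? w (points I)
  ... | yes nv = trans (χ-⊘ f w I nv) (sym (*-identityˡ _))
  ... | no ¬nv = 𝟙-no (interpolates? (f *P w) I) (λ is → ¬nv (go us is))
    where
    go : ∀ {I} → Units I → Interpolates (f *P w) I → Nonvanishing w (points I)
    go {[]}    []       []       = []
    go {p ∷ I} (u ∷ us) (i ∷ is) = (λ e → u (C.trans (C.sym i) (C.trans (eval-* f w (proj₁ p)) (C.trans (C.*-congˡ e) (C.zeroʳ _))))) ∷ go us is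

  SquareParts : ℕ → ℕ → ℕ × Poly × Poly → Set (c ⊔ ℓ)
  SquareParts D n (j , t , s) = suc j ≤ D × Mon t j × ∃ λ i → j + j + i ≡ n × SFMon i s

  squareParts : ℕ → ℕ → List (ℕ × Poly × Poly)
  squareParts D n = pairs (upTo D) (λ j → pairs (M j) (λ t → lag SF n (j + j)))

  enum-squareParts : ∀ D n → Enum (Both _≡_ (Both _≈P_ _≈P_)) (SquareParts D n) (squareParts D n)
  enum-squareParts D n = enum-pairs {_~_ = _≡_} {_≈_ = Both _≈P_ _≈P_} {P = λ j → suc j ≤ D} {Q = Q} {K = λ j → pairs (M j) (λ t → lag SF n (j + j))}
    (enum-upTo D) inner (λ { _ refl q → q })
    where
    Q : ℕ → Poly × Poly → Set (c ⊔ ℓ)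
    Q j (t , s) = Mon t j × ∃ λ i → j + j + i ≡ n × SFMon i s
    inner : ∀ j → suc j ≤ D → Enum (Both _≈P_ _≈P_) (Q j) (pairs (M j) (λ t → lag SF n (j + j)))
    inner j _ = enum-pairs {_~_ = _≈P_} {_≈_ = _≈P_} {P = λ t → Mon t j} {Q = λ _ s → ∃ λ i → j + j + i ≡ n × SFMon i s}
      (enum-M j) (λ _ _ → enum-lag enum-SF n (j + j)) (λ _ _ q → q)

  enum-square-parts : ∀ D n → suc n ≤ D → Enum _≈P_ (λ f → Mon f n) (map (λ (j , t , s) → s *P (t *P t)) (squareParts D n))
  enum-square-parts D n n<D = enum-map {_~_ = Both _≡_ (Both _≈P_ _≈P_)} {_≈_ = _≈P_} {Q = SquareParts D n} {Q′ = λ f → Mon f n} T transP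
    (λ {x} → mem x) (λ {x} {y} → inj x y) (λ {x} {y} _ → resp x y) surj (enum-squareParts D n)
    where
    T : ℕ × Poly × Poly → Poly
    T (j , t , s) = s *P (t *P t)
    resp : ∀ x y → Both _≡_ (Both _≈P_ _≈P_) x y → T x ≈P T y
    resp (j , t , s) (j′ , t′ , s′) (_ , e , e′) = *P-cong e′ (*P-cong e e)
    mem : ∀ x → SquareParts D n x → Mon (T x) n
    mem (j , t , s) (_ , mt , i , refl , ms , _) = subst (Mon (s *P (t *P t))) (+-comm i (j + j)) (mon-* ms (mon-* mt mt))
    inj : ∀ x y → SquareParts D n x → SquareParts D n y → T x ≈P T y → Both _≡_ (Both _≈P_ _≈P_) x y
    inj (j , t , s) (j′ , t′ , s′) (_ , mt , _ , _ , _ , sf) (_ , mt′ , _ , _ , _ , sf′) e =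
      lead-unique {t′} 1≉0 1≉0 (lead-cong t≈t′ mt) mt′ , t≈t′ , proj₁ parts
      where
      parts : s ≈P s′ × t ≈P t′
      parts = square-part-unique {s} {s′} {t} {t′} sf sf′ mt mt′ e
      t≈t′ = proj₂ parts
    surj : ∀ f → Mon f n → ∃ λ x → SquareParts D n x × f ≈P T x
    surj f m with decompose n ≤-refl m
    ... | s , t , i , j , sf , mt , eq , e = (j , t , s) ,
          (≤-trans (s≤s (≤-trans (≤-trans (m≤m+n j j) (m≤m+n (j + j) i)) (≤-reflexive eq))) n<D , mt , i , eq , sf) , e

  -- Existence and uniqueness of f = s t², read as an identity of sums. Indices j with 2 j > n
  -- contribute empty lists, so any `D` above `n` will do; the lagged version uses this to keep one
  -- range for all lags.
  ∑-square-parts : ∀ D n → suc n ≤ D → ∀ {φ} → (∀ {f g} → f ≈P g → φ f ≡ φ g) →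
    ∑ (M n) φ ≡ ∑ (upTo D) (λ j → ∑ (M j) (λ t → ∑ (lag SF n (j + j)) (λ s → φ (s *P (t *P t)))))
  ∑-square-parts D n n<D {φ} resp = trans (enum-∑ ≈P-equiv (enum-M n) (enum-square-parts D n n<D) resp)
    (trans (∑-map _ (pairs (upTo D) _) φ) (trans (∑-pairs (upTo D) _ _) (∑-cong (upTo D) (λ j → ∑-pairs (M j) _ _))))

  lag-cases : ∀ n k → (∃ λ i → n ≡ k + i) ⊎ suc n ≤ k
  lag-cases n k with k ≤? n
  ... | yes k≤n = inj₁ (n ∸ k , sym (m+[n∸m]≡n k≤n))
  ... | no k≰n  = inj₂ (≰⇒> k≰n)

  lag-at : ∀ {a} {A : Set a} (L : ℕ → List A) k i → lag L (k + i) k ≡ L i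
  lag-at L zero    i = refl
  lag-at L (suc k) i = lag-at L k i

  ∑-square-parts-lag : ∀ D n k → suc n ≤ D → ∀ {φ} → (∀ {f g} → f ≈P g → φ f ≡ φ g) →
    ∑ (lag M n k) φ ≡ ∑ (upTo D) (λ j → ∑ (M j) (λ t → ∑ (lag SF n (k + (j + j))) (λ s → φ (s *P (t *P t)))))
  ∑-square-parts-lag D n k n<D {φ} resp with lag-cases n k
  ... | inj₁ (i , refl) = trans (cong (λ L → ∑ L φ) (lag-at M k i))
        (trans (∑-square-parts D i (≤-trans (s≤s (m≤n+m i k)) n<D) resp)
        (∑-cong (upTo D) (λ j → ∑-cong (M j) (λ t → cong (λ L → ∑ L (λ s → φ (s *P (t *P t)))) (sym (lag-+ SF k i (j + j)))))))
  ... | inj₂ n<k = trans (cong (λ L → ∑ L φ) (lag-> M n<k))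
        (sym (∑-zero (upTo D) (λ j → ∑-zero (M j) (λ t → cong (λ L → ∑ L (λ s → φ (s *P (t *P t)))) (lag-> SF (≤-trans n<k (m≤m+n k (j + j))))))))

-- Equidistribution of the unit values of squarefree polynomials.

module Equidistribution {c ℓ : Level} (F : FiniteField c ℓ) where

  open Polynomials F
  open Divisibility F
  open SquareFreePolynomials F
  open Interpolation F
  private
    module NR = RingProps C.ring

  card-split : ∃ λ r → card ≡ 2 + r
  card-split = go elements (elements-complete 0#) (elements-complete 1#)
    where
    go : ∀ L → Any (0# ≈_) L → Any (1# ≈_) L → ∃ λ r → length L ≡ 2 + r
    go (x ∷ [])    (here e) (here e′) = contradiction (C.trans e (C.sym e′)) 0≉1
    go (x ∷ y ∷ L) _        _         = length L , refl

  open Rate card (proj₁ card-split) (proj₂ card-split)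

  2≤card : 2 ≤ card
  2≤card = subst (2 ≤_) (sym (proj₂ card-split)) (m≤m+n 2 _)

  instance
    card-nonZero : NonZero card
    card-nonZero = ℕ.>-nonZero (≤-trans (s≤s z≤n) 2≤card)

  -- Fixing also the order of the points leaves the values as the only freedom of the data.
  Covers : Data → Set c
  Covers I = points I ≡ elements

  covers-⊘ : ∀ {I} w → Covers I → Covers (I ⊘ w)
  covers-⊘ {I} w e = trans (points-⊘ I w) e

  covers-length : ∀ {I} → Covers I → length I ≡ card
  covers-length {I} e = trans (sym (length-map proj₁ I)) (cong length e)

  χ≤1 : ∀ f I → χ f I ≤ 1
  χ≤1 f I with interpolates? f I
  ... | yes _ = ≤-refl
  ... | no _  = z≤n

  χ-covers : ∀ f w {I} → Covers I → Units I → χ (f *P w) I ≡ 𝟙 (nonvanishing? w elements) * χ f (I ⊘ w)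
  χ-covers f w {I} e us = subst (λ xs → χ (f *P w) I ≡ 𝟙 (nonvanishing? w xs) * χ f (I ⊘ w)) e (χ-units f w I us)

  nonvanishing-covers : ∀ {w I} → Covers I → Nonvanishing w elements → Nonvanishing w (points I)
  nonvanishing-covers {w} e nv = subst (Nonvanishing w) (sym e) nv

  -- A monic linear polynomial has a root, so degree 1 drops out of the sieve below, which is what makes it contract for q = 2.
  linear-vanishes : ∀ {t} → Mon t 1 → ¬ Nonvanishing (t *P t) elements
  linear-vanishes {t} (l , d) nv = go nv (elements-complete x)
    where
    x = ⊖ coef t 0
    t≈ : t ≈P lin x
    t≈ = from≗ t (lin x) λ { zero → C.sym (NR.-‿involutive _) ; (suc zero) → l ; (suc (suc i)) → d (suc (suc i)) (s≤s (s≤s z≤n)) }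
    go : ∀ {L} → Nonvanishing (t *P t) L → ¬ Any (x ≈_) L
    go (n ∷ ns) (here {y} e) = n (C.trans (eval-* t t y) (C.trans (C.*-congʳ (C.trans (eval-cong y t≈) (lin-root e))) (C.zeroˡ _)))
    go (n ∷ ns) (there i)    = go ns i

  -- In degree n - k: `U` counts all monic polynomials with values `I`, `S` the squarefree ones, and
  -- `T` those whose t in s t² has degree at least 2, sorted by t.
  U S T : ℕ → ℕ → Data → ℕ
  U n k I = ∑ (lag M n k) (λ f → χ f I)
  S n k I = ∑ (lag SF n k) (λ f → χ f I)
  T n k I = ∑ (upTo n) (λ j → ∑ (M (2 + j)) (λ t →
              𝟙 (nonvanishing? (t *P t) elements) * S n (k + ((2 + j) + (2 + j))) (I ⊘ (t *P t))))

  sieve : ∀ {I} → Covers I → Units I → ∀ n k → U n k I ≡ S n k I + T n k I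
  sieve {I} cov us n k = begin
    -- The range `2 + n` reaches beyond every possible degree of t and exposes the terms of degree 0
    -- and 1, of which the first is `S` and the second vanishes.
    U n k I                                          ≡⟨ ∑-square-parts-lag (2 + n) n k (n≤1+n (suc n)) (χ-cong I) ⟩
    ∑ (upTo (2 + n)) X                               ≡⟨ ∑-upTo-suc (suc n) X ⟩
    X 0 + ∑ (upTo (suc n)) (X ∘ suc)                 ≡⟨ cong (X 0 +_) (∑-upTo-suc n (X ∘ suc)) ⟩
    X 0 + (X 1 + ∑ (upTo n) (λ j → X (2 + j)))       ≡⟨ cong₂ _+_ X₀ (cong₂ _+_ X₁ (∑-cong (upTo n) (λ j → ∑-cong (M (2 + j)) (factor (2 + j))))) ⟩
    S n k I + T n k I                                ∎
    where
    open ≡-Reasoning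
    X : ℕ → ℕ
    X j = ∑ (M j) (λ t → ∑ (lag SF n (k + (j + j))) (λ s → χ (s *P (t *P t)) I))
    factor : ∀ j t → ∑ (lag SF n (k + (j + j))) (λ s → χ (s *P (t *P t)) I)
             ≡ 𝟙 (nonvanishing? (t *P t) elements) * S n (k + (j + j)) (I ⊘ (t *P t))
    factor j t = trans (∑-cong (lag SF n (k + (j + j))) (λ s → χ-covers s (t *P t) cov us)) (∑-*ˡ (lag SF n (k + (j + j))) (𝟙 (nonvanishing? (t *P t) elements)) (λ s → χ s (I ⊘ (t *P t))))
    X₀ : X 0 ≡ S n k I
    X₀ = trans (+-identityʳ _) (trans (∑-cong (lag SF n (k + 0)) (λ s → χ-cong I (transP (*P-congˡ s (*P-identityˡ oneP)) (PR.*-identityʳ s))))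
           (cong (λ k → S n k I) (+-identityʳ k)))
    X₁ : X 1 ≡ 0
    X₁ = ∑-zeroAll (All.map (λ {t} m → trans (factor 1 t) (cong (_* S n (k + 2) (I ⊘ (t *P t)))
           (𝟙-no (nonvanishing? (t *P t) elements) (linear-vanishes m)))) (Enum.member (enum-M 1)))

  U-≤ : ∀ n I → U n 0 I ≤ card ^ n
  U-≤ n I = ≤-trans (∑-mono (M n) (λ f → χ≤1 f I)) (≤-reflexive (trans (∑-length (M n)) (length-M n)))

  -- `K₁` bounds all scaled counts in degrees up to q, where interpolation is not exact for both
  -- degrees compared. The factor 5 solves K₁ + (4/5) K = K.
  K₁ K : ℕ
  K₁ = 16 ^ card * card ^ card
  K  = 5 * K₁

  instance
    L-nonZero : NonZero L
    L-nonZero = m*n≢0 15 card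

    P-nonZero : NonZero P
    P-nonZero = m*n≢0 card (225 * proj₁ card-split + 194) {{card-nonZero}} {{ℕ.>-nonZero (≤-trans (s≤s z≤n) (m≤n+m 194 (225 * proj₁ card-split)))}}

  -- For n > q interpolation is exact in degrees n and n - 1 and the two sides are equal; for n ≤ q
  -- the trivial bound q^n is absorbed by `K₁`.
  U-near : ∀ n {I I′} → Covers I → Covers I′ → Near (16 ^ n * U n 0 I) (16 ^ n * (card * U n 1 I′)) (K₁ * L ^ n)
  U-near n {I} {I′} cov cov′ with n ≤? card
  ... | yes n≤q = near-≤ (m≤m*n K₁ (L ^ n) {{m^n≢0 L n}}) (near-trivial (bound (U-≤ n I)) (bound (U₁ n)))
    where
    bound : ∀ {x} → x ≤ card ^ n → 16 ^ n * x ≤ K₁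
    bound le = *-mono-≤ (^-monoʳ-≤ 16 n≤q) (≤-trans le (^-monoʳ-≤ card n≤q))
    U₁ : ∀ n → card * U n 1 I′ ≤ card ^ n
    U₁ zero    = ≤-trans (≤-reflexive (*-zeroʳ card)) z≤n
    U₁ (suc n) = *-monoʳ-≤ card (U-≤ n I′)
  ... | no n≰q = near-≤ z≤n (near-≡ (cong (16 ^ n *_) (trans (count (suc i) cov (sym (trans (+-suc card i) eq))) (cong (card *_)
        (sym (subst (λ m → U m 1 I′ ≡ card ^ i) eq (count i cov′ refl)))))))
    where
    i = n ∸ suc card
    eq : suc (card + i) ≡ n
    eq = m+[n∸m]≡n (≰⇒> n≰q)
    count : ∀ {m} i {I} → Covers I → m ≡ card + i → U m 0 I ≡ card ^ i
    count i {I} cov refl = interpolation-count card I (covers-length cov) (subst Distinct (sym cov) elements-distinct) i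

  -- Degree n is compared with q times degree n - 1, for two unrelated unit data. This one statement
  -- contains both the independence of the values and the growth by q, and it reproduces itself in
  -- the recursion.
  Equi : ℕ → Set (c ⊔ ℓ)
  Equi n = ∀ {I I′} → Covers I → Covers I′ → Units I → Units I′ →
           Near (16 ^ n * S n 0 I) (16 ^ n * (card * S n 1 I′)) (K * L ^ n)

  equi-lag : ∀ n k → (∀ i → k + i ≡ n → Equi i) → ∀ {I I′} → Covers I → Covers I′ → Units I → Units I′ →
             Near (16 ^ n * S n k I) (16 ^ n * (card * S n (suc k) I′)) (K * (16 ^ k * lagPow L n k))
  equi-lag n k ih {I} {I′} cov cov′ us us′ with lag-cases n k
  ... | inj₂ n<k = near-≤ z≤n (near-≡ (trans (cong (16 ^ n *_) (empty n<k)) (sym (trans (cong (λ x → 16 ^ n * (card * x)) (empty (m≤n⇒m≤1+n n<k)))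
          (cong (16 ^ n *_) (*-zeroʳ card))))))
    where
    empty : ∀ {k I} → suc n ≤ k → S n k I ≡ 0
    empty {k} {I} lt = cong (λ L → ∑ L (λ f → χ f I)) (lag-> SF lt)
  ... | inj₁ (i , refl) = near-≤ (≤-reflexive (trans (x∙yz≈y∙xz (16 ^ k) K (L ^ i)) (cong (λ x → K * (16 ^ k * x)) (sym (lagPow-≡ L i k)))))
      (near-cong (scale (cong (λ L → ∑ L (λ f → χ f I)) (sym (lag-at SF k i))))
                 (scale (cong (λ L → card * ∑ L (λ f → χ f I′)) (sym (trans (cong (lag SF (k + i)) (+-comm 1 k)) (lag-+ SF k i 1)))))
                 (near-*ˡ (16 ^ k) (ih i refl cov cov′ us us′)))
    where
    scale : ∀ {x y} → x ≡ y → 16 ^ k * (16 ^ i * x) ≡ 16 ^ (k + i) * y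
    scale {x} refl = trans (sym (*-assoc (16 ^ k) (16 ^ i) x)) (cong (_* x) (sym (^-distribˡ-+-* 16 k i)))

  near-𝟙 : ∀ {p} {X : Set p} (d : Dec X) k m {a b r} → (X → Near (k * a) (k * (m * b)) r) → Near (k * (𝟙 d * a)) (k * (m * (𝟙 d * b))) r
  near-𝟙 (yes x) k m {a} {b} n = near-cong (cong (k *_) (sym (+-identityʳ a))) (cong (λ y → k * (m * y)) (sym (+-identityʳ b))) (n x)
  near-𝟙 (no _)  k m n = near-≤ z≤n (near-≡ (cong (k *_) (sym (*-zeroʳ m))))

  Q-power : ∀ m → Q ^ m ≡ 16 ^ (m + m) * card ^ m
  Q-power zero    = refl
  Q-power (suc m) rewrite +-suc m m | Q-power m = eq 16 card (16 ^ (m + m)) (card ^ m)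
    where
    eq : ∀ a q x y → a * a * q * (x * y) ≡ a * (a * x) * (q * y)
    eq = solve-∀

  -- Subtraction of the sieves in degrees n and n - 1 leaves the errors of the terms with deg t ≥ 2,
  -- all from smaller degrees. By `contraction` they amount to at most four fifths of `K * L ^ n`;
  -- the error of `U` takes the last fifth.
  equidistribution-step : ∀ n → (∀ i → suc i ≤ n → Equi i) → Equi n
  equidistribution-step n ih {I} {I′} cov cov′ us us′ =
    near-≤ total (near-cancel-+ {a = 16 ^ n * S n 0 I} {b = 16 ^ n * (card * S n 1 I′)}
      (near-cong (trans (cong (16 ^ n *_) (sieve cov us n 0)) (*-distribˡ-+ (16 ^ n) (S n 0 I) _))
                 (trans (cong (λ x → 16 ^ n * (card * x)) (sieve cov′ us′ n 1)) (eq₁ (16 ^ n) card (S n 1 I′) (T n 1 I′)))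
                 (U-near n cov cov′))
      tails)
    where
    eq₁ : ∀ a b x y → a * (b * (x + y)) ≡ a * (b * x) + a * (b * y)
    eq₁ = solve-∀
    R : ℕ → ℕ
    R j = Q ^ (2 + j) * lagPow L n ((2 + j) + (2 + j))
    rate-j : ∀ j → ∑ (M (2 + j)) (λ _ → K * (16 ^ ((2 + j) + (2 + j)) * lagPow L n ((2 + j) + (2 + j)))) ≡ K * R j
    rate-j j = trans (∑-const (M (2 + j)) _) (trans (cong (_* (K * (16 ^ ((2 + j) + (2 + j)) * lagPow L n ((2 + j) + (2 + j))))) (length-M (2 + j)))
      (trans (eq (card ^ (2 + j)) K (16 ^ ((2 + j) + (2 + j))) (lagPow L n ((2 + j) + (2 + j))))
             (cong (λ x → K * (x * lagPow L n ((2 + j) + (2 + j)))) (sym (Q-power (2 + j))))))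
      where
      eq : ∀ a k b x → a * (k * (b * x)) ≡ k * (b * a * x)
      eq = solve-∀
    smaller : ∀ j i → (2 + j) + (2 + j) + i ≡ n → suc i ≤ n
    smaller j i e = ≤-trans (s≤s (m≤n+m i (suc j + (2 + j)))) (≤-reflexive e)
    tails : Near (16 ^ n * T n 0 I) (16 ^ n * (card * T n 1 I′)) (K * ∑ (upTo n) R)
    tails = near-≤ (≤-reflexive (trans (∑-cong (upTo n) rate-j) (∑-*ˡ (upTo n) K R)))
      (near-cong (sym (∑∑-*ˡ (upTo n) (λ j → M (2 + j)) (16 ^ n) (X 0 I)))
                 (sym (trans (cong (16 ^ n *_) (∑∑-*ˡ (upTo n) (λ j → M (2 + j)) card (X 1 I′))) (∑∑-*ˡ (upTo n) (λ j → M (2 + j)) (16 ^ n) (λ j t → card * X 1 I′ j t))))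
                 (near-∑ (All.universal (λ j → near-∑ (All.universal (term j) (M (2 + j)))) (upTo n))))
      where
      X : ℕ → Data → ℕ → Poly → ℕ
      X k I j t = 𝟙 (nonvanishing? (t *P t) elements) * S n (k + ((2 + j) + (2 + j))) (I ⊘ (t *P t))
      term : ∀ j t → Near (16 ^ n * (𝟙 (nonvanishing? (t *P t) elements) * S n ((2 + j) + (2 + j)) (I ⊘ (t *P t))))
                          (16 ^ n * (card * (𝟙 (nonvanishing? (t *P t) elements) * S n (suc ((2 + j) + (2 + j))) (I′ ⊘ (t *P t)))))
                          (K * (16 ^ ((2 + j) + (2 + j)) * lagPow L n ((2 + j) + (2 + j))))
      term j t = near-𝟙 (nonvanishing? (t *P t) elements) (16 ^ n) card λ nv →
        equi-lag n ((2 + j) + (2 + j)) (λ i e → ih i (smaller j i e)) (covers-⊘ {I} (t *P t) cov) (covers-⊘ {I′} (t *P t) cov′)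
          (units-⊘ {I} {t *P t} (nonvanishing-covers {t *P t} {I} cov nv) us)
          (units-⊘ {I′} {t *P t} (nonvanishing-covers {t *P t} {I′} cov′ nv) us′)
    total : K₁ * L ^ n + K * ∑ (upTo n) R ≤ K * L ^ n
    total = ≤-trans (+-monoʳ-≤ (K₁ * L ^ n) (≤-trans (≤-reflexive (eq₂ 5 K₁ (∑ (upTo n) R))) (*-monoʳ-≤ K₁ (contraction rate-≤ n n))))
      (≤-reflexive (eq₃ 4 K₁ (L ^ n)))
      where
      eq₂ : ∀ a k x → a * k * x ≡ k * (a * x)
      eq₂ = solve-∀
      eq₃ : ∀ a k x → k * x + k * (a * x) ≡ (1 + a) * k * x
      eq₃ = solve-∀

  equidistribution : ∀ n → Equi n
  equidistribution n = go n n ≤-refl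
    where
    go : ∀ b n → n ≤ b → Equi n
    go zero    zero z≤n = equidistribution-step zero (λ _ ())
    go (suc b) n    le  = equidistribution-step n (λ i i<n → go b i (≤-pred (≤-trans i<n le)))

-- Pairs of squarefree polynomials with weighted degree d - k.

module WeightedPairs {c ℓ : Level} (F : FiniteField c ℓ) (N : ℕ) (2≤N : 2 ≤ N) where

  open Polynomials F
  open Divisibility F
  open PS using (_:+_; _:*_; _:=_)
  open SquareFreePolynomials F
  open Interpolation F
  open Equidistribution F
  open Rate card (proj₁ card-split) (proj₂ card-split)

  -- Sum over the pairs (g , h) of squarefree monic polynomials with deg g + N deg h = d - k.
  Pairs : ℕ → ℕ → (Poly → Poly → ℕ) → ℕ
  Pairs d k φ = ∑ (upTo (suc d)) (λ j → ∑ (SF j) (λ h → ∑ (lag SF d (k + N * j)) (λ g → φ g h)))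

  private
    column : ℕ → ℕ → (Poly → Poly → ℕ) → ℕ → Poly → ℕ
    column d k φ j h = ∑ (lag SF d (k + N * j)) (λ g → φ g h)

  A : ℕ → ℕ → Data → ℕ
  A d k I = Pairs d k (λ g h → χ (g *P (h *P h)) I)

  pairs-cong : ∀ d k {φ ψ} → (∀ g h → φ g h ≡ ψ g h) → Pairs d k φ ≡ Pairs d k ψ
  pairs-cong d k e = ∑-cong (upTo (suc d)) (λ j → ∑-cong (SF j) (λ h → ∑-cong (lag SF d (k + N * j)) (λ g → e g h)))

  pairs-+ : ∀ d k φ ψ → Pairs d k (λ g h → φ g h + ψ g h) ≡ Pairs d k φ + Pairs d k ψ
  pairs-+ d k φ ψ = trans
    (∑-cong (upTo (suc d)) (λ j → ∑-cong (SF j) (λ h → ∑-+ (lag SF d (k + N * j)) (λ g → φ g h) (λ g → ψ g h))))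
    (∑∑-+ (upTo (suc d)) SF (column d k φ) (column d k ψ))

  pairs-*ˡ : ∀ d k m φ → Pairs d k (λ g h → m * φ g h) ≡ m * Pairs d k φ
  pairs-*ˡ d k m φ = trans
    (∑-cong (upTo (suc d)) (λ j → ∑-cong (SF j) (λ h → ∑-*ˡ (lag SF d (k + N * j)) m (λ g → φ g h))))
    (sym (∑∑-*ˡ (upTo (suc d)) SF m (column d k φ)))

  pairs-∑ : ∀ d k {x} {X : Set x} (L : List X) (φ : X → Poly → Poly → ℕ) →
            Pairs d k (λ g h → ∑ L (λ u → φ u g h)) ≡ ∑ L (λ u → Pairs d k (φ u))
  pairs-∑ d k []      φ = trans (pairs-cong d k (λ g h → sym (*-zeroˡ 0))) (pairs-*ˡ d k 0 (λ _ _ → 0))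
  pairs-∑ d k (u ∷ L) φ = trans (pairs-+ d k (φ u) _) (cong (Pairs d k (φ u) +_) (pairs-∑ d k L φ))

  private
    16≤L : 16 ≤ L
    16≤L = ≤-trans (m≤m+n 16 14) (*-monoʳ-≤ 15 2≤card)

  -- Equidistribution is applied to g for each h. There are at most q^j polynomials h of degree j,
  -- each lowering the degree left for g by N j ≥ 2 j, so the errors are bounded by the convergent
  -- series of `geometric`. This is where N ≥ 2 is decisive.
  pairs-near : ∀ d k {I I′} → Covers I → Covers I′ → Units I → Units I′ →
               Near (16 ^ d * A d k I) (16 ^ d * (card * A d (suc k) I′)) (K * (L * L) * L ^ d)
  pairs-near d k {I} {I′} cov cov′ us us′ = near-≤ total
    (near-cong (sym (trans (cong (16 ^ d *_) (factor k cov us)) (∑∑-*ˡ (upTo (suc d)) SF (16 ^ d) (X k I))))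
      (sym (trans (cong (λ x → 16 ^ d * (card * x)) (factor (suc k) cov′ us′)) (trans (cong (16 ^ d *_) (∑∑-*ˡ (upTo (suc d)) SF card (X (suc k) I′)))
        (∑∑-*ˡ (upTo (suc d)) SF (16 ^ d) (λ j h → card * X (suc k) I′ j h)))))
      (near-∑ (All.universal (λ j → near-∑ (All.universal (term j) (SF j))) (upTo (suc d)))))
    where
    X : ℕ → Data → ℕ → Poly → ℕ
    X k I j h = 𝟙 (nonvanishing? (h *P h) elements) * S d (k + N * j) (I ⊘ (h *P h))
    factor : ∀ k {I} → Covers I → Units I → A d k I ≡ ∑ (upTo (suc d)) (λ j → ∑ (SF j) (X k I j))
    factor k {I} cov us = ∑-cong (upTo (suc d)) (λ j → ∑-cong (SF j) (λ h →
      trans (∑-cong (lag SF d (k + N * j)) (λ g → χ-covers g (h *P h) cov us))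
            (∑-*ˡ (lag SF d (k + N * j)) (𝟙 (nonvanishing? (h *P h) elements)) (λ g → χ g (I ⊘ (h *P h))))))
    R : ℕ → ℕ
    R j = K * (16 ^ (j + j) * lagPow L d (j + j))
    split : ∀ j → k + N * j ≡ (j + j) + (k + (N ∸ 2) * j)
    split j = trans (cong (λ n → k + n * j) (sym (m+[n∸m]≡n 2≤N))) (eq k j (N ∸ 2))
      where
      eq : ∀ k j n → k + (2 + n) * j ≡ (j + j) + (k + n * j)
      eq = solve-∀
    term : ∀ j h → Near (16 ^ d * X k I j h) (16 ^ d * (card * X (suc k) I′ j h)) (R j)
    term j h = near-≤ (*-monoʳ-≤ K (≤-trans (≤-reflexive (cong (λ i → 16 ^ i * lagPow L d i) (split j))) (lagPow-mono 16≤L d (j + j) (k + (N ∸ 2) * j))))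
      (near-𝟙 (nonvanishing? (h *P h) elements) (16 ^ d) card λ nv →
        equi-lag d (k + N * j) (λ i _ → equidistribution i) (covers-⊘ {I} (h *P h) cov) (covers-⊘ {I′} (h *P h) cov′)
          (units-⊘ {I} {h *P h} (nonvanishing-covers {h *P h} {I} cov nv) us)
          (units-⊘ {I′} {h *P h} (nonvanishing-covers {h *P h} {I′} cov′ nv) us′))
    SF-length : ∀ j → length (SF j) ≤ card ^ j
    SF-length j = ≤-trans (length-filter sqfree? (M j)) (≤-reflexive (length-M j))
    eq₁ : ∀ a k b x → a * (k * (b * x)) ≡ k * (b * a * x)
    eq₁ = solve-∀
    total : ∑ (upTo (suc d)) (λ j → ∑ (SF j) (λ _ → R j)) ≤ K * (L * L) * L ^ d
    total = ≤-trans (∑-mono (upTo (suc d)) (λ j → ≤-trans (≤-reflexive (∑-const (SF j) (R j))) (≤-trans (*-monoˡ-≤ (R j) (SF-length j))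
        (≤-reflexive (trans (eq₁ (card ^ j) K (16 ^ (j + j)) (lagPow L d (j + j))) (cong (λ x → K * (x * lagPow L d (j + j))) (sym (Q-power j))))))))
      (≤-trans (≤-reflexive (∑-*ˡ (upTo (suc d)) K (λ j → Q ^ j * lagPow L d (j + j))))
      (≤-trans (*-monoʳ-≤ K (≤-trans (m≤n*m (G (suc d) d) P) (geometric (suc d) d))) (≤-reflexive (sym (*-assoc K (L * L) (L ^ d))))))

  pairs-step : ∀ k {I I′} → Covers I → Covers I′ → Units I → Units I′ →
               Sim card (λ d → A d k I) (λ d → card * A d (suc k) I′)
  pairs-step k {I} {I′} cov cov′ us us′ = sim-geometric {card} {λ d → A d k I} {λ d → card * A d (suc k) I′} (K * (L * L)) (λ d → pairs-near d k cov cov′ us us′)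

  -- For k = 0 the two data are compared through a common third count, `card * A d 1 I`; every
  -- further lag costs one factor q.
  pairs-unit : ∀ k {I I′} → Covers I → Covers I′ → Units I → Units I′ →
               Sim card (λ d → card ^ k * A d k I) (λ d → A d 0 I′)
  pairs-unit zero {I} {I′} cov cov′ us us′ = sim-cong (λ d → sym (*-identityˡ (A d 0 I))) (λ _ → refl)
    (sim-trans {a = λ d → A d 0 I} {b = λ d → card * A d 1 I} {e = λ d → A d 0 I′} (pairs-step 0 cov cov us us) (sim-sym (pairs-step 0 cov′ cov us′ us)))
  pairs-unit (suc k) {I} {I′} cov cov′ us us′ =
    sim-trans {a = λ d → card ^ suc k * A d (suc k) I} {b = λ d → card ^ k * A d k I} {e = λ d → A d 0 I′}
      (sim-cong (λ d → eq card (card ^ k) (A d (suc k) I)) (λ _ → refl)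
        (sim-*ˡ {a = λ d → card * A d (suc k) I} {b = λ d → A d k I} (card ^ k) (sim-sym (pairs-step k cov cov us us))))
      (pairs-unit k cov cov′ us us′)
    where
    eq : ∀ a b x → b * (a * x) ≡ a * b * x
    eq = solve-∀

  nz : Carrier → Poly → ℕ
  nz x f = 𝟙 (≉0? (evalP f x))

  nz-cong : ∀ x {f g} → f ≈P g → nz x f ≡ nz x g
  nz-cong x {f} {g} e = 𝟙-cong (≉0? (evalP f x)) (≉0? (evalP g x))
    (λ n e′ → n (C.trans (eval-cong x e) e′)) (λ n e′ → n (C.trans (eval-cong x (symP e)) e′))

  bezout-lin : ∀ x f → ¬ (evalP f x ≈ 0#) → Bezout (lin x) f
  bezout-lin x f n = negP (v *P k) , v , transP (+P-cong (reflP {negP (v *P k) *P lin x}) (*P-congˡ v e))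
          (transP (step (negP (v *P k)) v (lin x) k [ a ])
          (transP (+P-cong (*P-cong {g = lin x} (PR.-‿inverseˡ (v *P k)) reflP) (transP (const-* (inv a) [ a ])
            (∷≈∷ (C.trans (C.*-comm _ _) (inv-inverseʳ n)) []≈[]))) reflP))
    where
    k = proj₁ (factor-lin f x)
    e = proj₂ (factor-lin f x)
    a = evalP f x
    v = [ inv a ]
    step : ∀ u v l k r → ((u *P l) +P (v *P ((l *P k) +P r))) ≈P (((u +P (v *P k)) *P l) +P (v *P r))
    step = PS.solve 5 (λ u v l k r → (u :* l) :+ (v :* ((l :* k) :+ r)) := ((u :+ (v :* k)) :* l) :+ (v :* r)) reflP

  sqfree-lin : ∀ x → SqFree (lin x)
  sqfree-lin x with sqfree-or-square 1≉0 (mon-lin x)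
  ... | inj₁ sf = sf
  ... | inj₂ (h , k , m , (r , e)) = case mon-quotient (mon-* m m) (mon-lin x) e of λ { (j , eq , _) → contradiction (suc-injective eq) (nonzero k j) }
    where
    nonzero : ∀ k j → ¬ (k + suc k + j ≡ 0)
    nonzero k j eq rewrite +-suc k k = case eq of λ ()

  -- Roots of a squarefree polynomial are simple, so the quotient by X - x does not vanish at x;
  -- conversely such a quotient is coprime to X - x and the product is squarefree again.
  enum-roots : ∀ x n → Enum _≈P_ (λ g → SFMon n g × evalP g x ≈ 0#) (map (lin x *P_) (filter (λ g → ≉0? (evalP g x)) (lag SF n 1)))
  enum-roots x n = enum-map {_~_ = _≈P_} {_≈_ = _≈P_} {Q = Pre} (lin x *P_) transP (λ {g} → mem g)
    (λ {g} {g′} _ _ e → cancelˡ {lin x} {g} {g′} (mon⇒≉0 (mon-lin x)) e) (λ _ e → *P-congˡ (lin x) e) surj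
    (enum-filter ≈P-equiv (λ g → ≉0? (evalP g x)) (λ e n e′ → n (C.trans (eval-cong x e) e′)) (enum-lag enum-SF n 1))
    where
    Pre : Poly → Set (c ⊔ ℓ)
    Pre g = (∃ λ i → suc i ≡ n × SFMon i g) × ¬ (evalP g x ≈ 0#)
    mem : ∀ g → Pre g → SFMon n (lin x *P g) × evalP (lin x *P g) x ≈ 0#
    mem g ((i , refl , m , sf) , n≉0) =
      (mon-* (mon-lin x) m , sqfree-* (mon⇒≉0 (mon-lin x)) (mon⇒≉0 m) (sqfree-lin x) sf (bezout-lin x g n≉0)) ,
      C.trans (eval-* (lin x) g x) (C.trans (C.*-congʳ (lin-root {x} C.refl)) (C.zeroˡ _))
    surj : ∀ f → SFMon n f × evalP f x ≈ 0# → ∃ λ g → Pre g × f ≈P (lin x *P g)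
    surj f ((m , sf) , root) = k , ((proj₁ quotient , proj₁ (proj₂ quotient) , proj₂ (proj₂ quotient) ,
        sqfree-∣ {k} {f} (lin x , transP (*P-comm k (lin x)) (symP e)) sf) , nonroot) , e
      where
      k = proj₁ (root⇒∣ f x root)
      e = proj₂ (root⇒∣ f x root)
      quotient = mon-quotient {lin x} {f} {k} (mon-lin x) m (symP e)
      nonroot : ¬ (evalP k x ≈ 0#)
      nonroot z = case unit-degree (sf (lin x) (k′ , transP (*P-assoc (lin x) (lin x) k′)
          (symP (transP e (*P-congˡ (lin x) (proj₂ (root⇒∣ k x z))))))) 1≉0 (mon-lin x) of λ ()
        where k′ = proj₁ (root⇒∣ k x z)

  ∑-local : ∀ x n {φ} → (∀ {f g} → f ≈P g → φ f ≡ φ g) →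
            ∑ (SF n) φ ≡ ∑ (SF n) (λ g → nz x g * φ g) + ∑ (lag SF n 1) (λ g → nz x g * φ (lin x *P g))
  ∑-local x n {φ} resp = trans (enum-∑ ≈P-equiv (enum-SF n) (enum-⇔ (λ { _ (inj₁ q) → proj₁ q ; _ (inj₂ q) → proj₁ q }) cases
      (enum-++ (enum-filter ≈P-equiv root? (λ e n e′ → n (C.trans (eval-cong x e) e′)) (enum-SF n)) (enum-roots x n)
        (λ (_ , n≉0) (_ , z) e → n≉0 (C.trans (eval-cong x e) z)))) resp)
    (trans (∑-++ (filter root? (SF n)) _ φ) (cong₂ _+_ (∑-filter root? (SF n) φ)
      (trans (∑-map (lin x *P_) (filter root? (lag SF n 1)) φ) (∑-filter root? (lag SF n 1) _))))
    where
    root? : ∀ g → Dec (¬ (evalP g x ≈ 0#))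
    root? g = ≉0? (evalP g x)
    cases : ∀ g → SFMon n g → (SFMon n g × ¬ (evalP g x ≈ 0#)) ⊎ (SFMon n g × evalP g x ≈ 0#)
    cases g sf with evalP g x ≈? 0#
    ... | yes z = inj₂ (sf , z)
    ... | no z  = inj₁ (sf , z)

  ∑-local-lag : ∀ x n k {φ} → (∀ {f g} → f ≈P g → φ f ≡ φ g) →
    ∑ (lag SF n k) φ ≡ ∑ (lag SF n k) (λ g → nz x g * φ g) + ∑ (lag SF n (suc k)) (λ g → nz x g * φ (lin x *P g))
  ∑-local-lag x n k {φ} resp with lag-cases n k
  ... | inj₂ n<k rewrite lag-> SF n<k | lag-> SF (m≤n⇒m≤1+n n<k) = refl
  ... | inj₁ (i , refl) rewrite lag-at SF k i | trans (cong (lag SF (k + i)) (+-comm 1 k)) (lag-+ SF k i 1) = ∑-local x i resp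

  Respects : (Poly → Poly → ℕ) → Set (c ⊔ ℓ)
  Respects φ = ∀ {g g′ h h′} → g ≈P g′ → h ≈P h′ → φ g h ≡ φ g′ h′

  pairs-local-g : ∀ x d k {φ} → Respects φ →
    Pairs d k φ ≡ Pairs d k (λ g h → nz x g * φ g h) + Pairs d (suc k) (λ g h → nz x g * φ (lin x *P g) h)
  pairs-local-g x d k {φ} resp = trans
    (∑-cong (upTo (suc d)) (λ j → ∑-cong (SF j) (λ h → ∑-local-lag x d (k + N * j) {λ g → φ g h} (λ e → resp e reflP))))
    (∑∑-+ (upTo (suc d)) SF (column d k (λ g h → nz x g * φ g h)) (column d (suc k) (λ g h → nz x g * φ (lin x *P g) h)))

  pairs-local-h : ∀ x d k {φ} → Respects φ →
    Pairs d k φ ≡ Pairs d k (λ g h → nz x h * φ g h) + Pairs d (k + N) (λ g h → nz x h * φ g (lin x *P h))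
  pairs-local-h x d k {φ} resp = begin
    ∑ (upTo (suc d)) (λ j → ∑ (SF j) (Y j))
      ≡⟨ ∑-cong (upTo (suc d)) (λ j → ∑-local x j {Y j} (λ e → ∑-cong (lag SF d (k + N * j)) (λ g → resp reflP e))) ⟩
    ∑ (upTo (suc d)) (λ j → ∑ (SF j) (λ h → nz x h * Y j h) + ∑ (lag SF j 1) (λ h → nz x h * Y j (lin x *P h)))
      ≡⟨ ∑-+ (upTo (suc d)) (λ j → ∑ (SF j) (λ h → nz x h * Y j h)) (λ j → ∑ (lag SF j 1) (λ h → nz x h * Y j (lin x *P h))) ⟩
    ∑ (upTo (suc d)) (λ j → ∑ (SF j) (λ h → nz x h * Y j h)) + ∑ (upTo (suc d)) (λ j → ∑ (lag SF j 1) (λ h → nz x h * Y j (lin x *P h)))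
      ≡⟨ cong₂ _+_ (∑-cong (upTo (suc d)) (λ j → ∑-cong (SF j) (λ h → sym (∑-*ˡ (lag SF d (k + N * j)) (nz x h) (λ g → φ g h))))) second ⟩
    Pairs d k (λ g h → nz x h * φ g h) + Pairs d (k + N) (λ g h → nz x h * φ g (lin x *P h)) ∎
    where
    open ≡-Reasoning
    Y : ℕ → Poly → ℕ
    Y j h = ∑ (lag SF d (k + N * j)) (λ g → φ g h)
    Z : ℕ → ℕ
    Z j = ∑ (SF j) (λ h → nz x h * Y (suc j) (lin x *P h))
    too-large : suc d ≤ k + N * suc d
    too-large = ≤-trans (m≤n*m (suc d) N {{ℕ.>-nonZero (≤-trans (s≤s z≤n) 2≤N)}}) (m≤n+m (N * suc d) k)
    index : ∀ k N j → k + N * suc j ≡ k + N + N * j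
    index k N j = trans (cong (k +_) (*-suc N j)) (sym (+-assoc k N (N * j)))
    second : ∑ (upTo (suc d)) (λ j → ∑ (lag SF j 1) (λ h → nz x h * Y j (lin x *P h))) ≡ Pairs d (k + N) (λ g h → nz x h * φ g (lin x *P h))
    second = begin
      ∑ (upTo (suc d)) (λ j → ∑ (lag SF j 1) (λ h → nz x h * Y j (lin x *P h)))  ≡⟨ ∑-upTo-suc d (λ j → ∑ (lag SF j 1) (λ h → nz x h * Y j (lin x *P h))) ⟩
      ∑ (upTo d) Z                                                              ≡⟨ sym (+-identityʳ _) ⟩
      -- Replacing h by its cofactor shortens the range of j by one. The missing term at j = d is
      -- zero because N (d + 1) exceeds d.
      ∑ (upTo d) Z + 0                                                          ≡⟨ cong (∑ (upTo d) Z +_) (sym Z-d) ⟩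
      ∑ (upTo d) Z + Z d                                                        ≡⟨ sym (∑-upTo-last d Z) ⟩
      ∑ (upTo (suc d)) Z                                                        ≡⟨ ∑-cong (upTo (suc d)) (λ j → ∑-cong (SF j) (λ h →
          trans (sym (∑-*ˡ (lag SF d (k + N * suc j)) (nz x h) (λ g → φ g (lin x *P h))))
                (cong (λ i → ∑ (lag SF d i) (λ g → nz x h * φ g (lin x *P h))) (index k N j)))) ⟩
      Pairs d (k + N) (λ g h → nz x h * φ g (lin x *P h))                        ∎
      where
      Z-d : Z d ≡ 0
      Z-d = ∑-zero (SF d) (λ h → trans (cong (λ L → nz x h * ∑ L (λ g → φ g (lin x *P h))) (lag-> SF too-large)) (*-zeroʳ (nz x h)))

-- From unit values to arbitrary values: the weight of a zero.

module LocalWeights {c ℓ : Level} (F : FiniteField c ℓ) (N : ℕ) (2≤N : 2 ≤ N) where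

  open Polynomials F
  open Divisibility F
  open PS using (_:*_; _:=_)
  open SquareFreePolynomials F
  open Interpolation F
  open Equidistribution F
  open WeightedPairs F N 2≤N

  χ-insert : ∀ f J x u K → χ f (J ++ (x , u) ∷ K) ≡ 𝟙 (evalP f x ≈? u) * χ f (J ++ K)
  χ-insert f J x u K = sym (trans (𝟙-× (evalP f x ≈? u) (interpolates? f (J ++ K)))
    (𝟙-cong ((evalP f x ≈? u) ×-dec interpolates? f (J ++ K)) (interpolates? f (J ++ (x , u) ∷ K))
      (λ (e , is) → Allₚ.++⁺ (Allₚ.++⁻ˡ J is) (e ∷ Allₚ.++⁻ʳ J is))
      (λ is → All.head (Allₚ.++⁻ʳ J is) , Allₚ.++⁺ (Allₚ.++⁻ˡ J is) (All.tail (Allₚ.++⁻ʳ J is)))))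

  -- Data after a zero at `x` has been divided out through `w`: the cofactor takes a unit value `u`
  -- at `x`, and the position of `x` between `J` and `K` is kept.
  ext : Poly → Data → Carrier → Data → Carrier → Data
  ext w J x K u = (J ⊘ w) ++ (x , u) ∷ (K ⊘ w)

  ⊘-++ : ∀ J K w → (J ++ K) ⊘ w ≡ (J ⊘ w) ++ (K ⊘ w)
  ⊘-++ J K w = map-++ _ J K

  private
    -- A condition of not vanishing is resolved into the possible unit values, which makes it a sum
    -- over prescribed data.
    ∑-nonzero-value : ∀ v → ∑ elements (λ u → 𝟙 (≉0? u) * 𝟙 (v ≈? u)) ≡ 𝟙 (≉0? v)
    ∑-nonzero-value v = trans (∑-cong elements eq) (trans (∑-*ˡ elements (𝟙 (≉0? v)) (λ u → 𝟙 (v ≈? u)))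
      (trans (cong (𝟙 (≉0? v) *_) (∑-at C.isEquivalence enum-elements {v} tt (λ _ → tt) (v ≈?_))) (*-identityʳ _)))
      where
      eq : ∀ u → 𝟙 (≉0? u) * 𝟙 (v ≈? u) ≡ 𝟙 (≉0? v) * 𝟙 (v ≈? u)
      eq u with v ≈? u
      ... | yes e = cong (_* 1) (𝟙-cong (≉0? u) (≉0? v) (λ n z → n (C.trans (C.sym e) z)) (λ n z → n (C.trans e z)))
      ... | no _  = trans (*-zeroʳ (𝟙 (≉0? u))) (sym (*-zeroʳ (𝟙 (≉0? v))))

    nz-pair : ∀ x g h → nz x h * nz x g ≡ nz x (g *P (h *P h))
    nz-pair x g h = trans (𝟙-× (≉0? (evalP h x)) (≉0? (evalP g x))) (𝟙-cong (≉0? (evalP h x) ×-dec ≉0? (evalP g x)) (≉0? (evalP (g *P (h *P h)) x))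
      (λ (h≉0 , g≉0) z → x≉0⇒y≉0⇒xy≉0 g≉0 (x≉0⇒y≉0⇒xy≉0 h≉0 h≉0) (C.trans (C.sym value) z))
      (λ n → (λ z → n (C.trans value (C.trans (C.*-congˡ (C.trans (C.*-congʳ z) (C.zeroˡ _))) (C.zeroʳ _)))) ,
             (λ z → n (C.trans value (C.trans (C.*-congʳ z) (C.zeroˡ _))))))
      where
      value : evalP (g *P (h *P h)) x ≈ (evalP g x ⊗ (evalP h x ⊗ evalP h x))
      value = C.trans (eval-* g (h *P h) x) (C.*-congˡ (eval-* h h x))

  zero-factor : ∀ {w x y} J K → evalP w x ≈ 0# → y ≈ 0# → Nonvanishing w (points (J ++ K)) → ∀ g h e → e ≈P ((g *P (h *P h)) *P w) →
    nz x h * (nz x g * χ e (J ++ (x , y) ∷ K)) ≡ ∑ elements (λ u → 𝟙 (≉0? u) * χ (g *P (h *P h)) (ext w J x K u))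
  zero-factor {w} {x} {y} J K wx≈0 y≈0 nv g h e e≈ = begin
    nz x h * (nz x g * χ e (J ++ (x , y) ∷ K))
      ≡⟨ sym (*-assoc (nz x h) (nz x g) _) ⟩
    nz x h * nz x g * χ e (J ++ (x , y) ∷ K)
      ≡⟨ cong₂ _*_ (nz-pair x g h) (trans (χ-cong (J ++ (x , y) ∷ K) e≈) (trans (χ-insert (f *P w) J x y K)
         (trans (cong₂ _*_ (𝟙-yes (evalP (f *P w) x ≈? y) root) (trans (χ-⊘ f w (J ++ K) nv) (cong (χ f) (⊘-++ J K w)))) (*-identityˡ _)))) ⟩
    nz x f * χ f ((J ⊘ w) ++ (K ⊘ w))
      ≡⟨ cong (_* χ f ((J ⊘ w) ++ (K ⊘ w))) (sym (∑-nonzero-value (evalP f x))) ⟩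
    ∑ elements (λ u → 𝟙 (≉0? u) * 𝟙 (evalP f x ≈? u)) * χ f ((J ⊘ w) ++ (K ⊘ w))
      ≡⟨ sym (∑-*ʳ elements _ _) ⟩
    ∑ elements (λ u → 𝟙 (≉0? u) * 𝟙 (evalP f x ≈? u) * χ f ((J ⊘ w) ++ (K ⊘ w)))
      ≡⟨ ∑-cong elements (λ u → trans (*-assoc (𝟙 (≉0? u)) _ _) (cong (𝟙 (≉0? u) *_) (sym (χ-insert f (J ⊘ w) x u (K ⊘ w))))) ⟩
    ∑ elements (λ u → 𝟙 (≉0? u) * χ f (ext w J x K u)) ∎
    where
    open ≡-Reasoning
    f = g *P (h *P h)
    root : evalP (f *P w) x ≈ y
    root = C.trans (eval-* f w x) (C.trans (C.*-congˡ wx≈0) (C.trans (C.zeroʳ _) (C.sym y≈0)))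

  pairs-local : ∀ x d k {φ} → Respects φ → (∀ g h → nz x h * (nz x g * φ g h) ≡ 0) →
    Pairs d k φ ≡ Pairs d (k + N) (λ g h → nz x h * (nz x g * φ g (lin x *P h)))
                + (Pairs d (suc k) (λ g h → nz x h * (nz x g * φ (lin x *P g) h))
                +  Pairs d (suc (k + N)) (λ g h → nz x h * (nz x g * φ (lin x *P g) (lin x *P h))))
  pairs-local x d k {φ} resp none = trans (pairs-local-g x d k resp) (cong₂ _+_
    (trans (pairs-local-h x d k {λ g h → nz x g * φ g h} (λ e e′ → cong₂ _*_ (nz-cong x e) (resp e e′)))
           (cong (_+ Pairs d (k + N) (λ g h → nz x h * (nz x g * φ g (lin x *P h)))) (trans (pairs-cong d k none) (pairs-*ˡ d k 0 (λ _ _ → 0)))))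
    (pairs-local-h x d (suc k) {λ g h → nz x g * φ (lin x *P g) h} (λ e e′ → cong₂ _*_ (nz-cong x e) (resp (*P-congˡ (lin x) e) e′))))

  pairs-ext : ∀ d k {φ} (c : Carrier → ℕ) (E : Carrier → Data) → (∀ g h → φ g h ≡ ∑ elements (λ u → c u * χ (g *P (h *P h)) (E u))) →
    Pairs d k φ ≡ ∑ elements (λ u → c u * A d k (E u))
  pairs-ext d k c E e = trans (pairs-cong d k e) (trans (pairs-∑ d k elements (λ u g h → c u * χ (g *P (h *P h)) (E u)))
    (∑-cong elements (λ u → pairs-*ˡ d k (c u) (λ g h → χ (g *P (h *P h)) (E u)))))

  private
    rearrange₁ : ∀ l g h → ((l *P g) *P (h *P h)) ≈P ((g *P (h *P h)) *P l)
    rearrange₁ = PS.solve 3 (λ l g h → (l :* g) :* (h :* h) := (g :* (h :* h)) :* l) reflP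

    rearrange₂ : ∀ l g h → (g *P ((l *P h) *P (l *P h))) ≈P ((g *P (h *P h)) *P (l *P l))
    rearrange₂ = PS.solve 3 (λ l g h → g :* ((l :* h) :* (l :* h)) := (g :* (h :* h)) :* (l :* l)) reflP

    rearrange₃ : ∀ l g h → ((l *P g) *P ((l *P h) *P (l *P h))) ≈P ((g *P (h *P h)) *P (l *P (l *P l)))
    rearrange₃ = PS.solve 3 (λ l g h → (l :* g) :* ((l :* h) :* (l :* h)) := (g :* (h :* h)) :* (l :* (l :* l))) reflP

    root-* : ∀ l w x → evalP l x ≈ 0# → evalP (l *P w) x ≈ 0#
    root-* l w x e = C.trans (eval-* l w x) (C.trans (C.*-congʳ e) (C.zeroˡ _))

  nonvanishing-* : ∀ {v w xs} → Nonvanishing v xs → Nonvanishing w xs → Nonvanishing (v *P w) xs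
  nonvanishing-* {v} {w} ns ms = All.zipWith (λ {x} (n , m) z → x≉0⇒y≉0⇒xy≉0 n m (C.trans (C.sym (eval-* v w x)) z)) (ns , ms)

  l¹ l² l³ : Carrier → Poly
  l¹ x = lin x
  l² x = lin x *P lin x
  l³ x = lin x *P (lin x *P lin x)

  -- In g h² the factor X - x occurs once through g, twice through h and three times through both.
  -- The data at the other points are divided by that power, while the weighted degree drops by 1, N
  -- or N + 1.
  zero-step : ∀ d k {x y} J K → y ≈ 0# → Nonvanishing (lin x) (points (J ++ K)) →
    A d k (J ++ (x , y) ∷ K) ≡ ∑ elements (λ u → 𝟙 (≉0? u) * A d (k + N) (ext (l² x) J x K u))
      + (∑ elements (λ u → 𝟙 (≉0? u) * A d (suc k) (ext (l¹ x) J x K u))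
      +  ∑ elements (λ u → 𝟙 (≉0? u) * A d (suc (k + N)) (ext (l³ x) J x K u)))
  zero-step d k {x} {y} J K y≈0 nv = trans (pairs-local x d k {φ} resp none) (cong₂ _+_
    (pairs-ext d (k + N) (λ u → 𝟙 (≉0? u)) (ext (l² x) J x K) (λ g h → zero-factor {l² x} J K (root-* l l x root) y≈0 nv² g h _ (rearrange₂ l g h)))
    (cong₂ _+_
    (pairs-ext d (suc k) (λ u → 𝟙 (≉0? u)) (ext (l¹ x) J x K) (λ g h → zero-factor {l¹ x} J K root y≈0 nv g h _ (rearrange₁ l g h)))
    (pairs-ext d (suc (k + N)) (λ u → 𝟙 (≉0? u)) (ext (l³ x) J x K)
       (λ g h → zero-factor {l³ x} J K (root-* l (l *P l) x root) y≈0 (nonvanishing-* {l} {l *P l} nv nv²) g h _ (rearrange₃ l g h)))))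
    where
    I = J ++ (x , y) ∷ K
    l = lin x
    φ : Poly → Poly → ℕ
    φ g h = χ (g *P (h *P h)) I
    resp : Respects φ
    resp e e′ = χ-cong I (*P-cong e (*P-cong e′ e′))
    root : evalP l x ≈ 0#
    root = lin-root {x} C.refl
    nv² : Nonvanishing (l *P l) (points (J ++ K))
    nv² = nonvanishing-* {l} {l} nv nv
    none : ∀ g h → nz x h * (nz x g * φ g h) ≡ 0
    none g h = trans (sym (*-assoc (nz x h) (nz x g) (φ g h))) (trans (cong₂ _*_ (nz-pair x g h) (χ-insert f J x y K)) (go (evalP f x ≈? y)))
      where
      f = g *P (h *P h)
      go : (e? : Dec (evalP f x ≈ y)) → nz x f * (𝟙 e? * χ f (J ++ K)) ≡ 0
      go (yes e) = cong (_* (1 * χ f (J ++ K))) (𝟙-no (≉0? (evalP f x)) (λ n → n (C.trans e y≈0)))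
      go (no _)  = *-zeroʳ (nz x f)

  -- (q - 1) (q^(N+1) + q^N + q + 1) times the limiting probability that f takes the value y at a given point.
  weight : Carrier → ℕ
  weight y with y ≈? 0#
  ... | yes _ = units * (card ^ N + (card + 1))
  ... | no _  = card ^ suc N

  weight-zero : ∀ {y} → y ≈ 0# → weight y ≡ units * (card ^ N + (card + 1))
  weight-zero {y} e with y ≈? 0#
  ... | yes _ = refl
  ... | no n  = contradiction e n

  weight-unit : ∀ {y} → ¬ (y ≈ 0#) → weight y ≡ card ^ suc N
  weight-unit {y} n with y ≈? 0#
  ... | yes e = contradiction e n
  ... | no _  = refl

  -- `V` is what `W` would be if all values were units, so W / V is the density of the data relative
  -- to unit data.
  V W : Data → ℕ
  V []      = 1
  V (p ∷ K) = card ^ suc N * V K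
  W []      = 1
  W (p ∷ K) = weight (proj₂ p) * W K

  weight-cong : ∀ {y z} → (y ≈ 0# → z ≈ 0#) → (z ≈ 0# → y ≈ 0#) → weight y ≡ weight z
  weight-cong {y} {z} f g with z ≈? 0#
  ... | yes e = weight-zero (g e)
  ... | no n  = weight-unit (λ e → n (f e))

  V-⊘ : ∀ K w → V (K ⊘ w) ≡ V K
  V-⊘ []      w = refl
  V-⊘ (p ∷ K) w = cong (card ^ suc N *_) (V-⊘ K w)

  -- The weight of a value depends only on whether it is zero, which division by a unit preserves.
  W-⊘ : ∀ K {w} → Nonvanishing w (points K) → W (K ⊘ w) ≡ W K
  W-⊘ []      []       = refl
  W-⊘ (p ∷ K) {w} (n ∷ ns) = cong₂ _*_
    (weight-cong (λ e → numerator (proj₂ p ≈? 0#) e) (λ e → C.trans (C.*-congʳ e) (C.zeroˡ _))) (W-⊘ K {w} ns)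
    where
    numerator : Dec (proj₂ p ≈ 0#) → (proj₂ p ⊗ inv (evalP w (proj₁ p))) ≈ 0# → proj₂ p ≈ 0#
    numerator (yes z) e = z
    numerator (no z)  e = contradiction e (x≉0⇒y≉0⇒xy≉0 z (inv≉0 n))

  units-insert : ∀ {J x y} → Units J → ¬ (y ≈ 0#) → Units (J ++ [ (x , y) ])
  units-insert us n = Allₚ.++⁺ us (n ∷ [])

  sim-𝟙 : ∀ {p} {X : Set p} (d : Dec X) {a b} → (X → Sim card a b) → Sim card (λ d′ → 𝟙 d * a d′) (λ d′ → 𝟙 d * b d′)
  sim-𝟙 (yes x) {a} {b} s = sim-cong (λ d → sym (*-identityˡ (a d))) (λ d → sym (*-identityˡ (b d))) (s x)
  sim-𝟙 (no _)  s = sim-≡ (λ _ → refl)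

  module _ {I₁} (cov₁ : Covers I₁) (us₁ : Units I₁) where

    -- `J` holds the points whose values are already units, `K` those still arbitrary; `k` is the
    -- degree already removed, and q^k restores the scale.
    Claim : ℕ → Data → Data → Set
    Claim k J K = Sim card (λ d → card ^ k * (V K * A d k (J ++ K))) (λ d → W K * A d 0 I₁)

    -- A unit at the head of `K` passes to `J`; a zero is divided out by `zero-step` and returns as
    -- a sum over unit values. The induction runs on the length because division replaces `K` by
    -- another list, and `J` and `k` must vary.
    asymptotic : ∀ n K → length K ≡ n → ∀ J k → Units J → Covers (J ++ K) → Claim k J K
    asymptotic zero [] _ J k us cov = sim-cong
      (λ d → cong (card ^ k *_) (trans (cong (A d k) (sym (++-identityʳ J))) (sym (*-identityˡ (A d k (J ++ []))))))
      (λ d → sym (*-identityˡ (A d 0 I₁)))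
      (pairs-unit k (subst Covers (++-identityʳ J) cov) cov₁ us us₁)
    asymptotic (suc n) ((x , y) ∷ K) eq J k us cov with y ≈? 0#
    ... | no y≉0 = sim-cong
          (λ d → trans (cong (λ I → card ^ suc N * (card ^ k * (V K * A d k I))) (++-assoc J [ (x , y) ] K)) (rearrange (card ^ suc N) (card ^ k) (V K) _))
          (λ d → sym (*-assoc (card ^ suc N) (W K) (A d 0 I₁)))
          (sim-*ˡ {a = λ d → card ^ k * (V K * A d k ((J ++ [ (x , y) ]) ++ K))} {b = λ d → W K * A d 0 I₁} (card ^ suc N)
            (asymptotic n K (suc-injective eq) (J ++ [ (x , y) ]) k (units-insert us y≉0) (subst Covers (sym (++-assoc J [ (x , y) ] K)) cov)))
      where
      rearrange : ∀ s a b c → s * (a * (b * c)) ≡ a * (s * b * c)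
      rearrange = solve-∀
    ... | yes y≈0 = sim-cong (λ d → sym (left d)) right
          (sim-+ (sim-∑ {a = a²} {b = b²} (All.universal s² elements))
          (sim-+ (sim-∑ {a = a¹} {b = b¹} (All.universal s¹ elements))
                 (sim-∑ {a = a³} {b = b³} (All.universal s³ elements))))
      where
      nv : Nonvanishing (lin x) (points (J ++ K))
      nv = All.map (λ n → lin-nonroot n) (subst (All _) (sym (map-++ proj₁ J K))
             (distinct-insert (points J) (subst Distinct (trans (sym cov) (map-++ proj₁ J ((x , y) ∷ K))) elements-distinct)))
      nv² : Nonvanishing (l² x) (points (J ++ K))
      nv² = nonvanishing-* {lin x} {lin x} nv nv
      nv³ : Nonvanishing (l³ x) (points (J ++ K))
      nv³ = nonvanishing-* {lin x} {l² x} nv nv²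
      ext-claim : ∀ w k → Nonvanishing w (points (J ++ K)) → ∀ {u} → ¬ (u ≈ 0#) →
                  Sim card (λ d → card ^ k * (V K * A d k (ext w J x K u))) (λ d → W K * A d 0 I₁)
      ext-claim w k nv {u} u≉0 = sim-cong
        (λ d → cong (card ^ k *_) (cong₂ _*_ (V-⊘ K w) (cong (A d k) (++-assoc (J ⊘ w) [ (x , u) ] (K ⊘ w)))))
        (λ d → cong (_* A d 0 I₁) (W-⊘ K {w} nvK))
        (asymptotic n (K ⊘ w) (trans (length-map _ K) (suc-injective eq)) ((J ⊘ w) ++ [ (x , u) ]) k
          (units-insert (units-⊘ {J} {w} nvJ us) u≉0)
          (trans (cong points (++-assoc (J ⊘ w) [ (x , u) ] (K ⊘ w)))
            (trans (map-++ proj₁ (J ⊘ w) ((x , u) ∷ (K ⊘ w))) (trans (cong₂ (λ a b → a ++ x ∷ b) (points-⊘ J w) (points-⊘ K w))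
              (trans (sym (map-++ proj₁ J ((x , y) ∷ K))) cov)))))
        where
        nv′ : Nonvanishing w (points J ++ points K)
        nv′ = subst (Nonvanishing w) (map-++ proj₁ J K) nv
        nvJ = Allₚ.++⁻ˡ (points J) nv′
        nvK = Allₚ.++⁻ʳ (points J) nv′
      a¹ a² a³ b¹ b² b³ : Carrier → ℕ → ℕ
      a¹ u d = 𝟙 (≉0? u) * (card ^ N * (card ^ suc k * (V K * A d (suc k) (ext (l¹ x) J x K u))))
      a² u d = 𝟙 (≉0? u) * (card * (card ^ (k + N) * (V K * A d (k + N) (ext (l² x) J x K u))))
      a³ u d = 𝟙 (≉0? u) * (1 * (card ^ suc (k + N) * (V K * A d (suc (k + N)) (ext (l³ x) J x K u))))
      b¹ u d = 𝟙 (≉0? u) * (card ^ N * (W K * A d 0 I₁))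
      b² u d = 𝟙 (≉0? u) * (card * (W K * A d 0 I₁))
      b³ u d = 𝟙 (≉0? u) * (1 * (W K * A d 0 I₁))
      s¹ : ∀ u → Sim card (a¹ u) (b¹ u)
      s¹ u = sim-𝟙 (≉0? u) (λ n → sim-*ˡ (card ^ N) (ext-claim (l¹ x) (suc k) nv n))
      s² : ∀ u → Sim card (a² u) (b² u)
      s² u = sim-𝟙 (≉0? u) (λ n → sim-*ˡ card (ext-claim (l² x) (k + N) nv² n))
      s³ : ∀ u → Sim card (a³ u) (b³ u)
      s³ u = sim-𝟙 (≉0? u) (λ n → sim-*ˡ 1 (ext-claim (l³ x) (suc (k + N)) nv³ n))
      -- `m` is q^(N+1) divided by q to the degree just removed: q^N, q or 1. These are the three
      -- summands in the weight of zero.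
      pull : ∀ m k′ w d → card ^ k * card ^ suc N ≡ m * card ^ k′ →
             card ^ k * (card ^ suc N * V K * ∑ elements (λ u → 𝟙 (≉0? u) * A d k′ (ext w J x K u)))
             ≡ ∑ elements (λ u → 𝟙 (≉0? u) * (m * (card ^ k′ * (V K * A d k′ (ext w J x K u)))))
      pull m k′ w d e = trans (r₁ (card ^ k) (card ^ suc N) (V K) Σ′) (trans (cong (λ z → z * V K * Σ′) e)
          (trans (sym (∑-*ˡ elements (m * card ^ k′ * V K) (λ u → 𝟙 (≉0? u) * A d k′ (ext w J x K u))))
            (∑-cong elements (λ u → r₂ m (card ^ k′) (V K) (𝟙 (≉0? u)) (A d k′ (ext w J x K u))))))
        where
        Σ′ = ∑ elements (λ u → 𝟙 (≉0? u) * A d k′ (ext w J x K u))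
        r₁ : ∀ a b c s → a * (b * c * s) ≡ a * b * c * s
        r₁ = solve-∀
        r₂ : ∀ m a v i z → m * a * v * (i * z) ≡ i * (m * (a * (v * z)))
        r₂ = solve-∀
      left : ∀ d → card ^ k * (card ^ suc N * V K * A d k (J ++ (x , y) ∷ K)) ≡
                   ∑ elements (λ u → a² u d) + (∑ elements (λ u → a¹ u d) + ∑ elements (λ u → a³ u d))
      left d = trans (cong (λ z → card ^ k * (card ^ suc N * V K * z)) (zero-step d k J K y≈0 nv))
        (trans (distr (card ^ k) (card ^ suc N * V K) _ _ _) (cong₂ _+_ (pull card (k + N) (l² x) d e²)
          (cong₂ _+_ (pull (card ^ N) (suc k) (l¹ x) d e¹) (pull 1 (suc (k + N)) (l³ x) d e³))))
        where
        distr : ∀ a b x y z → a * (b * (x + (y + z))) ≡ a * (b * x) + (a * (b * y) + a * (b * z))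
        distr = solve-∀
        p : ∀ a q b → a * (q * b) ≡ b * (q * a)
        p = solve-∀
        p′ : ∀ a q b → a * (q * b) ≡ q * (a * b)
        p′ = solve-∀
        e¹ : card ^ k * card ^ suc N ≡ card ^ N * card ^ suc k
        e¹ = p (card ^ k) card (card ^ N)
        e² : card ^ k * card ^ suc N ≡ card * card ^ (k + N)
        e² = trans (p′ (card ^ k) card (card ^ N)) (cong (card *_) (sym (^-distribˡ-+-* card k N)))
        e³ : card ^ k * card ^ suc N ≡ 1 * card ^ suc (k + N)
        e³ = trans e² (sym (*-identityˡ _))
      right : ∀ d → ∑ elements (λ u → b² u d) + (∑ elements (λ u → b¹ u d) + ∑ elements (λ u → b³ u d))
                    ≡ units * (card ^ N + (card + 1)) * W K * A d 0 I₁
      right d = trans (cong₂ _+_ (out card) (cong₂ _+_ (out (card ^ N)) (out 1))) (collect units card (card ^ N) (W K) (A d 0 I₁))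
        where
        out : ∀ m → ∑ elements (λ u → 𝟙 (≉0? u) * (m * (W K * A d 0 I₁))) ≡ units * (m * (W K * A d 0 I₁))
        out m = ∑-*ʳ elements (m * (W K * A d 0 I₁)) (λ u → 𝟙 (≉0? u))
        collect : ∀ u q n w a → u * (q * (w * a)) + (u * (n * (w * a)) + u * (1 * (w * a))) ≡ u * (n + (q + 1)) * w * a
        collect = solve-∀

-- Fibres of the power map and points on the curve.

module PowerFibres {c ℓ : Level} (F : FiniteField c ℓ) where

  open Polynomials F
  open CS using (_:*_; _:=_)
  open Divisibility F
  open SquareFreePolynomials F
  open Interpolation F

  pow-cong : ∀ n {x y} → x ≈ y → pow x n ≈ pow y n
  pow-cong zero    e = C.refl
  pow-cong (suc n) e = C.*-cong e (pow-cong n e)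

  pow-⊗ : ∀ n x y → pow (x ⊗ y) n ≈ (pow x n ⊗ pow y n)
  pow-⊗ zero    x y = C.sym (C.*-identityˡ 1#)
  pow-⊗ (suc n) x y = C.trans (C.*-congˡ (pow-⊗ n x y)) (step x y (pow x n) (pow y n))
    where
    step : ∀ x y a b → ((x ⊗ y) ⊗ (a ⊗ b)) ≈ ((x ⊗ a) ⊗ (y ⊗ b))
    step = CS.solve 4 (λ x y a b → (x :* y) :* (a :* b) := (x :* a) :* (y :* b)) C.refl

  pow-+ : ∀ m n x → pow x (m + n) ≈ (pow x m ⊗ pow x n)
  pow-+ zero    n x = C.sym (C.*-identityˡ _)
  pow-+ (suc m) n x = C.trans (C.*-congˡ (pow-+ m n x)) (C.sym (C.*-assoc _ _ _))

  pow-1 : ∀ n → pow 1# n ≈ 1#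
  pow-1 zero    = C.refl
  pow-1 (suc n) = C.trans (C.*-identityˡ _) (pow-1 n)

  pow-* : ∀ m n x → pow x (m * n) ≈ pow (pow x n) m
  pow-* zero    n x = C.refl
  pow-* (suc m) n x = C.trans (pow-+ n (m * n) x) (C.*-congˡ (pow-* m n x))

  pow-*-1 : ∀ m n x → pow x n ≈ 1# → pow x (m * n) ≈ 1#
  pow-*-1 m n x e = C.trans (pow-* m n x) (C.trans (pow-cong m e) (pow-1 m))

  pow≉0 : ∀ n {x} → ¬ (x ≈ 0#) → ¬ (pow x n ≈ 0#)
  pow≉0 zero    x≉0 = 1≉0
  pow≉0 (suc n) x≉0 = x≉0⇒y≉0⇒xy≉0 x≉0 (pow≉0 n x≉0)

  pow-zero : ∀ n {x} → x ≈ 0# → pow x (suc n) ≈ 0#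
  pow-zero n e = C.trans (C.*-congʳ e) (C.zeroˡ _)

  cancel-⊗ : ∀ {x y z} → ¬ (x ≈ 0#) → (x ⊗ y) ≈ (x ⊗ z) → y ≈ z
  cancel-⊗ {x} {y} {z} x≉0 e = C.trans (C.sym (undo y)) (C.trans (C.*-congˡ e) (undo z))
    where
    undo : ∀ y → (inv x ⊗ (x ⊗ y)) ≈ y
    undo y = C.trans (C.sym (C.*-assoc _ _ _)) (C.trans (C.*-congʳ (C.trans (C.*-comm _ _) (inv-inverseʳ x≉0))) (C.*-identityˡ y))

  product : List Carrier → Carrier
  product = foldr _⊗_ 1#

  product-insert : ∀ xs y ys → product (xs ++ y ∷ ys) ≈ (y ⊗ product (xs ++ ys))
  product-insert []       y ys = C.refl
  product-insert (x ∷ xs) y ys = C.trans (C.*-congˡ (product-insert xs y ys)) (step x y _)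
    where
    step : ∀ x y p → (x ⊗ (y ⊗ p)) ≈ (y ⊗ (x ⊗ p))
    step = CS.solve 3 (λ x y p → x :* (y :* p) := y :* (x :* p)) C.refl

  split-at : ∀ {x L} → Any (x ≈_) L → ∃ λ xs → ∃ λ y → ∃ λ ys → L ≡ xs ++ y ∷ ys × x ≈ y
  split-at {L = y ∷ L} (here e)  = [] , y , L , refl , e
  split-at {L = z ∷ L} (there i) with split-at i
  ... | xs , y , ys , refl , e = z ∷ xs , y , ys , refl , e

  distinct-remove : ∀ xs {y ys} → Distinct (xs ++ y ∷ ys) → Distinct (xs ++ ys)
  distinct-remove []       (_ ∷ ds) = ds
  distinct-remove (x ∷ xs) (d ∷ ds) = Allₚ.++⁺ (Allₚ.++⁻ˡ xs d) (All.tail (Allₚ.++⁻ʳ xs d)) ∷ distinct-remove xs ds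

  product-unique : ∀ {L K} → Distinct L → Distinct K → All (λ x → Any (x ≈_) K) L → All (λ x → Any (x ≈_) L) K → product L ≈ product K
  product-unique {[]} {[]}    _ _ _ _        = C.refl
  product-unique {[]} {y ∷ K} _ _ _ (() ∷ _)
  product-unique {x ∷ L} {K} (x≉ ∷ dL) dK (i ∷ is) ks with split-at i
  ... | xs , y , ys , refl , x≈y = C.trans (C.*-cong x≈y (product-unique dL (distinct-remove xs dK) (All.zipWith to (x≉ , is))
        (All.zipWith from (distinct-insert xs dK , Allₚ.++⁺ (Allₚ.++⁻ˡ xs ks) (All.tail (Allₚ.++⁻ʳ xs ks)))))) (C.sym (product-insert xs y ys))
    where
    to : ∀ {z} → (¬ (x ≈ z)) × Any (z ≈_) (xs ++ y ∷ ys) → Any (z ≈_) (xs ++ ys)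
    to (x≉z , j) with Anyₚ.++⁻ xs j
    ... | inj₁ j′         = Anyₚ.++⁺ˡ j′
    ... | inj₂ (here e)   = contradiction (C.trans x≈y (C.sym e)) x≉z
    ... | inj₂ (there j′) = Anyₚ.++⁺ʳ xs j′
    from : ∀ {z} → (¬ (y ≈ z)) × Any (z ≈_) (x ∷ L) → Any (z ≈_) L
    from (y≉z , here e)  = contradiction (C.sym (C.trans e x≈y)) y≉z
    from (y≉z , there j) = j

  nonzeros : List Carrier
  nonzeros = filter ≉0? elements

  enum-nonzeros : Enum _≈_ (λ x → ⊤ × ¬ (x ≈ 0#)) nonzeros
  enum-nonzeros = enum-filter C.isEquivalence ≉0? (λ e n z → n (C.trans e z)) enum-elements

  length-nonzeros : length nonzeros ≡ units
  length-nonzeros = trans (sym (∑-length nonzeros)) (trans (∑-filter ≉0? elements (λ _ → 1)) (∑-cong elements (λ x → *-identityʳ _)))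

  -- Multiplication by v permutes the nonzero elements, hence fixes their product.
  fermat : ∀ {v} → ¬ (v ≈ 0#) → pow v units ≈ 1#
  fermat {v} v≉0 = cancel-⊗ (product≉0 (Enum.member enum-nonzeros)) (C.trans (C.*-comm _ _)
    (C.trans (C.sym (scaled nonzeros)) (C.trans (product-unique (Enum.distinct E) (Enum.distinct enum-nonzeros)
      (All.map (λ q → Enum.covers enum-nonzeros _ q) (Enum.member E)) (All.map (λ q → Enum.covers E _ q) (Enum.member enum-nonzeros)))
      (C.sym (C.*-identityʳ _)))))
    where
    E : Enum _≈_ (λ x → ⊤ × ¬ (x ≈ 0#)) (map (v ⊗_) nonzeros)
    E = enum-map (v ⊗_) C.trans (λ (_ , n) → tt , x≉0⇒y≉0⇒xy≉0 v≉0 n) (λ _ _ → cancel-⊗ v≉0) (λ _ → C.*-congˡ)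
      (λ y (_ , n) → (inv v ⊗ y) , (tt , x≉0⇒y≉0⇒xy≉0 (inv≉0 v≉0) n) ,
        C.sym (C.trans (C.sym (C.*-assoc v (inv v) y)) (C.trans (C.*-congʳ (inv-inverseʳ v≉0)) (C.*-identityˡ y)))) enum-nonzeros
    product≉0 : ∀ {L} → All (λ x → ⊤ × ¬ (x ≈ 0#)) L → ¬ (product L ≈ 0#)
    product≉0 []             = 1≉0
    product≉0 ((_ , n) ∷ ns) = x≉0⇒y≉0⇒xy≉0 n (product≉0 ns)
    step : ∀ v x p q → ((v ⊗ x) ⊗ (p ⊗ q)) ≈ ((v ⊗ p) ⊗ (x ⊗ q))
    step = CS.solve 4 (λ v x p q → (v :* x) :* (p :* q) := (v :* p) :* (x :* q)) C.refl
    scaled′ : ∀ L → product (map (v ⊗_) L) ≈ (pow v (length L) ⊗ product L)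
    scaled′ []      = C.sym (C.*-identityˡ 1#)
    scaled′ (x ∷ L) = C.trans (C.*-congˡ (scaled′ L)) (step v x _ _)
    scaled : ∀ L → product (map (v ⊗_) nonzeros) ≈ (pow v units ⊗ product nonzeros)
    scaled _ = C.trans (scaled′ nonzeros) (C.*-congʳ (C.reflexive (cong (pow v) length-nonzeros)))

  roots-≤ : ∀ n {f} → Mon f n → ∀ {L} → Distinct L → All (λ x → evalP f x ≈ 0#) L → length L ≤ n
  roots-≤ n       m {[]}    _        _        = z≤n
  roots-≤ zero    m {x ∷ L} _        (r ∷ _)  = contradiction (C.trans (C.sym (C.trans (eval-cong x (mon-0 m)) (eval-const 1# x))) r) 1≉0
  roots-≤ (suc n) {f} m {x ∷ L} (d ∷ ds) (r ∷ rs) = s≤s (roots-≤ n mk ds (All.zipWith root (d , rs)))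
    where
    k = proj₁ (root⇒∣ f x r)
    e = proj₂ (root⇒∣ f x r)
    mk : Mon k n
    mk with mon-quotient {lin x} {f} {k} (mon-lin x) m (symP e)
    ... | _ , refl , mk = mk
    root : ∀ {y} → (¬ (x ≈ y)) × evalP f y ≈ 0# → evalP k y ≈ 0#
    root {y} (x≉y , z) with evalP k y ≈? 0#
    ... | yes w = w
    ... | no w  = contradiction (C.trans (C.sym (eval-* (lin x) k y)) (C.trans (C.sym (eval-cong y e)) z)) (x≉0⇒y≉0⇒xy≉0 (lin-nonroot x≉y) w)

  monomial : ℕ → Poly
  monomial zero    = oneP
  monomial (suc n) = 0# ∷ monomial n

  mon-monomial : ∀ n → Mon (monomial n) n
  mon-monomial zero    = mon-one
  mon-monomial (suc n) = mon-∷ 0# (mon-monomial n)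

  eval-monomial : ∀ n x → evalP (monomial n) x ≈ pow x n
  eval-monomial zero    x = eval-const 1# x
  eval-monomial (suc n) x = C.trans (C.+-identityˡ _) (C.*-congˡ (eval-monomial n x))

  roots-of-unity-≤ : ∀ n {L} → Distinct L → All (λ x → pow x (suc n) ≈ 1#) L → length L ≤ suc n
  roots-of-unity-≤ n d rs = roots-≤ (suc n) (mon-+const (⊖ 1#) (mon-monomial (suc n))) d
    (All.map (λ {x} r → C.trans (eval-+ (monomial (suc n)) [ ⊖ 1# ] x)
      (C.trans (C.+-cong (C.trans (eval-monomial (suc n) x) r) (eval-const (⊖ 1#) x)) (C.-‿inverseʳ 1#))) rs)

  fibre : ℕ → Carrier → ℕ
  fibre r v = ∑ elements (λ y → 𝟙 (pow y r ≈? v))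

  fibre-list : ℕ → Carrier → List Carrier
  fibre-list r v = filter (λ y → pow y r ≈? v) elements

  fibre-length : ∀ r v → fibre r v ≡ length (fibre-list r v)
  fibre-length r v = sym (trans (sym (∑-length (fibre-list r v))) (trans (∑-filter (λ y → pow y r ≈? v) elements (λ _ → 1)) (∑-cong elements (λ y → *-identityʳ _))))

  enum-fibre : ∀ r v → Enum _≈_ (λ y → ⊤ × pow y r ≈ v) (fibre-list r v)
  enum-fibre r v = enum-filter C.isEquivalence (λ y → pow y r ≈? v) (λ e e′ → C.trans (C.sym (pow-cong r e)) e′) enum-elements

  fibre-cong : ∀ r {v w} → v ≈ w → fibre r v ≡ fibre r w
  fibre-cong r {v} {w} e = ∑-cong elements (λ y → 𝟙-cong (pow y r ≈? v) (pow y r ≈? w) (λ e′ → C.trans e′ e) (λ e′ → C.trans e′ (C.sym e)))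

  fibre-zero : ∀ r {v} → v ≈ 0# → fibre (suc r) v ≡ 1
  fibre-zero r {v} v≈0 = trans (∑-cong elements (λ y → 𝟙-cong (pow y (suc r) ≈? v) (0# ≈? y)
      (λ e → C.sym (base (y ≈? 0#) (C.trans e v≈0))) (λ e → C.trans (pow-zero r (C.sym e)) (C.sym v≈0))))
    (∑-at C.isEquivalence enum-elements {0#} tt (λ _ → tt) (0# ≈?_))
    where
    base : ∀ {y} → Dec (y ≈ 0#) → pow y (suc r) ≈ 0# → y ≈ 0#
    base (yes z) _ = z
    base (no z)  e = contradiction e (pow≉0 (suc r) z)

  -- Multiplication by `y` carries the roots of unity onto the fibre: a nonempty fibre over a unit
  -- is one of their cosets.
  fibre-nonempty : ∀ r {v y} → ¬ (v ≈ 0#) → pow y (suc r) ≈ v → fibre (suc r) v ≡ fibre (suc r) 1#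
  fibre-nonempty r {v} {y} v≉0 e = trans (fibre-length (suc r) v) (trans (enum-length C.isEquivalence (enum-fibre (suc r) v) E)
      (trans (length-map (y ⊗_) (fibre-list (suc r) 1#)) (sym (fibre-length (suc r) 1#))))
    where
    y≉0 : ¬ (y ≈ 0#)
    y≉0 z = v≉0 (C.trans (C.sym e) (pow-zero r z))
    E : Enum _≈_ (λ z → ⊤ × pow z (suc r) ≈ v) (map (y ⊗_) (fibre-list (suc r) 1#))
    E = enum-map (y ⊗_) C.trans
      (λ {z} (_ , p) → tt , C.trans (pow-⊗ (suc r) y z) (C.trans (C.*-cong e p) (C.*-identityʳ v)))
      (λ _ _ → cancel-⊗ y≉0) (λ _ → C.*-congˡ)
      (λ z (_ , p) → (inv y ⊗ z) , (tt , cancel-⊗ {pow y (suc r)} (pow≉0 (suc r) y≉0)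
          (C.trans (C.sym (pow-⊗ (suc r) y (inv y ⊗ z))) (C.trans (pow-cong (suc r) (undo z)) (C.trans p (C.trans (C.sym e) (C.sym (C.*-identityʳ _))))))) ,
        C.sym (undo z))
      (enum-fibre (suc r) 1#)
      where
      undo : ∀ z → (y ⊗ (inv y ⊗ z)) ≈ z
      undo z = C.trans (C.sym (C.*-assoc y (inv y) z)) (C.trans (C.*-congʳ (inv-inverseʳ y≉0)) (C.*-identityˡ z))

  Power : ℕ → Carrier → Set (c ⊔ ℓ)
  Power r v = Any (λ y → pow y (suc r) ≈ v) elements

  power? : ∀ r v → Dec (Power r v)
  power? r v = Any.any? (λ y → pow y (suc r) ≈? v) elements

  fibre-nonpower : ∀ r {v} → ¬ Power r v → fibre (suc r) v ≡ 0
  fibre-nonpower r {v} n = ∑-zeroAll (All.map (λ {y} ne → 𝟙-no (pow y (suc r) ≈? v) ne) (Allₚ.¬Any⇒All¬ elements n))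

  fibre-power : ∀ r {v} → ¬ (v ≈ 0#) → Power r v → fibre (suc r) v ≡ fibre (suc r) 1#
  fibre-power r v≉0 p = let (y , e) = Any.satisfied p in fibre-nonempty r {y = y} v≉0 e

  powers : ℕ → ℕ
  powers r = ∑ elements (λ v → 𝟙 (≉0? v) * 𝟙 (power? r v))

  -- Both sides count the nonzero y, the left one according to the value of y^r.
  powers-fibre : ∀ r → powers r * fibre (suc r) 1# ≡ units
  powers-fibre r = begin
    powers r * fibre (suc r) 1#                                            ≡⟨ sym (∑-*ʳ elements _ _) ⟩
    ∑ elements (λ v → 𝟙 (≉0? v) * 𝟙 (power? r v) * fibre (suc r) 1#)        ≡⟨ ∑-cong elements pointwise ⟩
    ∑ elements (λ v → ∑ elements (λ y → 𝟙 (≉0? v) * 𝟙 (pow y (suc r) ≈? v))) ≡⟨ ∑-swap elements elements _ ⟩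
    ∑ elements (λ y → ∑ elements (λ v → 𝟙 (≉0? v) * 𝟙 (pow y (suc r) ≈? v))) ≡⟨ ∑-cong elements value ⟩
    units ∎
    where
    open ≡-Reasoning
    pointwise : ∀ v → 𝟙 (≉0? v) * 𝟙 (power? r v) * fibre (suc r) 1# ≡ ∑ elements (λ y → 𝟙 (≉0? v) * 𝟙 (pow y (suc r) ≈? v))
    pointwise v = trans (by (≉0? v) (power? r v)) (sym (∑-*ˡ elements (𝟙 (≉0? v)) (λ y → 𝟙 (pow y (suc r) ≈? v))))
      where
      by : (a : Dec (¬ (v ≈ 0#))) (b : Dec (Power r v)) → 𝟙 a * 𝟙 b * fibre (suc r) 1# ≡ 𝟙 a * fibre (suc r) v
      by (no _)  b       = refl
      by (yes n) (yes p) = cong (1 *_) (sym (fibre-power r n p))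
      by (yes n) (no p)  = sym (trans (+-identityʳ _) (fibre-nonpower r p))
    value : ∀ y → ∑ elements (λ v → 𝟙 (≉0? v) * 𝟙 (pow y (suc r) ≈? v)) ≡ 𝟙 (≉0? y)
    value y = trans (∑-cong elements swap) (trans (∑-*ˡ elements (𝟙 (≉0? y)) (λ v → 𝟙 (pow y (suc r) ≈? v)))
        (trans (cong (𝟙 (≉0? y) *_) (∑-at C.isEquivalence enum-elements {pow y (suc r)} tt (λ _ → tt) (pow y (suc r) ≈?_))) (*-identityʳ _)))
      where
      swap : ∀ v → 𝟙 (≉0? v) * 𝟙 (pow y (suc r) ≈? v) ≡ 𝟙 (≉0? y) * 𝟙 (pow y (suc r) ≈? v)
      swap v with pow y (suc r) ≈? v
      ... | yes e = cong (_* 1) (𝟙-cong (≉0? v) (≉0? y) (λ n z → n (C.trans (C.sym e) (pow-zero r z)))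
                      (λ n z → pow≉0 (suc r) n (C.trans e z)))
      ... | no _  = trans (*-zeroʳ (𝟙 (≉0? v))) (sym (*-zeroʳ (𝟙 (≉0? y))))

  suc-units : suc units ≡ card
  suc-units = trans (+-comm 1 units) (sym (trans (sym (∑-length elements)) (trans (∑-cong elements split) (trans (∑-+ elements _ _)
    (cong (units +_) (∑-at C.isEquivalence enum-elements {0#} tt (λ _ → tt) (0# ≈?_)))))))
    where
    split : ∀ x → 1 ≡ 𝟙 (≉0? x) + 𝟙 (0# ≈? x)
    split x with x ≈? 0#
    ... | yes e = sym (𝟙-yes (0# ≈? x) (C.sym e))
    ... | no n  = cong suc (sym (𝟙-no (0# ≈? x) (λ e → n (C.sym e))))

  units≢0 : ¬ (units ≡ 0)
  units≢0 z = empty enum-nonzeros (trans length-nonzeros z)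
    where
    empty : ∀ {L} → Enum _≈_ (λ x → ⊤ × ¬ (x ≈ 0#)) L → ¬ (length L ≡ 0)
    empty {[]} (enum _ _ cov) _ = case cov 1# (tt , 1≉0) of λ ()

  -- There are at most `suc g` roots of unity of this order, and at most `suc h` nonzero powers,
  -- since by `fermat` these are roots of X^(h+1) - 1. The two numbers multiply to (h + 1) (g + 1),
  -- so both bounds are attained; cyclicity of the unit group is not invoked.
  roots-of-unity-divisor : ∀ g h → suc h * suc g ≡ units → fibre (suc g) 1# ≡ suc g
  roots-of-unity-divisor g h eq = ≤-antisym
    (≤-trans (≤-reflexive (fibre-length (suc g) 1#)) (roots-of-unity-≤ g (Enum.distinct (enum-fibre (suc g) 1#)) (All.map proj₂ (Enum.member (enum-fibre (suc g) 1#)))))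
    (*-cancelˡ-≤ (suc h) (≤-trans (≤-reflexive (trans eq (sym (powers-fibre g)))) (*-monoˡ-≤ (fibre (suc g) 1#) powers-≤)))
    where
    image : List Carrier
    image = filter (λ v → ≉0? v ×-dec power? g v) elements
    powers-≤ : powers g ≤ suc h
    powers-≤ = ≤-trans (≤-reflexive (trans (∑-cong elements (λ v → trans (𝟙-× (≉0? v) (power? g v)) (sym (*-identityʳ _))))
        (trans (sym (∑-filter (λ v → ≉0? v ×-dec power? g v) elements (λ _ → 1))) (∑-length image))))
      (roots-of-unity-≤ h (AllPairsₚ.filter⁺ (λ v → ≉0? v ×-dec power? g v) elements-distinct)
        (All.map root (Allₚ.all-filter (λ v → ≉0? v ×-dec power? g v) elements)))
      where
      root : ∀ {v} → (¬ (v ≈ 0#)) × Power g v → pow v (suc h) ≈ 1#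
      root {v} (v≉0 , p) with Any.satisfied p
      ... | y , e = C.trans (pow-cong (suc h) (C.sym e)) (C.trans (C.sym (pow-* (suc h) (suc g) y))
              (C.trans (C.reflexive (cong (pow y) eq)) (fermat (λ z → v≉0 (C.trans (C.sym e) (pow-zero g z))))))

  -- Every unit has y^(q-1) = 1, so Bézout's identity turns y^m = 1 into y^gcd = 1, and the gcd is a
  -- divisor of q - 1 to which `roots-of-unity-divisor` applies.
  roots-of-unity : ∀ r → fibre (suc r) 1# ≡ gcd (suc r) units
  roots-of-unity r with gcd (suc r) units | gcd[m,n]∣m (suc r) units | gcd[m,n]∣n (suc r) units | Bézout.identity (gcd-GCD (suc r) units)
  ... | zero | divides a ea | _ | _ = contradiction (trans ea (*-zeroʳ a)) (λ ())
  ... | suc g | divides a ea | divides b eb | id = trans (∑-cong elements (λ y → 𝟙-cong (pow y (suc r) ≈? 1#) (pow y (suc g) ≈? 1#)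
        (to y id) (λ e → C.trans (C.reflexive (cong (pow y) ea)) (pow-*-1 a (suc g) y e)))) (divisor b eb)
    where
    divisor : ∀ b → units ≡ b * suc g → fibre (suc g) 1# ≡ suc g
    divisor zero    eb = contradiction eb units≢0
    divisor (suc h) eb = roots-of-unity-divisor g h (sym eb)
    cancelled : ∀ y {a b c} → a + b ≡ c → pow y b ≈ 1# → pow y c ≈ 1# → pow y a ≈ 1#
    cancelled y {a} {b} refl eb ec = C.trans (C.sym (C.*-identityʳ _)) (C.trans (C.*-congˡ (C.sym eb)) (C.trans (C.sym (pow-+ a b y)) ec))
    to : ∀ y → Bézout.Identity (suc g) (suc r) units → pow y (suc r) ≈ 1# → pow y (suc g) ≈ 1#
    to y id e = by id
      where
      order : pow y units ≈ 1#
      order = fermat (λ z → 1≉0 (C.trans (C.sym e) (pow-zero r z)))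
      by : Bézout.Identity (suc g) (suc r) units → pow y (suc g) ≈ 1#
      by (Bézout.+- x z eq) = cancelled y {suc g} {z * units} eq (pow-*-1 z units y order) (pow-*-1 x (suc r) y e)
      by (Bézout.-+ x z eq) = cancelled y {suc g} {x * suc r} eq (pow-*-1 x (suc r) y e) (pow-*-1 z units y order)

  points-on-curve : ℕ → Poly → ℕ
  points-on-curve m f = ∑ elements (λ x → fibre m (evalP f x))

  ≈²-equiv : IsEquivalence _≈²_
  ≈²-equiv = record { refl = C.refl , C.refl ; sym = λ (e , e′) → C.sym e , C.sym e′ ; trans = λ (e , e′) (d , d′) → C.trans e d , C.trans e′ d′ }

  curve : ℕ → Poly → List (Carrier × Carrier)
  curve m f = filter (λ (x , y) → pow y m ≈? evalP f x) (pairs elements (λ _ → elements))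

  enum-curve : ∀ m f → Enum _≈²_ (OnCurve m f) (curve m f)
  enum-curve m f = enum-⇔ (λ _ → proj₂) (λ _ e → (tt , tt) , e) (enum-filter {_~_ = _≈²_} ≈²-equiv (λ (x , y) → pow y m ≈? evalP f x)
    (λ { (e , e′) p → C.trans (C.sym (pow-cong m e′)) (C.trans p (eval-congʳ f e)) })
    (enum-pairs {_~_ = _≈_} {_≈_ = _≈_} enum-elements (λ _ _ → enum-elements) (λ _ _ _ → tt)))

  curve-length : ∀ m f → length (curve m f) ≡ points-on-curve m f
  curve-length m f = trans (sym (∑-length (curve m f))) (trans (∑-filter (λ (x , y) → pow y m ≈? evalP f x) (pairs elements (λ _ → elements)) (λ _ → 1))
    (trans (∑-pairs elements (λ _ → elements) _) (∑-cong elements (λ x → ∑-cong elements (λ y → *-identityʳ _)))))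

  pointCount⇒≡ : ∀ {m f k} → PointCount m f k → points-on-curve m f ≡ k
  pointCount⇒≡ {m} {f} (L , refl , mem , dis , cov) = trans (sym (curve-length m f)) (enum-length ≈²-equiv (enum-curve m f) (enum mem dis cov))

  ≡⇒pointCount : ∀ {m f k} → points-on-curve m f ≡ k → PointCount m f k
  ≡⇒pointCount {m} {f} refl = _ , curve-length m f , Enum.member (enum-curve m f) , Enum.distinct (enum-curve m f) , Enum.covers (enum-curve m f)

-- Explicit enumerations of the two families.

module Families {c ℓ : Level} (F : FiniteField c ℓ) (N : ℕ) (2≤N : 2 ≤ N) where

  open Polynomials F
  open Divisibility F
  open SquareFreePolynomials F
  open Interpolation F
  open Equidistribution F
  open PowerFibres F
  open WeightedPairs F N 2≤N
  open LocalWeights F N 2≤N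

  Triple : Set c
  Triple = ℕ × Poly × Poly

  _≈T_ : Triple → Triple → Set (c ⊔ ℓ)
  _≈T_ = Both _≡_ (Both _≈P_ _≈P_)

  IsPair : ℕ → Triple → Set (c ⊔ ℓ)
  IsPair d (j , h , g) = suc j ≤ suc d × SFMon j h × ∃ λ i → N * j + i ≡ d × SFMon i g

  pairList : ℕ → List Triple
  pairList d = pairs (upTo (suc d)) (λ j → pairs (SF j) (λ h → lag SF d (N * j)))

  enum-pairList : ∀ d → Enum _≈T_ (IsPair d) (pairList d)
  enum-pairList d = enum-pairs {_~_ = _≡_} {_≈_ = Both _≈P_ _≈P_} {P = λ j → suc j ≤ suc d} {Q = Q} {K = λ j → pairs (SF j) (λ h → lag SF d (N * j))}
    (enum-upTo (suc d)) inner (λ { _ refl q → q })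
    where
    Q : ℕ → Poly × Poly → Set (c ⊔ ℓ)
    Q j (h , g) = SFMon j h × ∃ λ i → N * j + i ≡ d × SFMon i g
    inner : ∀ j → suc j ≤ suc d → Enum (Both _≈P_ _≈P_) (Q j) (pairs (SF j) (λ h → lag SF d (N * j)))
    inner j _ = enum-pairs {_~_ = _≈P_} {_≈_ = _≈P_} {P = SFMon j} {Q = λ _ g → ∃ λ i → N * j + i ≡ d × SFMon i g}
      (enum-SF j) (λ _ _ → enum-lag enum-SF d (N * j)) (λ _ _ q → q)

  value : Triple → Poly
  value (j , h , g) = g *P (h *P h)

  value-mon : ∀ {d} p → IsPair d p → ∃ (Mon (value p))
  value-mon (j , h , g) (_ , (mh , _) , i , _ , mg , _) = _ , mon-* mg (mon-* mh mh)

  value-cong : ∀ p p′ → p ≈T p′ → value p ≈P value p′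
  value-cong (j , h , g) (j′ , h′ , g′) (_ , e , e′) = *P-cong e′ (*P-cong e e)

  value-injective : ∀ {d} p p′ → IsPair d p → IsPair d p′ → value p ≈P value p′ → p ≈T p′
  value-injective (j , h , g) (j′ , h′ , g′) (_ , (mh , _) , _ , _ , _ , sg) (_ , (mh′ , _) , _ , _ , _ , sg′) e =
    lead-unique {h′} 1≉0 1≉0 (lead-cong h≈ mh) mh′ , h≈ , proj₁ parts
    where
    parts : g ≈P g′ × h ≈P h′
    parts = square-part-unique {g} {g′} {h} {h′} sg sg′ mh mh′ e
    h≈ = proj₂ parts

  toPair : ∀ {d g h} → SquareFreePair N d g h → ∃ λ j → IsPair d (j , h , g)
  toPair {d} (sfPair {i} {j} sg sh deg) = j , s≤s (≤-trans (≤-trans (m≤n*m j N {{ℕ.>-nonZero (≤-trans (s≤s z≤n) 2≤N)}}) (m≤m+n (N * j) i)) (≤-reflexive deg)) , sh , i , deg , sg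

  fromPair : ∀ {d j g h} → IsPair d (j , h , g) → SquareFreePair N d g h
  fromPair (_ , sh , _ , deg , sg) = sfPair sg sh deg

  familyList : ℕ → List Poly
  familyList d = map value (pairList d)

  enum-family : ∀ d → Enum _≈P_ (InF N d) (familyList d)
  enum-family d = enum-map {_~_ = _≈T_} {_≈_ = _≈P_} {Q = IsPair d} {Q′ = InF N d} value transP
    (λ {p} → mem p) (λ {p} {p′} → value-injective p p′) (λ {p} {p′} _ → value-cong p p′) surj (enum-pairList d)
    where
    mem : ∀ p → IsPair d p → InF N d (value p)
    mem p@(j , h , g) ip = (_ , mon⇒monic (value p) (proj₂ (value-mon p ip))) ,
      pair⇒infhat {a = 1#} {g = g} {h = h} 1≉0 (fromPair ip) (symP (scale-1 (value p)))
    surj : ∀ f → InF N d f → ∃ λ p → IsPair d p × f ≈P value p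
    surj f ((n , mf) , hat) = go (infhat⇒pair hat)
      where
      go : PairDecomposition N d f → ∃ λ p → IsPair d p × f ≈P value p
      go (a , g , h , a≉0 , sp , e) = p , ip , transP e (transP (scale-cong a≈1 reflP) (scale-1 (value p)))
        where
        p = proj₁ (toPair sp) , h , g
        ip = proj₂ (toPair sp)
        -- Since g h² is monic, `a` is the leading coefficient of `f`, which is 1 for monic `f`.
        lead-a : HasLead f a (proj₁ (value-mon p ip))
        lead-a = lead-coef (C.*-identityʳ a) (lead-cong (symP e) (lead-scale a (proj₂ (value-mon p ip))))
        a≈1 : a ≈ 1#
        a≈1 with lead-unique {f} a≉0 1≉0 lead-a (monic⇒mon mf)
        ... | refl = C.trans (C.sym (HasLead.top lead-a)) (HasLead.top (monic⇒mon mf))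

  ∑-family : ∀ d ψ → ∑ (familyList d) ψ ≡ Pairs d 0 (λ g h → ψ (g *P (h *P h)))
  ∑-family d ψ = trans (∑-map value (pairList d) ψ) (trans (∑-pairs (upTo (suc d)) (λ j → pairs (SF j) (λ h → lag SF d (N * j))) (ψ ∘ value))
    (∑-cong (upTo (suc d)) (λ j → ∑-pairs (SF j) (λ h → lag SF d (N * j)) (λ (h , g) → ψ (g *P (h *P h))))))

  hatValue : Carrier × Triple → Poly
  hatValue (a , p) = scaleP a (value p)

  hatList : ℕ → List Poly
  hatList d = map hatValue (pairs nonzeros (λ _ → pairList d))

  enum-hat : ∀ d → Enum _≈P_ (InFhat N d) (hatList d)
  enum-hat d = enum-map {_~_ = Both _≈_ _≈T_} {_≈_ = _≈P_} {Q = Q} {Q′ = InFhat N d} hatValue transP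
    (λ {x} → mem x) (λ {x} {y} → inj x y) (λ {x} {y} _ → resp x y) surj
    (enum-pairs {_~_ = _≈_} {_≈_ = _≈T_} {P = λ a → ⊤ × ¬ (a ≈ 0#)} {Q = λ _ → IsPair d} enum-nonzeros (λ _ _ → enum-pairList d) (λ _ _ q → q))
    where
    Q : Carrier × Triple → Set (c ⊔ ℓ)
    Q (a , p) = (⊤ × ¬ (a ≈ 0#)) × IsPair d p
    mem : ∀ x → Q x → InFhat N d (hatValue x)
    mem (a , p@(j , h , g)) ((_ , a≉0) , ip) = pair⇒infhat {a = a} {g = g} {h = h} a≉0 (fromPair ip) reflP
    resp : ∀ x y → Both _≈_ _≈T_ x y → hatValue x ≈P hatValue y
    resp (a , p) (a′ , p′) (e , e′) = scale-cong e (value-cong p p′ e′)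
    inj : ∀ x y → Q x → Q y → hatValue x ≈P hatValue y → Both _≈_ _≈T_ x y
    inj (a , p) (a′ , p′) ((_ , a≉0) , ip) ((_ , a′≉0) , ip′) e = a≈a′ , value-injective p p′ ip ip′ v≈
      where
      la : HasLead (hatValue (a , p)) a (proj₁ (value-mon p ip))
      la = lead-coef (C.*-identityʳ a) (lead-scale a (proj₂ (value-mon p ip)))
      la′ : HasLead (hatValue (a , p)) a′ (proj₁ (value-mon p′ ip′))
      la′ = lead-coef (C.*-identityʳ a′) (lead-cong (symP e) (lead-scale a′ (proj₂ (value-mon p′ ip′))))
      a≈a′ : a ≈ a′
      a≈a′ = C.trans (C.sym (HasLead.top la)) (subst (λ n → coef (hatValue (a , p)) n ≈ a′) (sym (lead-unique {hatValue (a , p)} a≉0 a′≉0 la la′)) (HasLead.top la′))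
      v≈ : value p ≈P value p′
      v≈ = transP (symP (inv-scale (value p) a≉0)) (transP (scale-cong C.refl (transP e (scale-cong (C.sym a≈a′) reflP))) (inv-scale (value p′) a≉0))
    surj : ∀ f → InFhat N d f → ∃ λ x → Q x × f ≈P hatValue x
    surj f hat = go (infhat⇒pair hat)
      where
      go : PairDecomposition N d f → ∃ λ x → Q x × f ≈P hatValue x
      go (a , g , h , a≉0 , sp , e) = (a , proj₁ (toPair sp) , h , g) , ((tt , a≉0) , proj₂ (toPair sp)) , e

  ∑-hat : ∀ d ψ → ∑ (hatList d) ψ ≡ ∑ elements (λ a → 𝟙 (≉0? a) * Pairs d 0 (λ g h → ψ (scaleP a (g *P (h *P h)))))
  ∑-hat d ψ = trans (∑-map hatValue (pairs nonzeros (λ _ → pairList d)) ψ) (trans (∑-pairs nonzeros (λ _ → pairList d) (ψ ∘ hatValue))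
    (trans (∑-filter ≉0? elements (λ a → ∑ (pairList d) (λ p → ψ (hatValue (a , p)))))
    (∑-cong elements (λ a → cong (𝟙 (≉0? a) *_) (trans (sym (∑-map value (pairList d) (λ f → ψ (scaleP a f)))) (∑-family d (λ f → ψ (scaleP a f))))))))

  -- All functions from the points to the field, written as data.
  grid : List Carrier → List Data
  grid []       = [ [] ]
  grid (x ∷ xs) = concatMap (λ y → map ((x , y) ∷_) (grid xs)) elements

  ∑-grid-∷ : ∀ x xs φ → ∑ (grid (x ∷ xs)) φ ≡ ∑ elements (λ y → ∑ (grid xs) (λ I → φ ((x , y) ∷ I)))
  ∑-grid-∷ x xs φ = trans (∑-concatMap _ elements φ) (∑-cong elements (λ y → ∑-map ((x , y) ∷_) (grid xs) φ))

  grid-points : ∀ xs → All (λ I → points I ≡ xs) (grid xs)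
  grid-points []       = refl ∷ []
  grid-points (x ∷ xs) = Allₚ.concat⁺ (Allₚ.map⁺ (All.universal (λ y → Allₚ.map⁺ (All.map (cong (x ∷_)) (grid-points xs))) elements))

  -- The number of points as a statistic of the values of f.

  module Counts (r : ℕ) where

    m : ℕ
    m = suc r

    total : Data → ℕ
    total I = ∑ I (λ p → fibre m (proj₂ p))

    -- Up to equality in the field, `f` interpolates exactly one member of the grid, so any
    -- statistic of the point count is a combination of interpolation indicators. `θ` is arbitrary
    -- because the induction shifts it by the number of points above `x`; later it is `δ k` or the
    -- constant 1.
    grid-detect : ∀ f xs (θ : ℕ → ℕ) → θ (∑ xs (λ x → fibre m (evalP f x))) ≡ ∑ (grid xs) (λ I → θ (total I) * χ f I)
    grid-detect f []       θ = sym (trans (+-identityʳ _) (*-identityʳ (θ 0)))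
    grid-detect f (x ∷ xs) θ = sym (begin
      ∑ (grid (x ∷ xs)) (λ I → θ (total I) * χ f I)
        ≡⟨ ∑-grid-∷ x xs _ ⟩
      ∑ elements (λ y → ∑ (grid xs) (λ I → θ (fibre m y + total I) * χ f ((x , y) ∷ I)))
        ≡⟨ ∑-cong elements (λ y → trans (∑-cong (grid xs) (λ I → trans (cong (θ (fibre m y + total I) *_) (χ-insert f [] x y I)) (x∙yz≈y∙xz (θ (fibre m y + total I)) (𝟙 (evalP f x ≈? y)) (χ f I))))
             (trans (∑-*ˡ (grid xs) (𝟙 (evalP f x ≈? y)) _) (cong (𝟙 (evalP f x ≈? y) *_) (sym (grid-detect f xs (λ t → θ (fibre m y + t))))))) ⟩
      ∑ elements (λ y → 𝟙 (evalP f x ≈? y) * θ (fibre m y + rest))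
        ≡⟨ ∑-cong elements (λ y → same y (evalP f x ≈? y)) ⟩
      ∑ elements (λ y → 𝟙 (evalP f x ≈? y) * θ (fibre m (evalP f x) + rest))
        ≡⟨ ∑-*ʳ elements _ _ ⟩
      ∑ elements (λ y → 𝟙 (evalP f x ≈? y)) * θ (fibre m (evalP f x) + rest)
        ≡⟨ cong (_* θ (fibre m (evalP f x) + rest)) (∑-at C.isEquivalence enum-elements {evalP f x} tt (λ _ → tt) (evalP f x ≈?_)) ⟩
      1 * θ (fibre m (evalP f x) + rest)
        ≡⟨ *-identityˡ _ ⟩
      θ (fibre m (evalP f x) + rest) ∎)
      where
      open ≡-Reasoning
      rest = ∑ xs (λ x → fibre m (evalP f x))
      same : ∀ y (e : Dec (evalP f x ≈ y)) → 𝟙 e * θ (fibre m y + rest) ≡ 𝟙 e * θ (fibre m (evalP f x) + rest)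
      same y (yes e) = cong (λ n → 1 * θ (n + rest)) (fibre-cong m (C.sym e))
      same y (no _)  = refl

    -- The distribution of `probSum` with integer weights left unnormalised, and with one term for
    -- each field element in place of one for each value of the random variable.
    weighted : ℕ → ℕ → ℕ
    weighted zero    zero    = 1
    weighted zero    (suc k) = 0
    weighted (suc n) k       = ∑ elements (λ y → weight y * select (fibre m y) k (weighted n))

    δ : ℕ → ℕ → ℕ
    δ k t = 𝟙 (t ℕ.≟ k)

    δ-shift : ∀ v k t → δ k (v + t) ≡ select v k (λ k′ → δ k′ t)
    δ-shift zero    k       t = refl
    δ-shift (suc v) zero    t = refl
    δ-shift (suc v) (suc k) t = trans (𝟙-cong (suc v + t ℕ.≟ suc k) (v + t ℕ.≟ k) suc-injective (cong suc)) (trans (δ-shift v k t) (sym (≤ᵇ-suc v k)))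
      where
      ≤ᵇ-suc : ∀ v k → select (suc v) (suc k) (λ k′ → δ k′ t) ≡ select v k (λ k′ → δ k′ t)
      ≤ᵇ-suc zero    k = refl
      ≤ᵇ-suc (suc v) k = refl

    grid-δ : ∀ xs k → ∑ (grid xs) (λ I → δ k (total I) * W I) ≡ weighted (length xs) k
    grid-δ []       zero    = refl
    grid-δ []       (suc k) = refl
    grid-δ (x ∷ xs) k = trans (∑-grid-∷ x xs _) (∑-cong elements (λ y → trans
      (∑-cong (grid xs) (λ I → trans (cong (_* (weight y * W I)) (δ-shift (fibre m y) k (total I))) (x∙yz≈y∙xz (select (fibre m y) k (λ k′ → δ k′ (total I))) (weight y) (W I))))
      (trans (∑-*ˡ (grid xs) (weight y) (λ I → select (fibre m y) k (λ k′ → δ k′ (total I)) * W I)) (cong (weight y *_) (pull (fibre m y))))))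
      where
      pull : ∀ v → ∑ (grid xs) (λ I → select v k (λ k′ → δ k′ (total I)) * W I) ≡ select v k (weighted (length xs))
      pull v with v ≤ᵇ k
      ... | true  = grid-δ xs (k ∸ v)
      ... | false = ∑-zero (grid xs) (λ _ → refl)

    grid-weight : ∀ xs → ∑ (grid xs) (λ I → 1 * W I) ≡ ∑ elements weight ^ length xs
    grid-weight []       = refl
    grid-weight (x ∷ xs) = trans (∑-grid-∷ x xs _) (trans (∑-cong elements (λ y → trans (∑-cong (grid xs) (λ I → x∙yz≈y∙xz 1 (weight y) (W I)))
      (trans (∑-*ˡ (grid xs) (weight y) _) (cong (weight y *_) (grid-weight xs))))) (∑-*ʳ elements _ _))

    nonpowers : ℕ
    nonpowers = ∑ elements (λ v → 𝟙 (≉0? v) * 𝟙 (¬? (power? r v)))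

    powers+nonpowers : powers r + nonpowers ≡ units
    powers+nonpowers = trans (sym (∑-+ elements _ _)) (∑-cong elements (λ v → trans (sym (*-distribˡ-+ (𝟙 (≉0? v)) _ _))
      (trans (cong (𝟙 (≉0? v) *_) (complement (power? r v))) (*-identityʳ _))))
      where
      complement : ∀ {p} {X : Set p} (d : Dec X) → 𝟙 d + 𝟙 (¬? d) ≡ 1
      complement (yes _) = refl
      complement (no _)  = refl

    weight₀ weight₁ weightₘ : ℕ
    weight₀ = nonpowers * card ^ suc N
    weight₁ = units * (card ^ N + (card + 1))
    weightₘ = powers r * card ^ suc N

    -- Fibre size and weight are both constant on three classes: units that are not m-th powers,
    -- with empty fibre; zero, with one point; and units that are m-th powers, with as many points
    -- as there are m-th roots of unity.
    ∑-weight : ∀ (G : ℕ → ℕ) → ∑ elements (λ y → weight y * G (fibre m y)) ≡ weight₀ * G 0 + (weight₁ * G 1 + weightₘ * G (fibre m 1#))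
    ∑-weight G = trans (∑-cong elements split) (trans (∑-+ elements _ _) (cong₂ _+_ (out² (λ v → 𝟙 (≉0? v) * 𝟙 (¬? (power? r v))) (G 0))
      (trans (∑-+ elements _ _) (cong₂ _+_ zeros (out² (λ v → 𝟙 (≉0? v) * 𝟙 (power? r v)) (G (fibre m 1#)))))))
      where
      s = card ^ suc N
      out² : ∀ (f : Carrier → ℕ) x → ∑ elements (λ v → f v * (s * x)) ≡ ∑ elements f * s * x
      out² f x = trans (∑-*ʳ elements (s * x) f) (sym (*-assoc (∑ elements f) s x))
      zeros : ∑ elements (λ v → 𝟙 (0# ≈? v) * (weight₁ * G 1)) ≡ weight₁ * G 1
      zeros = trans (∑-*ʳ elements _ _) (trans (cong (_* (weight₁ * G 1)) (∑-at C.isEquivalence enum-elements {0#} tt (λ _ → tt) (0# ≈?_))) (*-identityˡ _))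
      mix : ℕ → ℕ → ℕ → ℕ → ℕ
      mix a b z p = a * b * (s * G 0) + (z * (weight₁ * G 1) + a * p * (s * G (fibre m 1#)))
      mix-cong : ∀ {a a′ b b′ z z′ p p′} → a ≡ a′ → b ≡ b′ → z ≡ z′ → p ≡ p′ → mix a b z p ≡ mix a′ b′ z′ p′
      mix-cong refl refl refl refl = refl
      split : ∀ y → weight y * G (fibre m y) ≡ mix (𝟙 (≉0? y)) (𝟙 (¬? (power? r y))) (𝟙 (0# ≈? y)) (𝟙 (power? r y))
      split y = by (y ≈? 0#) (power? r y)
        where
        by : Dec (y ≈ 0#) → Dec (Power r y) → weight y * G (fibre m y) ≡ mix (𝟙 (≉0? y)) (𝟙 (¬? (power? r y))) (𝟙 (0# ≈? y)) (𝟙 (power? r y))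
        by (yes e) _ = trans (cong₂ (λ w f → w * G f) (weight-zero e) (fibre-zero r e))
          (sym (trans (mix-cong (𝟙-no (≉0? y) (λ n → n e)) refl (𝟙-yes (0# ≈? y) (C.sym e)) refl) (trans (+-identityʳ _) (*-identityˡ _))))
        by (no n) (yes p) = trans (cong₂ (λ w f → w * G f) (weight-unit n) (fibre-power r n p))
          (sym (trans (mix-cong (𝟙-yes (≉0? y) n) (𝟙-no (¬? (power? r y)) (λ k → k p)) (𝟙-no (0# ≈? y) (λ e → n (C.sym e))) (𝟙-yes (power? r y) p)) (*-identityˡ _)))
        by (no n) (no p) = trans (cong₂ (λ w f → w * G f) (weight-unit n) (fibre-nonpower r p))
          (sym (trans (mix-cong (𝟙-yes (≉0? y) n) (𝟙-yes (¬? (power? r y)) p) (𝟙-no (0# ≈? y) (λ e → n (C.sym e))) (𝟙-no (power? r y) p)) (trans (+-identityʳ _) (*-identityˡ _))))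

    weighted-suc : ∀ n k → weighted (suc n) k ≡
      weight₀ * weighted n k + (weight₁ * select 1 k (weighted n) + weightₘ * select (gcd m units) k (weighted n))
    weighted-suc n k = trans (∑-weight (λ v → select v k (weighted n))) (cong (λ v → weight₀ * weighted n k + (weight₁ * select 1 k (weighted n) + weightₘ * select v k (weighted n))) (roots-of-unity r))

    ∑-weight-total : ∑ elements weight ≡ weight₀ + (weight₁ + weightₘ)
    ∑-weight-total = trans (∑-cong elements (λ y → sym (*-identityʳ (weight y)))) (trans (∑-weight (λ _ → 1))
      (cong₂ _+_ (*-identityʳ weight₀) (cong₂ _+_ (*-identityʳ weight₁) (*-identityʳ weightₘ))))

    V-points : ∀ I → V I ≡ (card ^ suc N) ^ length (points I)
    V-points []      = refl
    V-points (p ∷ I) = cong (card ^ suc N *_) (V-points I)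

    ones : Data
    ones = map (_, 1#) elements

    covers-ones : Covers ones
    covers-ones = trans (sym (map-∘ elements)) (map-id elements)

    units-ones : Units ones
    units-ones = Allₚ.map⁺ (All.universal (λ _ → 1≉0) elements)

    data-asymptotic : ∀ I → Covers I → Sim card (λ d → V I * A d 0 I) (λ d → W I * A d 0 ones)
    data-asymptotic I cov = sim-cong (λ d → *-identityˡ (V I * A d 0 I)) (λ _ → refl)
      (asymptotic covers-ones units-ones (length I) I refl [] 0 [] cov)

    -- The family splits into the parts with prescribed values I, whose densities are proportional to the product weight W.
    record Governed (μ : ℕ) (count : (ℕ → ℕ) → ℕ → ℕ) : Set c where
      field
        local     : Data → ℕ → ℕ
        expansion : ∀ θ d → count θ d ≡ ∑ (grid elements) (λ I → θ (total I) * local I d)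
        -- `μ` is the number of admissible leading coefficients: 1 for the monic family and q - 1
        -- for the full one.
        limit     : ∀ I → Covers I → Sim card (λ d → V I * local I d) (λ d → W I * (μ * A d 0 ones))

    governed-limit : ∀ {μ count} → Governed μ count → ∀ θ →
      Sim card (λ d → (card ^ suc N) ^ card * count θ d) (λ d → ∑ (grid elements) (λ I → θ (total I) * W I) * (μ * A d 0 ones))
    governed-limit {μ} {count} gov θ = sim-cong left right (sim-∑ {a = a} {b = b} (All.map term (grid-points elements)))
      where
      open Governed gov
      a b : Data → ℕ → ℕ
      a I d = θ (total I) * ((card ^ suc N) ^ card * local I d)
      b I d = θ (total I) * (W I * (μ * A d 0 ones))
      term : ∀ {I} → points I ≡ elements → Sim card (a I) (b I)
      term {I} cov = sim-*ˡ (θ (total I)) (sim-cong (λ d → cong (_* local I d) (trans (V-points I) (cong (λ xs → (card ^ suc N) ^ length xs) cov))) (λ _ → refl) (limit I cov))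
      left : ∀ d → ∑ (grid elements) (λ I → a I d) ≡ (card ^ suc N) ^ card * count θ d
      left d = trans (∑-cong (grid elements) (λ I → x∙yz≈y∙xz (θ (total I)) ((card ^ suc N) ^ card) (local I d))) (trans (∑-*ˡ (grid elements) ((card ^ suc N) ^ card) (λ I → θ (total I) * local I d)) (cong ((card ^ suc N) ^ card *_) (sym (expansion θ d))))
      right : ∀ d → ∑ (grid elements) (λ I → b I d) ≡ ∑ (grid elements) (λ I → θ (total I) * W I) * (μ * A d 0 ones)
      right d = trans (∑-cong (grid elements) (λ I → sym (*-assoc (θ (total I)) (W I) _))) (∑-*ʳ (grid elements) _ _)

    -- The count of curves with k points and the total count are proportional to the same
    -- `A d 0 ones`; cross-multiplication eliminates it, so its size is irrelevant here.
    governed-ratio : ∀ {μ count} → Governed μ count → ∀ k →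
      Sim card (λ d → ∑ elements weight ^ card * count (δ k) d) (λ d → weighted card k * count (λ _ → 1) d)
    governed-ratio {μ} {count} gov k = sim-cancel-* V₀ {{m^n≢0 (card ^ suc N) card {{m^n≢0 card (suc N)}}}} (sim-trans {b = λ d → Z * (P * (μ * A d 0 ones))}
      (sim-cong (λ d → x∙yz≈y∙xz Z V₀ (count (δ k) d)) (λ d → cong (λ p → Z * (p * (μ * A d 0 ones))) (grid-δ elements k)) (sim-*ˡ Z (governed-limit gov (δ k))))
      (sim-sym (sim-cong (λ d → x∙yz≈y∙xz P V₀ (count (λ _ → 1) d)) (λ d → trans (cong (λ p → P * (p * (μ * A d 0 ones))) (grid-weight elements)) (x∙yz≈y∙xz P Z _)) (sim-*ˡ P (governed-limit gov (λ _ → 1))))))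
      where
      V₀ = (card ^ suc N) ^ card
      Z = ∑ elements weight ^ card
      P = weighted card k

    count : (ℕ → List Poly) → (ℕ → ℕ) → ℕ → ℕ
    count L θ d = ∑ (L d) (λ f → θ (points-on-curve m f))

    family-governed : Governed 1 (count familyList)
    family-governed = record
      { local = λ I d → A d 0 I
      ; expansion = λ θ d → trans (∑-family d _) (trans (pairs-cong d 0 (λ g h → grid-detect (g *P (h *P h)) elements θ))
          (trans (pairs-∑ d 0 (grid elements) (λ I g h → θ (total I) * χ (g *P (h *P h)) I))
          (∑-cong (grid elements) (λ I → pairs-*ˡ d 0 (θ (total I)) (λ g h → χ (g *P (h *P h)) I)))))
      ; limit = λ I cov → sim-cong (λ _ → refl) (λ d → cong (W I *_) (sym (*-identityˡ (A d 0 ones)))) (data-asymptotic I cov) }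

    -- A leading coefficient `a` changes the data `I` into `I ⊘ [ a ]` for the monic part. The zeros
    -- stay in place, hence so does the weight, and each of the q - 1 coefficients contributes the
    -- same limit.
    hat-governed : Governed units (count hatList)
    hat-governed = record
      { local = local
      ; expansion = λ θ d → trans (∑-hat d _) (trans (∑-cong elements (λ a → expand θ d a (≉0? a)))
          (trans (∑-swap elements (grid elements) (λ a I → θ (total I) * (𝟙 (≉0? a) * A d 0 (I ⊘ [ a ]))))
          (∑-cong (grid elements) (λ I → ∑-*ˡ elements (θ (total I)) (λ a → 𝟙 (≉0? a) * A d 0 (I ⊘ [ a ]))))))
      ; limit = λ I cov → sim-cong (λ d → trans (∑-cong elements (λ a → x∙yz≈y∙xz (𝟙 (≉0? a)) (V I) _)) (∑-*ˡ elements (V I) (λ a → 𝟙 (≉0? a) * A d 0 (I ⊘ [ a ]))))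
          (λ d → trans (∑-*ʳ elements _ _) (x∙yz≈y∙xz units (W I) (A d 0 ones)))
          (sim-∑ {a = λ a d → 𝟙 (≉0? a) * (V I * A d 0 (I ⊘ [ a ]))} {b = λ a d → 𝟙 (≉0? a) * (W I * A d 0 ones)}
            (All.universal (λ a → sim-𝟙 (≉0? a) (λ n → sim-cong (λ d → cong (_* A d 0 (I ⊘ [ a ])) (V-⊘ I [ a ])) (λ d → cong (_* A d 0 ones) (W-⊘ I {[ a ]} (const-nonvanishing n (points I))))
               (data-asymptotic (I ⊘ [ a ]) (covers-⊘ {I} [ a ] cov)))) elements)) }
      where
      local : Data → ℕ → ℕ
      local I d = ∑ elements (λ a → 𝟙 (≉0? a) * A d 0 (I ⊘ [ a ]))
      const-nonvanishing : ∀ {a} → ¬ (a ≈ 0#) → ∀ xs → Nonvanishing [ a ] xs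
      const-nonvanishing {a} n xs = All.universal (λ x e → n (C.trans (C.sym (eval-const a x)) e)) xs
      expand : ∀ θ d a (a? : Dec (¬ (a ≈ 0#))) → 𝟙 a? * Pairs d 0 (λ g h → θ (points-on-curve m (scaleP a (g *P (h *P h)))))
               ≡ ∑ (grid elements) (λ I → θ (total I) * (𝟙 a? * A d 0 (I ⊘ [ a ])))
      expand θ d a (no _)  = sym (∑-zero (grid elements) (λ I → *-zeroʳ (θ (total I))))
      expand θ d a (yes n) = trans (*-identityˡ _) (trans (pairs-cong d 0 (λ g h → trans (grid-detect (scaleP a (g *P (h *P h))) elements θ)
          (∑-cong (grid elements) (λ I → cong (θ (total I) *_) (scale-χ (g *P (h *P h)) I)))))
        (trans (pairs-∑ d 0 (grid elements) (λ I g h → θ (total I) * χ (g *P (h *P h)) (I ⊘ [ a ])))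
          (∑-cong (grid elements) (λ I → trans (pairs-*ˡ d 0 (θ (total I)) (λ g h → χ (g *P (h *P h)) (I ⊘ [ a ]))) (cong (θ (total I) *_) (sym (*-identityˡ _)))))))
        where
        scale-χ : ∀ f I → χ (scaleP a f) I ≡ χ f (I ⊘ [ a ])
        scale-χ f I = trans (χ-cong I (transP (symP (const-* a f)) (*P-comm [ a ] f))) (χ-⊘ f [ a ] I (const-nonvanishing n (points I)))

  -- Sorting by square part gives q^(n+2) as the sum over j of q^j times the number of squarefree
  -- polynomials of degree n + 2 - 2 j; its terms with j ≥ 1 are q times the same sum for n.
  sqfree-count : ∀ n → card ^ (2 + n) ≡ length (SF (2 + n)) + card * card ^ n
  sqfree-count n = trans (squares (4 + n) (2 + n) (n≤1+n (3 + n))) (trans (∑-upTo-suc (3 + n) (H (2 + n)))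
    (cong₂ _+_ (*-identityˡ _) (trans (∑-cong (upTo (3 + n)) (λ j → trans (cong (λ k → card ^ suc j * length (lag SF (suc n) k)) (+-suc j j)) (*-assoc card (card ^ j) _)))
      (trans (∑-*ˡ (upTo (3 + n)) card (H n)) (cong (card *_) (sym (squares (3 + n) n (m≤n⇒m≤1+n (n≤1+n (suc n))))))))))
    where
    H : ℕ → ℕ → ℕ
    H n j = card ^ j * length (lag SF n (j + j))
    squares : ∀ D n → suc n ≤ D → card ^ n ≡ ∑ (upTo D) (H n)
    squares D n lt = trans (sym (trans (∑-length (M n)) (length-M n))) (trans (∑-square-parts D n lt {λ _ → 1} (λ _ → refl))
      (∑-cong (upTo D) (λ j → trans (∑-cong (M j) (λ t → ∑-length (lag SF n (j + j)))) (trans (∑-const (M j) _) (cong (_* length (lag SF n (j + j))) (length-M j))))))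

  -- The polynomials that are not squarefree number q^(n+1), at most half of q^(n+2).
  sqfree-many : ∀ n → card ^ (2 + n) ≤ 2 * length (SF (2 + n))
  sqfree-many n = +-cancelʳ-≤ (card ^ (2 + n)) _ _ (≤-trans (≤-reflexive (cong₂ _+_ (sqfree-count n) (sqfree-count n)))
    (≤-trans (≤-reflexive (eq (length (SF (2 + n))) (card * card ^ n))) (+-monoʳ-≤ (2 * length (SF (2 + n))) (*-monoˡ-≤ (card * card ^ n) 2≤card))))
    where
    eq : ∀ a b → (a + b) + (a + b) ≡ 2 * a + 2 * b
    eq = solve-∀

  family-≥ : ∀ d → length (SF d) ≤ Pairs d 0 (λ _ _ → 1)
  family-≥ d = ≤-trans (≤-trans (m≤n*m (length (SF d)) (length (SF 0)) {{ℕ.>-nonZero one}})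
      (≤-reflexive (trans (sym (∑-const (SF 0) (length (SF d)))) (∑-cong (SF 0) (λ h → trans (sym (∑-length (SF d))) (cong (λ k → ∑ (lag SF d k) (λ _ → 1)) (sym (*-zeroʳ N))))))))
    (≤-trans (m≤m+n (column 0) _) (≤-reflexive (sym (∑-upTo-suc d column))))
    where
    column : ℕ → ℕ
    column j = ∑ (SF j) (λ h → ∑ (lag SF d (0 + N * j)) (λ g → 1))
    one : 1 ≤ length (SF 0)
    one = nonempty (Enum.covers (enum-SF 0) oneP (mon-one , sqfree-oneP))
      where
      nonempty : ∀ {L} → Any (oneP ≈P_) L → 1 ≤ length L
      nonempty (here _)  = s≤s z≤n
      nonempty (there _) = s≤s z≤n

  -- The pairs with h = 1 alone have order q^d; this lower bound makes errors o(q^d) negligible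
  -- against the size of the family.
  family-many : ∀ d → 2 ≤ d → card ^ d ≤ 2 * length (familyList d)
  family-many (suc zero)    (s≤s ())
  family-many (suc (suc d)) _ = ≤-trans (sqfree-many d) (*-monoʳ-≤ 2 (≤-trans (family-≥ (2 + d)) (≤-reflexive (sym (trans (sym (∑-length (familyList (2 + d)))) (∑-family (2 + d) (λ _ → 1)))))))

  hat-many : ∀ d → 2 ≤ d → card ^ d ≤ 2 * length (hatList d)
  hat-many d 2≤d = ≤-trans (family-many d 2≤d) (*-monoʳ-≤ 2 (≤-trans (m≤n*m (length (familyList d)) units {{ℕ.≢-nonZero units≢0}})
    (≤-reflexive (sym (trans (sym (∑-length (hatList d))) (trans (∑-hat d (λ _ → 1)) (trans (∑-*ʳ elements _ _)
      (cong (units *_) (trans (sym (∑-family d (λ _ → 1))) (∑-length (familyList d)))))))))))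

-- Passage from integer estimates to rational probabilities.

module Rationals where

  open import Data.Rational.Unnormalised as ℚᵘ using (ℚᵘ; mkℚᵘ; *≡*; *≤*)
  import Data.Rational.Unnormalised.Properties as ℚᵘₚ
  import Data.Rational as ℚ
  open ℚ using (ℚ; 0ℚ; 1ℚ; mkℚ; toℚᵘ; fromℚᵘ)
  import Data.Rational.Properties as ℚₚ
  import Data.Integer.Properties as ℤₚ

  private
    module QR = CommutativeRing ℚₚ.+-*-commutativeRing
    module QP = RingProps QR.ring
    module QS = SemiringSolver QR.commutativeSemiring
    open QS using (_:+_; _:*_; _:=_)

  ι : ℕ → ℚ
  ι n = fromℚᵘ (mkℚᵘ (ℤ.+ n) 0)

  ratio : ℕ → ℕ → ℚ
  ratio a b = fromℚᵘ (mkℚᵘ (ℤ.+ a) b)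

  ratio-* : ∀ a b → ratio a b ℚ.* ι (suc b) ≡ ι a
  ratio-* a b = ℚₚ.toℚᵘ-injective (ℚᵘₚ.≃-trans (ℚₚ.toℚᵘ-homo-* (ratio a b) (ι (suc b)))
    (ℚᵘₚ.≃-trans (ℚᵘₚ.*-cong (ℚₚ.toℚᵘ-fromℚᵘ (mkℚᵘ (ℤ.+ a) b)) (ℚₚ.toℚᵘ-fromℚᵘ (mkℚᵘ (ℤ.+ suc b) 0)))
    (ℚᵘₚ.≃-trans (*≡* eq) (ℚᵘₚ.≃-sym (ℚₚ.toℚᵘ-fromℚᵘ (mkℚᵘ (ℤ.+ a) 0))))))
    where
    eq : (ℤ.+ a ℤ.* ℤ.+ suc b) ℤ.* ℤ.+ 1 ≡ ℤ.+ a ℤ.* ℤ.+ (suc b * 1)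
    eq = trans (ℤₚ.*-identityʳ _) (cong (λ n → ℤ.+ a ℤ.* ℤ.+ n) (sym (*-identityʳ (suc b))))

  ι-+ : ∀ m n → ι (m + n) ≡ ι m ℚ.+ ι n
  ι-+ m n = ℚₚ.toℚᵘ-injective (ℚᵘₚ.≃-trans (ℚₚ.toℚᵘ-fromℚᵘ (mkℚᵘ (ℤ.+ (m + n)) 0))
    (ℚᵘₚ.≃-trans (*≡* (cong (ℤ._* ℤ.+ 1) (sym (cong₂ ℤ._+_ (ℤₚ.*-identityʳ (ℤ.+ m)) (ℤₚ.*-identityʳ (ℤ.+ n))))))
    (ℚᵘₚ.≃-trans (ℚᵘₚ.+-cong (ℚᵘₚ.≃-sym (ℚₚ.toℚᵘ-fromℚᵘ (mkℚᵘ (ℤ.+ m) 0))) (ℚᵘₚ.≃-sym (ℚₚ.toℚᵘ-fromℚᵘ (mkℚᵘ (ℤ.+ n) 0))))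
      (ℚᵘₚ.≃-sym (ℚₚ.toℚᵘ-homo-+ (ι m) (ι n))))))

  ι-* : ∀ m n → ι (m * n) ≡ ι m ℚ.* ι n
  ι-* m n = ℚₚ.toℚᵘ-injective (ℚᵘₚ.≃-trans (ℚₚ.toℚᵘ-fromℚᵘ (mkℚᵘ (ℤ.+ (m * n)) 0))
    (ℚᵘₚ.≃-trans (*≡* (cong (ℤ._* ℤ.+ 1) (ℤₚ.pos-* m n)))
    (ℚᵘₚ.≃-trans (ℚᵘₚ.*-cong (ℚᵘₚ.≃-sym (ℚₚ.toℚᵘ-fromℚᵘ (mkℚᵘ (ℤ.+ m) 0))) (ℚᵘₚ.≃-sym (ℚₚ.toℚᵘ-fromℚᵘ (mkℚᵘ (ℤ.+ n) 0))))
      (ℚᵘₚ.≃-sym (ℚₚ.toℚᵘ-homo-* (ι m) (ι n))))))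

  ι-mono : ∀ {m n} → m ≤ n → ι m ℚ.≤ ι n
  ι-mono {m} {n} le = ℚₚ.toℚᵘ-cancel-≤ (ℚᵘₚ.≤-respˡ-≃ (ℚᵘₚ.≃-sym (ℚₚ.toℚᵘ-fromℚᵘ (mkℚᵘ (ℤ.+ m) 0)))
    (ℚᵘₚ.≤-respʳ-≃ (ℚᵘₚ.≃-sym (ℚₚ.toℚᵘ-fromℚᵘ (mkℚᵘ (ℤ.+ n) 0))) (*≤* (ℤₚ.*-monoʳ-≤-nonNeg (ℤ.+ 1) (ℤ.+≤+ le)))))

  ι-cancel : ∀ {m n} → ι m ℚ.≤ ι n → m ≤ n
  ι-cancel {m} {n} le with ℚᵘₚ.≤-respˡ-≃ (ℚₚ.toℚᵘ-fromℚᵘ (mkℚᵘ (ℤ.+ m) 0)) (ℚᵘₚ.≤-respʳ-≃ (ℚₚ.toℚᵘ-fromℚᵘ (mkℚᵘ (ℤ.+ n) 0)) (ℚₚ.toℚᵘ-mono-≤ le))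
  ... | *≤* le′ = ℤₚ.drop‿+≤+ (ℤₚ.*-cancelʳ-≤-pos (ℤ.+ m) (ℤ.+ n) (ℤ.+ 1) le′)

  ι-nonneg : ∀ n → 0ℚ ℚ.≤ ι n
  ι-nonneg n = ι-mono {0} {n} z≤n

  ι-monoʳ : ∀ {x y} n → x ℚ.≤ y → x ℚ.* ι n ℚ.≤ y ℚ.* ι n
  ι-monoʳ n le = ℚₚ.*-monoʳ-≤-nonNeg (ι n) {{ℚ.nonNegative (ι-nonneg n)}} le

  -- `c` is three times the denominator of `ε`. The 3 leaves a strict margin over the factor 2 by
  -- which q^d may exceed the size of a family.
  archimedean : ∀ ε → 0ℚ ℚ.< ε → ∃ λ c → ι 3 ℚ.≤ ε ℚ.* ι c
  archimedean ε@(mkℚ (ℤ.+ suc n) d _) _ = 3 * suc d , subst (ι 3 ℚ.≤_) (sym eq) (ι-mono {3} {3 * suc n} (*-monoʳ-≤ 3 (s≤s z≤n)))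
    where
    eq : ε ℚ.* ι (3 * suc d) ≡ ι (3 * suc n)
    eq = trans (cong (ε ℚ.*_) (ι-* 3 (suc d))) (trans (QS.solve 3 (λ e a b → e :* (a :* b) := a :* (e :* b)) refl ε (ι 3) (ι (suc d)))
      (trans (cong (λ x → ι 3 ℚ.* (x ℚ.* ι (suc d))) (sym (ℚₚ.↥p/↧p≡p ε))) (trans (cong (ι 3 ℚ.*_) (ratio-* (suc n) d)) (sym (ι-* 3 (suc n))))))
  archimedean (mkℚ (ℤ.+ 0) d _) (ℚ.*<* lt) = contradiction (subst (ℤ._< ℤ.+ 0) (ℤₚ.*-zeroˡ (ℤ.+ suc d)) lt) (ℤₚ.<-irrefl refl)
  archimedean (mkℚ (ℤ.-[1+ n ]) d _) (ℚ.*<* lt) = contradiction lt λ ()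

  private
    move : ∀ {u v w} → u ℚ.≤ v ℚ.+ w → u ℚ.- v ℚ.≤ w
    move {u} {v} {w} p = subst (u ℚ.- v ℚ.≤_) (trans (cong (ℚ._- v) (ℚₚ.+-comm v w))
      (trans (ℚₚ.+-assoc w v (ℚ.- v)) (trans (cong (w ℚ.+_) (ℚₚ.+-inverseʳ v)) (ℚₚ.+-identityʳ w)))) (ℚₚ.+-monoˡ-≤ (ℚ.- v) p)

  ∣-∣-≤ : ∀ {u v w} → u ℚ.≤ v ℚ.+ w → v ℚ.≤ u ℚ.+ w → ℚ.∣ u ℚ.- v ∣ ℚ.≤ w
  ∣-∣-≤ {u} {v} {w} p q with ℚₚ.∣p∣≡p∨∣p∣≡-p (u ℚ.- v)
  ... | inj₁ e = subst (ℚ._≤ w) (sym e) (move p)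
  ... | inj₂ e = subst (ℚ._≤ w) (sym (trans e negated)) (move q)
    where
    negated : ℚ.- (u ℚ.- v) ≡ v ℚ.- u
    negated = trans (ℚₚ.neg-distrib-+ u (ℚ.- v)) (trans (cong ((ℚ.- u) ℚ.+_) (QP.-‿involutive v)) (ℚₚ.+-comm (ℚ.- u) v))

  *-distribʳ-- : ∀ z x y → (x ℚ.- y) ℚ.* z ≡ x ℚ.* z ℚ.- y ℚ.* z
  *-distribʳ-- z x y = trans (ℚₚ.*-distribʳ-+ z x (ℚ.- y)) (cong (x ℚ.* z ℚ.+_) (sym (ℚₚ.neg-distribˡ-* y z)))

  -- Scaled by S = B c Q with B = b + 1, the difference is at most 2 B, whereas ε S is at least 3 B
  -- Q ≥ 3 B; so the difference cannot reach `ε`.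
  ratio-close : ∀ {A b P Q c p ε} → 1 ≤ Q → p ℚ.* ι Q ≡ ι P → ι 3 ℚ.≤ ε ℚ.* ι c →
    Near (c * (Q * A)) (c * (P * suc b)) (2 * suc b) → ℚ.∣ ratio A b ℚ.- p ∣ ℚ.< ε
  ratio-close {A} {b} {P} {Q} {c} {p} {ε} 1≤Q pQ≡P 3≤εc (near₁ , near₂) = ℚₚ.≰⇒> λ ε≤y →
    absurd (*-cancelʳ-≤ 3 2 B (≤-trans (*-monoʳ-≤ 3 (≤-trans (≤-reflexive (sym (*-identityʳ B))) (*-monoʳ-≤ B 1≤Q))) (ι-cancel (chain ε≤y))))
    where
    B = suc b
    S = B * (c * Q)
    x = ratio A b
    absurd : ∀ {X : Set} → 3 ≤ 2 → X
    absurd (s≤s (s≤s ()))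
    ιS : ι S ≡ ι B ℚ.* (ι c ℚ.* ι Q)
    ιS = trans (ι-* B (c * Q)) (cong (ι B ℚ.*_) (ι-* c Q))
    xS : x ℚ.* ι S ≡ ι (c * (Q * A))
    xS = trans (cong (x ℚ.*_) ιS) (trans (QS.solve 4 (λ x B c Q → x :* (B :* (c :* Q)) := c :* (Q :* (x :* B))) refl x (ι B) (ι c) (ι Q))
      (trans (cong (λ a → ι c ℚ.* (ι Q ℚ.* a)) (ratio-* A b)) (sym (trans (ι-* c (Q * A)) (cong (ι c ℚ.*_) (ι-* Q A))))))
    pS : p ℚ.* ι S ≡ ι (c * (P * B))
    pS = trans (cong (p ℚ.*_) ιS) (trans (QS.solve 4 (λ p B c Q → p :* (B :* (c :* Q)) := c :* ((p :* Q) :* B)) refl p (ι B) (ι c) (ι Q))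
      (trans (cong (λ a → ι c ℚ.* (a ℚ.* ι B)) pQ≡P) (sym (trans (ι-* c (P * B)) (cong (ι c ℚ.*_) (ι-* P B))))))
    upper : ℚ.∣ x ℚ.- p ∣ ℚ.* ι S ℚ.≤ ι (2 * B)
    upper = subst (ℚ._≤ ι (2 * B)) (sym (trans (cong (ℚ.∣ x ℚ.- p ∣ ℚ.*_) (sym (ℚₚ.0≤p⇒∣p∣≡p (ι-nonneg S))))
        (trans (sym (ℚₚ.∣p*q∣≡∣p∣*∣q∣ (x ℚ.- p) (ι S))) (cong ℚ.∣_∣ (trans (*-distribʳ-- (ι S) x p) (cong₂ ℚ._-_ xS pS))))))
      (∣-∣-≤ (subst (ι (c * (Q * A)) ℚ.≤_) (ι-+ (c * (P * B)) (2 * B)) (ι-mono near₁))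
             (subst (ι (c * (P * B)) ℚ.≤_) (ι-+ (c * (Q * A)) (2 * B)) (ι-mono near₂)))
    lower : ι (3 * (B * Q)) ℚ.≤ ε ℚ.* ι S
    lower = subst (ℚ._≤ ε ℚ.* ι S) (sym (ι-* 3 (B * Q))) (subst (ι 3 ℚ.* ι (B * Q) ℚ.≤_)
      (trans (cong (ε ℚ.* ι c ℚ.*_) (ι-* B Q)) (trans (QS.solve 4 (λ e c B Q → (e :* c) :* (B :* Q) := e :* (B :* (c :* Q))) refl ε (ι c) (ι B) (ι Q)) (cong (ε ℚ.*_) (sym ιS))))
      (ι-monoʳ (B * Q) 3≤εc))
    chain : ε ℚ.≤ ℚ.∣ x ℚ.- p ∣ → ι (3 * (B * Q)) ℚ.≤ ι (2 * B)
    chain le = ℚₚ.≤-trans lower (ℚₚ.≤-trans (ι-monoʳ S le) upper)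

  recipℕ-inverse : ∀ n .{{_ : NonZero n}} → recipℕ n ℚ.* ι n ≡ 1ℚ
  recipℕ-inverse (suc n) = ratio-* 1 n

  recipℚ-inverse : ∀ {p} → ¬ (p ≡ 0ℚ) → recipℚ p ℚ.* p ≡ 1ℚ
  recipℚ-inverse {p} p≢0 with p ℚ.≟ 0ℚ
  ... | yes e = contradiction e p≢0
  ... | no n  = ℚₚ.*-inverseˡ p {{ℚ.≢-nonZero n}}

  module _ {w₀ w₁ w g Z : ℕ} {p₀ p₁ p : ℚ} (R : ℕ → ℕ → ℕ)
           (e₀ : p₀ ℚ.* ι Z ≡ ι w₀) (e₁ : p₁ ℚ.* ι Z ≡ ι w₁) (e : p ℚ.* ι Z ≡ ι w)
           (R-zero : R 0 0 ≡ 1) (R-zero-suc : ∀ k → R 0 (suc k) ≡ 0)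
           (R-suc : ∀ n k → R (suc n) k ≡ w₀ * R n k + (w₁ * select 1 k (R n) + w * select g k (R n))) where

    -- One factor `Z` per summand clears the denominators and turns the convolution recursion of
    -- `probSum` into that of `R`. When g = 1 the last two entries of the law share the value 1 and
    -- their terms add, as the convention asks.
    probSum-weighted : ∀ n k → probSum ((0 , p₀) ∷ (1 , p₁) ∷ (g , p) ∷ []) n k ℚ.* ι (Z ^ n) ≡ ι (R n k)
    probSum-weighted zero    zero    = cong ι (sym R-zero)
    probSum-weighted zero    (suc k) = cong ι (sym (R-zero-suc k))
    probSum-weighted (suc n) k       = begin
      (t 0 p₀ ℚ.+ (t 1 p₁ ℚ.+ (t g p ℚ.+ 0ℚ))) ℚ.* z
        ≡⟨ QS.solve 4 (λ a b c z → (a :+ (b :+ (c :+ QS.con 0))) :* z := a :* z :+ (b :* z :+ c :* z)) refl (t 0 p₀) (t 1 p₁) (t g p) z ⟩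
      t 0 p₀ ℚ.* z ℚ.+ (t 1 p₁ ℚ.* z ℚ.+ t g p ℚ.* z)
        ≡⟨ cong₂ ℚ._+_ (term 0 {p₀} {w₀} e₀) (cong₂ ℚ._+_ (term 1 {p₁} {w₁} e₁) (term g {p} {w} e)) ⟩
      ι (w₀ * R n k) ℚ.+ (ι (w₁ * select 1 k (R n)) ℚ.+ ι (w * select g k (R n)))
        ≡⟨ sym (trans (ι-+ (w₀ * R n k) (w₁ * select 1 k (R n) + w * select g k (R n))) (cong (ι (w₀ * R n k) ℚ.+_) (ι-+ (w₁ * select 1 k (R n)) (w * select g k (R n))))) ⟩
      ι (w₀ * R n k + (w₁ * select 1 k (R n) + w * select g k (R n)))
        ≡⟨ cong ι (sym (R-suc n k)) ⟩
      ι (R (suc n) k) ∎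
      where
      open ≡-Reasoning
      D = (0 , p₀) ∷ (1 , p₁) ∷ (g , p) ∷ []
      z = ι (Z ^ suc n)
      t : ℕ → ℚ → ℚ
      t v p = if v ≤ᵇ k then p ℚ.* probSum D n (k ∸ v) else 0ℚ
      term : ∀ v {p w} → p ℚ.* ι Z ≡ ι w → t v p ℚ.* z ≡ ι (w * select v k (R n))
      term v {p} {w} e with v ≤ᵇ k
      ... | true  = trans (cong (p ℚ.* probSum D n (k ∸ v) ℚ.*_) (ι-* Z (Z ^ n)))
              (trans (QS.solve 4 (λ p s a b → (p :* s) :* (a :* b) := (p :* a) :* (s :* b)) refl p (probSum D n (k ∸ v)) (ι Z) (ι (Z ^ n)))
              (trans (cong₂ ℚ._*_ e (probSum-weighted n (k ∸ v))) (sym (ι-* w (R n (k ∸ v))))))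
      ... | false = trans (ℚₚ.*-zeroˡ z) (cong ι (sym (*-zeroʳ w)))

  -- The weights of the three values of one summand are u q^(N+1) (1 + q⁻¹ + q⁻ᴺ + q⁻⁽ᴺ⁺¹⁾) times its probabilities.
  module Law (q N u g a b : ℕ) .{{_ : NonZero q}} .{{_ : NonZero g}} (u≡ : a * g ≡ u) (a+b : a + b ≡ u) where

    s = q ^ suc N
    w₀ = b * s
    w₁ = u * (q ^ N + (q + 1))
    w  = a * s
    Z  = w₀ + (w₁ + w)

    r₁ r₂ r₃ ζ : ℚ
    r₁ = recipℕ (q ^ 1)
    r₂ = recipℕ (q ^ N)
    r₃ = recipℕ (q ^ suc N)
    ζ  = 1ℚ ℚ.+ r₁ ℚ.+ r₂ ℚ.+ r₃

    private
      ιs : ι s ≡ ι q ℚ.* ι (q ^ N)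
      ιs = ι-* q (q ^ N)

      q-r₁ : r₁ ℚ.* ι q ≡ 1ℚ
      q-r₁ = trans (cong (λ n → r₁ ℚ.* ι n) (sym (*-identityʳ q))) (recipℕ-inverse (q ^ 1) {{m^n≢0 q 1}})

      q-r₂ : r₂ ℚ.* ι (q ^ N) ≡ 1ℚ
      q-r₂ = recipℕ-inverse (q ^ N) {{m^n≢0 q N}}

      q-r₃ : r₃ ℚ.* ι s ≡ 1ℚ
      q-r₃ = recipℕ-inverse s {{m^n≢0 q (suc N)}}

      tail : (r₁ ℚ.+ r₂ ℚ.+ r₃) ℚ.* ι s ≡ ι (q ^ N + (q + 1))
      tail = begin
        (r₁ ℚ.+ r₂ ℚ.+ r₃) ℚ.* ι s
          ≡⟨ QS.solve 4 (λ a b c s → (a :+ b :+ c) :* s := a :* s :+ b :* s :+ c :* s) refl r₁ r₂ r₃ (ι s) ⟩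
        r₁ ℚ.* ι s ℚ.+ r₂ ℚ.* ι s ℚ.+ r₃ ℚ.* ι s
          ≡⟨ cong₂ ℚ._+_ (cong₂ ℚ._+_ (cong (r₁ ℚ.*_) ιs) (cong (r₂ ℚ.*_) ιs)) q-r₃ ⟩
        r₁ ℚ.* (ι q ℚ.* ι (q ^ N)) ℚ.+ r₂ ℚ.* (ι q ℚ.* ι (q ^ N)) ℚ.+ 1ℚ
          ≡⟨ QS.solve 5 (λ a b x y o → a :* (x :* y) :+ b :* (x :* y) :+ o := (a :* x) :* y :+ ((b :* y) :* x :+ o)) refl r₁ r₂ (ι q) (ι (q ^ N)) 1ℚ ⟩
        r₁ ℚ.* ι q ℚ.* ι (q ^ N) ℚ.+ (r₂ ℚ.* ι (q ^ N) ℚ.* ι q ℚ.+ 1ℚ)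
          ≡⟨ cong₂ (λ x y → x ℚ.* ι (q ^ N) ℚ.+ (y ℚ.* ι q ℚ.+ 1ℚ)) q-r₁ q-r₂ ⟩
        1ℚ ℚ.* ι (q ^ N) ℚ.+ (1ℚ ℚ.* ι q ℚ.+ 1ℚ)
          ≡⟨ cong₂ (λ x y → x ℚ.+ (y ℚ.+ 1ℚ)) (ℚₚ.*-identityˡ (ι (q ^ N))) (ℚₚ.*-identityˡ (ι q)) ⟩
        ι (q ^ N) ℚ.+ (ι q ℚ.+ ι 1)
          ≡⟨ sym (trans (ι-+ (q ^ N) (q + 1)) (cong (ι (q ^ N) ℚ.+_) (ι-+ q 1))) ⟩
        ι (q ^ N + (q + 1)) ∎
        where open ≡-Reasoning

      ζs : ζ ℚ.* ι s ≡ ι (s + (q ^ N + (q + 1)))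
      ζs = trans (QS.solve 5 (λ o a b c s → (o :+ a :+ b :+ c) :* s := o :* s :+ (a :+ b :+ c) :* s) refl 1ℚ r₁ r₂ r₃ (ι s))
        (trans (cong₂ ℚ._+_ (ℚₚ.*-identityˡ (ι s)) tail) (sym (ι-+ s (q ^ N + (q + 1)))))

      ζ≢0 : ¬ (ζ ≡ 0ℚ)
      ζ≢0 e = 1+n≰n {0} (≤-trans (≤-trans (m^n>0 q (suc N)) (m≤m+n s _)) (ι-cancel {s + (q ^ N + (q + 1))} {0}
        (ℚₚ.≤-reflexive (trans (sym ζs) (trans (cong (ℚ._* ι s) e) (ℚₚ.*-zeroˡ (ι s)))))))

      Z≡ : Z ≡ u * (s + (q ^ N + (q + 1)))
      Z≡ = trans (eq a b s (u * (q ^ N + (q + 1)))) (trans (cong (λ x → x * s + u * (q ^ N + (q + 1))) a+b) (sym (*-distribˡ-+ u s _)))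
        where
        eq : ∀ a b s t → b * s + (t + a * s) ≡ (a + b) * s + t
        eq = solve-∀

      -- Z = u s ζ, so `ι Z` cancels the reciprocal of ζ and leaves the integer u s.
      normalised : ∀ x → x ℚ.* recipℚ ζ ℚ.* ι Z ≡ x ℚ.* (ι u ℚ.* ι s)
      normalised x = trans (cong (x ℚ.* recipℚ ζ ℚ.*_) (trans (cong ι Z≡) (trans (ι-* u _) (cong (ι u ℚ.*_) (sym ζs)))))
        (trans (QS.solve 5 (λ x r u z s → (x :* r) :* (u :* (z :* s)) := (r :* z) :* (x :* (u :* s))) refl x (recipℚ ζ) (ι u) ζ (ι s))
        (trans (cong (ℚ._* (x ℚ.* (ι u ℚ.* ι s))) (recipℚ-inverse ζ≢0)) (ℚₚ.*-identityˡ _)))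

      g-u : recipℕ g ℚ.* ι u ≡ ι a
      g-u = trans (cong (recipℕ g ℚ.*_) (trans (cong ι (sym u≡)) (ι-* a g)))
        (trans (QS.solve 3 (λ r a g → r :* (a :* g) := (r :* g) :* a) refl (recipℕ g) (ι a) (ι g)) (trans (cong (ℚ._* ι a) (recipℕ-inverse g)) (ℚₚ.*-identityˡ _)))

    law₁ : (r₁ ℚ.+ r₂ ℚ.+ r₃) ℚ.* recipℚ ζ ℚ.* ι Z ≡ ι w₁
    law₁ = trans (normalised (r₁ ℚ.+ r₂ ℚ.+ r₃)) (trans (QS.solve 3 (λ x u s → x :* (u :* s) := u :* (x :* s)) refl (r₁ ℚ.+ r₂ ℚ.+ r₃) (ι u) (ι s))
      (trans (cong (ι u ℚ.*_) tail) (sym (ι-* u (q ^ N + (q + 1))))))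

    lawₘ : recipℕ g ℚ.* recipℚ ζ ℚ.* ι Z ≡ ι w
    lawₘ = trans (normalised (recipℕ g)) (trans (sym (ℚₚ.*-assoc (recipℕ g) (ι u) (ι s))) (trans (cong (ℚ._* ι s) g-u) (sym (ι-* a s))))

    law₀ : (1ℚ ℚ.- recipℕ g) ℚ.* recipℚ ζ ℚ.* ι Z ≡ ι w₀
    law₀ = trans (normalised (1ℚ ℚ.- recipℕ g)) (trans (sym (ℚₚ.*-assoc (1ℚ ℚ.- recipℕ g) (ι u) (ι s))) (trans (cong (ℚ._* ι s) rest) (sym (ι-* b s))))
      where
      rest : (1ℚ ℚ.- recipℕ g) ℚ.* ι u ≡ ι b
      rest = trans (*-distribʳ-- (ι u) 1ℚ (recipℕ g)) (trans (cong₂ ℚ._-_ (trans (ℚₚ.*-identityˡ (ι u)) (trans (cong ι (trans (sym a+b) (+-comm a b))) (ι-+ b a))) g-u)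
        (trans (ℚₚ.+-assoc (ι b) (ι a) (ℚ.- ι a)) (trans (cong (ι b ℚ.+_) (ℚₚ.+-inverseʳ (ι a))) (ℚₚ.+-identityʳ (ι b)))))

-- The limits for the monic and the full family.

module Limits {c ℓ : Level} (F : FiniteField c ℓ) (N : ℕ) (2≤N : 2 ≤ N) (r : ℕ) where

  import Data.Rational as ℚ
  open ℚ using (ℚ; 0ℚ)
  open Rationals
  open Polynomials F
  open SquareFreePolynomials F
  open Equidistribution F
  open PowerFibres F
  open LocalWeights F N 2≤N
  open Families F N 2≤N
  open Counts r

  private
    g : ℕ
    g = gcd m (card ∸ 1)

    g≡ : gcd m units ≡ g
    g≡ = cong (λ n → gcd m (n ∸ 1)) suc-units

    powers-g : powers r * g ≡ units
    powers-g = trans (cong (powers r *_) (sym (trans (roots-of-unity r) g≡))) (powers-fibre r)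

    instance
      g-nonZero : NonZero g
      g-nonZero = ℕ.≢-nonZero (λ e → units≢0 (trans (sym powers-g) (trans (cong (powers r *_) e) (*-zeroʳ (powers r)))))

    module Λ = Law card N units g (powers r) nonpowers powers-g powers+nonpowers

  probSum-law : ∀ k → probSum (law card m N) card k ℚ.* ι (∑ elements weight ^ card) ≡ ι (weighted card k)
  probSum-law k = trans (cong (λ z → probSum (law card m N) card k ℚ.* ι (z ^ card)) ∑-weight-total)
    (probSum-weighted {Λ.w₀} {Λ.w₁} {Λ.w} {g} {Λ.Z} weighted Λ.law₀ Λ.law₁ Λ.lawₘ refl (λ _ → refl)
      (λ n k → trans (weighted-suc n k) (cong (λ v → weight₀ * weighted n k + (weight₁ * select 1 k (weighted n) + weightₘ * select v k (weighted n))) g≡))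
      card k)

  Limit : (In : ℕ → Poly → Set (c ⊔ ℓ)) → ℕ → Set (c ⊔ ℓ)
  Limit In k = ∀ (ε : ℚ) → 0ℚ ℚ.< ε → ∃ λ D → ∀ d → D ≤ d → ∀ (A B : ℕ) →
    HasSize Poly _≈P_ (λ f → In d f × PointCount m f k) A → HasSize Poly _≈P_ (In d) B → (nz : NonZero B) →
    ℚ.∣ (ℚ._/_ (ℤ.+ A) B {{nz}}) ℚ.- probSum (law card m N) card k ∣ ℚ.< ε

  1≤∑weight : 1 ≤ ∑ elements weight ^ card
  1≤∑weight = m^n>0 (∑ elements weight) {{ℕ.≢-nonZero total≢0}} card
    where
    total≢0 : ¬ (∑ elements weight ≡ 0)
    total≢0 e = units≢0 (m*n≡0⇒m≡0 units (card ^ N + (card + 1)) {{ℕ.≢-nonZero (λ z → 1+n≢0 (trans (+-comm 1 card) (m+n≡0⇒n≡0 (card ^ N) z)))}}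
      (m+n≡0⇒m≡0 weight₁ (m+n≡0⇒n≡0 weight₀ (trans (sym ∑-weight-total) e))))

  -- Sizes in the sense of `HasSize` are unique, so `A` and `B` are the lengths of the explicit
  -- lists, for which `governed-ratio` gives the estimate that `ratio-close` needs.
  governed⇒limit : ∀ {μ In} L → (∀ d → Enum _≈P_ (In d) (L d)) → Governed μ (count L) →
                   (∀ d → 2 ≤ d → card ^ d ≤ 2 * length (L d)) → ∀ k → Limit In k
  -- The added 2 is the degree from which the lower bound `many` holds.
  governed⇒limit {μ} {In} L enumL gov many k ε 0<ε = 2 + D , close
    where
    a = proj₁ (archimedean ε 0<ε)
    3≤εa = proj₂ (archimedean ε 0<ε)
    D = proj₁ (governed-ratio gov k a)
    near = proj₂ (governed-ratio gov k a)
    points-cong : ∀ {f f′} → f ≈P f′ → points-on-curve m f ≡ points-on-curve m f′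
    points-cong e = ∑-cong elements (λ x → fibre-cong m (eval-cong x e))
    at-k : ∀ f → Dec (points-on-curve m f ≡ k)
    at-k f = points-on-curve m f ℕ.≟ k
    enum-k : ∀ d → Enum _≈P_ (λ f → In d f × PointCount m f k) (filter at-k (L d))
    enum-k d = enum-⇔ (λ f (i , e) → i , ≡⇒pointCount {m} {f} e) (λ f (i , p) → i , pointCount⇒≡ {m} {f} p)
      (enum-filter ≈P-equiv at-k (λ e e′ → trans (sym (points-cong e)) e′) (enumL d))
    size : ∀ {Q : Poly → Set (c ⊔ ℓ)} {K n} → Enum _≈P_ Q K → HasSize Poly _≈P_ Q n → length K ≡ n
    size e (K′ , eq , mem , dis , cov) = trans (enum-length ≈P-equiv e (enum mem dis cov)) eq
    count-k : ∀ d → count L (δ k) d ≡ length (filter at-k (L d))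
    count-k d = trans (∑-cong (L d) (λ f → sym (*-identityʳ _))) (trans (sym (∑-filter at-k (L d) (λ _ → 1))) (∑-length (filter at-k (L d))))
    close : ∀ d → 2 + D ≤ d → ∀ (A B : ℕ) → HasSize Poly _≈P_ (λ f → In d f × PointCount m f k) A → HasSize Poly _≈P_ (In d) B → (nz : NonZero B) →
      ℚ.∣ (ℚ._/_ (ℤ.+ A) B {{nz}}) ℚ.- probSum (law card m N) card k ∣ ℚ.< ε
    close d D≤d A (suc b) sA sB _ = ratio-close {A} {b} {weighted card k} {∑ elements weight ^ card} {a} 1≤∑weight (probSum-law k) 3≤εa
      (near-≤ (≤-trans (many d (≤-trans (m≤m+n 2 D) D≤d)) (≤-reflexive (cong (2 *_) (size (enumL d) sB))))
        (near-cong (cong (λ n → a * (∑ elements weight ^ card * n)) (trans (count-k d) (size (enum-k d) sA)))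
                   (cong (λ n → a * (weighted card k * n)) (trans (∑-length (L d)) (size (enumL d) sB)))
                   (near d (≤-trans (m≤n+m D 2) D≤d))))

  family-limit : ∀ k → Limit (InF N) k
  family-limit = governed⇒limit familyList enum-family family-governed family-many

  hat-limit : ∀ k → Limit (InFhat N) k
  hat-limit = governed⇒limit hatList enum-hat hat-governed hat-many

open import Data.Integer using (+_)
open import Data.Rational using (ℚ; 0ℚ; _/_; _-_; _<_; ∣_∣)

theorem1p1 : ∀ {c ℓ : Level} (F : FiniteField c ℓ) (m N k : ℕ) → 2 ≤ m → 2 ≤ N →
    (∀ (ε : ℚ) → 0ℚ < ε → ∃ λ D → ∀ d → D ≤ d → ∀ (A B : ℕ) →
    HasSize (FiniteField.Poly F) (FiniteField._≈P_ F) (λ f → FiniteField.InF F N d f × FiniteField.PointCount F m f k) A →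
    HasSize (FiniteField.Poly F) (FiniteField._≈P_ F) (FiniteField.InF F N d) B →
    (nz : NonZero B) →
    ∣ (_/_ (+ A) B {{nz}}) - probSum (law (FiniteField.card F) m N) (FiniteField.card F) k ∣ < ε)
    ×
    (∀ (ε : ℚ) → 0ℚ < ε → ∃ λ D → ∀ d → D ≤ d → ∀ (A B : ℕ) →
    HasSize (FiniteField.Poly F) (FiniteField._≈P_ F) (λ f → FiniteField.InFhat F N d f × FiniteField.PointCount F m f k) A →
    HasSize (FiniteField.Poly F) (FiniteField._≈P_ F) (FiniteField.InFhat F N d) B →
    (nz : NonZero B) →
    ∣ (_/_ (+ A) B {{nz}}) - probSum (law (FiniteField.card F) m N) (FiniteField.card F) k ∣ < ε)
theorem1p1 F (suc r) N k _ 2≤N = Limits.family-limit F N 2≤N r k , Limits.hat-limit F N 2≤N r k
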